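{- Let $\gamma$ and $\delta$ be diagrams with $\gamma\subset\delta$ and $|\delta|=n$. Then the induced subgraph $\mathcal P_\delta$ of the Assaf graph $\mathcal H_\delta$ on the vertex set $\{\pi\in S_n:\mathrm{inv}_\delta(\pi)=0\}$ and the induced subgraph $\mathcal R_{\gamma,\delta}$ of $\mathcal H_\delta$ on the vertex set $\{\pi\in S_n:\mathrm{inv}_\delta(\pi)=0,\ \mathrm{Descent}_\delta(\pi)=\gamma\}$ (each with the signature function and colored edges inherited from $\mathcal H_\delta$) are dual equivalence graphs.
   Context: Diagram: finite $\delta\subset\mathbb Z\times\mathbb Z$ of cells $(x,y)$, numbered $1,\dots,|\delta|$ in row reading order (rows top to bottom, each left to right). $T_\delta(\pi)$ is the filling of $\delta$ with row reading word $\pi$. Pistol starting at $c=(x,y)\in\delta$: cells $(x',y)\in\delta$ with $x'\ge x$ together with cells $(x',y-1)\in\delta$ with $x'\le x$; a set of indices is $\delta$-pistoled if its cells lie in a common pistol. Statistics for a filling $T$ of $\delta$: a descent is $c=(x,y)\in\delta$ with $(x,y-1)\in\delta$ and $T(c)>T(x,y-1)$; $\mathrm{Descent}(T)$ is the set of descents. For positions $c=(x,y)$, $d=(x',y)$, $x'>x$, $e=(x,y-1)$ with $d\in\delta$: if $c,d,e\in\delta$ they form an inversion triple when $T(e)<T(d)<T(c)$ or $T(c)\le T(e)<T(d)$ or $T(d)<T(c)\le T(e)$; if $c\notin\delta$, $d,e\in\delta$, $\{d,e\}$ is an inversion pair when $T(d)>T(e)$; if $e\notin\delta$, $c,d\in\delta$,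 $\{c,d\}$ is an inversion pair when $T(c)>T(d)$. $\mathrm{inv}(T)$ = number of inversion triples plus inversion pairs. $\mathrm{inv}_\delta(\pi)=\mathrm{inv}(T_\delta(\pi))$, $\mathrm{Descent}_\delta(\pi)=\mathrm{Descent}(T_\delta(\pi))$. Signature: $\sigma(\pi)_i=+1$ iff $i$ precedes $i+1$ in $\pi$, else $-1$. $d_i$ ($1<i<n$): $d_i(\dots i\dots i{ - }1\dots i{+}1\dots)=(\dots i{+}1\dots i{ - }1\dots i\dots)$, $d_i(\dots i{ - }1\dots i{+}1\dots i\dots)=(\dots i\dots i{+}1\dots i{ - }1\dots)$, identity if $i$ lies between $i\pm1$. $\tilde d_i$: $\tilde d_i(\dots i\dots i{ - }1\dots i{+}1\dots)=(\dots i{ - }1\dots i{+}1\dots i\dots)$, $\tilde d_i(\dots i\dots i{+}1\dots i{ - }1\dots)=(\dots i{+}1\dots i{ - }1\dots i\dots)$, identity if $i$ lies between $i\pm1$. $D_i^\delta(\pi)=\tilde d_i(\pi)$ if the positions of $i-1,i,i+1$ in $\pi$ are $\delta$-pistoled, else $d_i(\pi)$. The Assaf graph $\mathcal H_\delta$: vertices $S_n$, signature $\sigma$, edges $E_i=\{\{\pi,D_i^\delta\pi\}:D_i^\delta\pi\ne\pi\}$, $2\le i\le n-1$. Signed colored graph $(V,\sigma,E)$: finite $V$, $\sigma:V\to\{\pm1\}^{n-1}$, sets $E_i$ ($2\le i\le n-1$) of pairs of distinct vertices. Isomorphisms preserve signatures and colored edges in both directions. Restriction $\mathcal G|_I$ to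 an integer interval $I$: same vertices, $\sigma'(v)_i=\sigma(v)_{\min I+i-1}$ ($1\le i\le |I|-1$), $E'_i=E_{\min I+i-1}$ ($2\le i\le|I|-1$), when defined. $\mathcal G_\lambda$ ($\lambda$ a partition, French notation): vertices the standard Young tableaux of shape $\lambda$, signature $\sigma$ of the row reading word, $i$-edges $\{T,d_i(T)\}$ for $d_i(T)\ne T$ ($d_i$ acting on the reading word). A dual equivalence graph is a signed colored graph such that (Locally Standard) for every integer interval $I$ with $|I|=6$ each component of $\mathcal G|_I$ is isomorphic to some $\mathcal G_\lambda$, and (Commuting) whenever $\{v,w\}\in E_i$, $\{w,x\}\in E_j$ with $|i-j|>2$ there is $y$ with $\{v,y\}\in E_j$, $\{x,y\}\in E_i$. -}

module Defs where

open import Data.Bool using (Bool; true; false; _∧_; _∨_; not; T; if_then_else_)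
open import Data.Nat as ℕ using (ℕ; zero; suc; _+_; _∸_; _≤_; _<_; _≡ᵇ_; _<ᵇ_; _≤ᵇ_; ∣_-_∣)
open import Data.Integer as ℤ using (ℤ; +_)
import Data.Integer.Properties as ℤP
open import Data.Product using (Σ; ∃; _×_; _,_; proj₁; proj₂)
open import Data.Sum using (_⊎_)
open import Data.List using (List; []; _∷_; map; length; upTo; concat; reverse; filterᵇ)
open import Data.Bool.ListAction using (all; any)
open import Data.Nat.ListAction using (sum)
open import Data.List.Membership.Propositional using (_∈_)
open import Data.List.Relation.Unary.AllPairs using (AllPairs)
open import Data.List.Relation.Unary.All using (All)
open import Data.List.Relation.Unary.Linked using (Linked)
open import Data.Maybe using (Maybe; just; nothing)
open import Relation.Nullary using (¬_)
open import Relation.Nullary.Decidable using (⌊_⌋)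
open import Relation.Binary.PropositionalEquality using (_≡_; _≢_)
open import Relation.Binary.Construct.Closure.ReflexiveTransitive using (Star)
open import Function.Bundles using (_⇔_)

-- A cell (x , y) : x = column, y = row (y increases upwards).
Cell : Set
Cell = ℤ × ℤ

_≺_ : Cell → Cell → Set
(x , y) ≺ (x' , y') = (y' ℤ.< y) ⊎ (y ≡ y' × x ℤ.< x')

-- A diagram is a finite set of cells, represented canonically by the list
-- of its cells in row reading order (strictly increasing, hence no
-- duplicates).  The cell numbered j (1-based) is the j-th list element.
record Diagram : Set where
  constructor mkDiagram
  field
    cells  : List Cell
    sorted : AllPairs _≺_ cells
open Diagram public

_⊆ᴰ_ : Diagram → Diagram → Set
γ ⊆ᴰ δ = ∀ c → c ∈ cells γ → c ∈ cells δ

_==ℤ_ : ℤ → ℤ → Bool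
a ==ℤ b = ⌊ a ℤP.≟ b ⌋

_<ℤ_ : ℤ → ℤ → Bool
a <ℤ b = ⌊ a ℤP.<? b ⌋

_≤ℤ_ : ℤ → ℤ → Bool
a ≤ℤ b = ⌊ a ℤP.≤? b ⌋

_==ᶜ_ : Cell → Cell → Bool
(x , y) ==ᶜ (x' , y') = (x ==ℤ x') ∧ (y ==ℤ y')

memb : Cell → List Cell → Bool
memb c cs = any (c ==ᶜ_) cs

below : Cell → Cell
below (x , y) = (x , y ℤ.- ℤ.1ℤ)

right : Cell → Cell
right (x , y) = (x ℤ.+ ℤ.1ℤ , y)

above : Cell → Cell
above (x , y) = (x , y ℤ.+ ℤ.1ℤ)

b2n : Bool → ℕ
b2n true  = 1
b2n false = 0

range1 : ℕ → List ℕ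
range1 n = map suc (upTo n)

isPerm : ℕ → List ℕ → Bool
isPerm n π = (length π ≡ᵇ n) ∧ all (λ k → any (k ≡ᵇ_) π) (range1 n)

-- value of the filling T_cs(π) (row reading word π) at cell c
-- (0 if c is not a cell; only used for cells of the diagram).
val : List Cell → List ℕ → Cell → ℕ
val []       _        c = 0
val (_ ∷ _)  []       c = 0
val (d ∷ ds) (v ∷ vs) c = if c ==ᶜ d then v else val ds vs c

cellAt : List Cell → ℕ → Maybe Cell
cellAt []       _       = nothing
cellAt (c ∷ cs) zero    = just c
cellAt (c ∷ cs) (suc p) = cellAt cs p

pos : ℕ → List ℕ → ℕ
pos v []       = 0
pos v (w ∷ ws) = if v ≡ᵇ w then 0 else suc (pos v ws)

invTriple : ℕ → ℕ → ℕ → Bool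
invTriple tc td te =
  ((te <ᵇ td) ∧ (td <ᵇ tc)) ∨ ((tc ≤ᵇ te) ∧ (te <ᵇ td)) ∨ ((td <ᵇ tc) ∧ (tc ≤ᵇ te))

-- Number of inversion triples plus inversion pairs of T_cs(π).
-- Positions c = (x,y), d = (x',y), x' > x, e = (x,y-1), d a cell.
--  * first sum : c a cell (then either e a cell: triple; or e not: pair {c,d})
--  * second sum: e a cell and c not a cell (pair {d,e})
-- (if neither c nor e is a cell nothing is counted)
invW : List Cell → List ℕ → ℕ
invW cs π =
  sum (map (λ d → sum (map (λ c →
        b2n ((proj₂ c ==ℤ proj₂ d) ∧ (proj₁ c <ℤ proj₁ d))
        ℕ.* b2n (if memb (below c) cs
                 then invTriple (T' c) (T' d) (T' (below c))
                 else (T' d <ᵇ T' c))) cs)) cs)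
  + sum (map (λ d → sum (map (λ e →
        b2n ((proj₂ e ==ℤ (proj₂ d ℤ.- ℤ.1ℤ)) ∧ (proj₁ e <ℤ proj₁ d)
             ∧ not (memb (proj₁ e , proj₂ d) cs))
        ℕ.* b2n (T' e <ᵇ T' d)) cs)) cs)
  where
  T' : Cell → ℕ
  T' = val cs π

invδ : Diagram → List ℕ → ℕ
invδ δ π = invW (cells δ) π

descentsW : List Cell → List ℕ → List Cell
descentsW cs π =
  filterᵇ (λ c → memb (below c) cs ∧ (val cs π (below c) <ᵇ val cs π c)) cs

Descentδ : Diagram → List ℕ → List Cell
Descentδ δ π = descentsW (cells δ) π

-- σ(π)_i = +1 (true) iff i precedes i+1 in π
sig : List ℕ → ℕ → Bool
sig π i = pos i π <ᵇ pos (suc i) π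

swapV : ℕ → ℕ → ℕ → ℕ
swapV a b k = if k ≡ᵇ a then b else (if k ≡ᵇ b then a else k)

cyc3 : ℕ → ℕ → ℕ → ℕ → ℕ
cyc3 p q r k =
  if k ≡ᵇ p then q else (if k ≡ᵇ q then r else (if k ≡ᵇ r then p else k))

-- d_i : if i is not between i-1 and i+1, swap i with whichever of i±1 is
-- farther from it; otherwise identity.  This is the involution given by
--   (..i..i-1..i+1..) ↔ (..i+1..i-1..i..),  (..i-1..i+1..i..) ↔ (..i..i+1..i-1..).
dOp : ℕ → List ℕ → List ℕ
dOp i π =
  if iFirst then map (swapV i (if pa <ᵇ pc then suc i else i ∸ 1)) π
  else (if iLast then map (swapV i (if pa <ᵇ pc then i ∸ 1 else suc i)) π
  else π)
  where
  pa = pos (i ∸ 1) π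
  pb = pos i π
  pc = pos (suc i) π
  iFirst = (pb <ᵇ pa) ∧ (pb <ᵇ pc)
  iLast  = (pa <ᵇ pb) ∧ (pc <ᵇ pb)

-- d̃_i : (i,u,w) ↔ (u,w,i) on the positions of i-1,i,i+1 (u,w the other two
-- letters in their order); identity if i is between i-1 and i+1.  I.e.
--   (..i..i-1..i+1..) ↔ (..i-1..i+1..i..),  (..i..i+1..i-1..) ↔ (..i+1..i-1..i..).
dtOp : ℕ → List ℕ → List ℕ
dtOp i π =
  if iFirst then map (cyc3 i o1 o2) π
  else (if iLast then map (cyc3 o1 i o2) π
  else π)
  where
  pa = pos (i ∸ 1) π
  pb = pos i π
  pc = pos (suc i) π
  iFirst = (pb <ᵇ pa) ∧ (pb <ᵇ pc)
  iLast  = (pa <ᵇ pb) ∧ (pc <ᵇ pb)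
  o1 = if pa <ᵇ pc then i ∸ 1 else suc i
  o2 = if pa <ᵇ pc then suc i else i ∸ 1

inPistol : Cell → Maybe Cell → Bool
inPistol (x , y) nothing = false
inPistol (x , y) (just (x' , y')) =
  ((y' ==ℤ y) ∧ (x ≤ℤ x')) ∨ ((y' ==ℤ (y ℤ.- ℤ.1ℤ)) ∧ (x' ≤ℤ x))

pistoled : List Cell → List ℕ → Bool
pistoled cs ps = any (λ c → all (λ p → inPistol c (cellAt cs p)) ps) cs

Dδ : List Cell → ℕ → List ℕ → List ℕ
Dδ cs i π =
  if pistoled cs (pos (i ∸ 1) π ∷ pos i π ∷ pos (suc i) π ∷ [])
  then dtOp i π else dOp i π

-- signature indices 1..n-1 and edge colours 2..n-1 are the meaningful ones
record SCG (n : ℕ) : Set₁ where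
  field
    V : Set
    σ : V → ℕ → Bool          -- true = +1
    E : ℕ → V → V → Set       -- E i v w : {v,w} ∈ E_i
open SCG public

wordGraph : (n : ℕ) → (ℕ → List ℕ → List ℕ) → SCG n
wordGraph n D = record
  { V = Σ (List ℕ) (λ π → T (isPerm n π))
  ; σ = λ v i → sig (proj₁ v) i
  ; E = λ i v w → (proj₁ v ≢ proj₁ w)
                  × ((proj₁ w ≡ D i (proj₁ v)) ⊎ (proj₁ v ≡ D i (proj₁ w)))
  }

induced : ∀ {n} (G : SCG n) → (V G → Set) → SCG n
induced G P = record
  { V = Σ (V G) P
  ; σ = λ v i → σ G (proj₁ v) i
  ; E = λ i v w → E G i (proj₁ v) (proj₁ w)
  }

-- restriction to the interval I = [a , a + m - 1]
restrict : ∀ {n} (G : SCG n) (a m : ℕ) → SCG m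
restrict G a m = record
  { V = V G
  ; σ = λ v i → σ G v (a + i ∸ 1)
  ; E = λ i → E G (a + i ∸ 1)
  }

Adj : ∀ {n} (G : SCG n) → V G → V G → Set
Adj {n} G v w = ∃ λ i → (2 ≤ i) × (i ≤ n ∸ 1) × (E G i v w ⊎ E G i w v)

Reach : ∀ {n} (G : SCG n) → V G → V G → Set
Reach G = Star (Adj G)

ComponentIso : ∀ {n} (G : SCG n) (v : V G) (H : SCG n) → Set
ComponentIso {n} G v H =
  Σ (V H → V G) λ f →
      (∀ h h' → f h ≡ f h' → h ≡ h')
    × (∀ w → Reach G v w → ∃ λ h → f h ≡ w)
    × (∀ h → Reach G v (f h))
    × (∀ h i → 1 ≤ i → i ≤ n ∸ 1 → σ G (f h) i ≡ σ H h i)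
    × (∀ h h' i → 2 ≤ i → i ≤ n ∸ 1 → (E G i (f h) (f h') ⇔ E H i h h'))

IsPartition : List ℕ → Set
IsPartition λs = Linked (λ a b → b ≤ a) λs × All (λ a → 0 < a) λs

-- French diagram of λ: row y (y = 1 bottom) has cells x = 1..λ_y;
-- listed in row reading order (top row first).
rowsFrom : ℕ → List ℕ → List (List Cell)
rowsFrom y []        = []
rowsFrom y (k ∷ ks)  = map (λ x → (+ suc x , + y)) (upTo k) ∷ rowsFrom (suc y) ks

diagλ : List ℕ → List Cell
diagλ λs = concat (reverse (rowsFrom 1 λs))

isSYTword : ℕ → List ℕ → List ℕ → Bool
isSYTword n λs π =
  (length D ≡ᵇ n) ∧ all (λ c →
     (if memb (right c) D then val D π c <ᵇ val D π (right c) else true)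
   ∧ (if memb (above c) D then val D π c <ᵇ val D π (above c) else true)) D
  where
  D = diagλ λs

-- G_λ, with signature length n - 1 (n = |λ|); vertices = SYT of shape λ
-- identified with their row reading words; i-edges {T, d_i T}.
Gλ : (n : ℕ) → List ℕ → SCG n
Gλ n λs = induced (wordGraph n dOp) (λ v → T (isSYTword n λs (proj₁ v)))

LocallyStandard : ∀ {n} → SCG n → Set
LocallyStandard {n} G =
  ∀ a → 1 ≤ a → a + 5 ≤ n → ∀ (v : V G) →
    ∃ λ (λs : List ℕ) → IsPartition λs × (sum λs ≡ 6)
      × ComponentIso (restrict G a 6) v (Gλ 6 λs)

Commuting : ∀ {n} → SCG n → Set
Commuting {n} G =
  ∀ i j → 2 ≤ i → i ≤ n ∸ 1 → 2 ≤ j → j ≤ n ∸ 1 → 2 < ∣ i - j ∣ →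
  ∀ v w x → E G i v w → E G j w x →
  ∃ λ y → E G j v y × E G i x y

IsDEG : ∀ {n} → SCG n → Set
IsDEG G = LocallyStandard G × Commuting G

Hδ : (δ : Diagram) → SCG (length (cells δ))
Hδ δ = wordGraph (length (cells δ)) (Dδ (cells δ))

Pδ : (δ : Diagram) → SCG (length (cells δ))
Pδ δ = induced (Hδ δ) (λ v → invδ δ (proj₁ v) ≡ 0)

-- Descent set = γ (both listed canonically in row reading order)
Rγδ : (γ δ : Diagram) → SCG (length (cells δ))
Rγδ γ δ = induced (Hδ δ)
  (λ v → (invδ δ (proj₁ v) ≡ 0) × (Descentδ δ (proj₁ v) ≡ cells γ))

{-# OPTIONS --safe #-}
module Submission where

-- For an inversion-free filling π let r(k) be the row containing k.  Then
--   * π is determined by r: scanning the rows upwards and each row from left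
--     to right, the cyclic order with the entry below forces every entry;
--   * i precedes i+1 in π iff r(i) ≥ r(i+1);
--   * D_i preserves being inversion-free and the descent set, and acts on r as
--     d_i acts on the word obtained from π by sorting every row.  Indeed a
--     δ-pistoled triple i-1, i, i+1 on which D_i is not the identity occupies
--     two cells of a row and the cell below the left one, where d̃_i rotates it
--     between (i, i+1 over i-1) and (i+1, i-1 over i); otherwise D_i = d_i swaps
--     two consecutive values which lie in no common pistol.
-- So the components of the restriction to six consecutive values map to
-- components of the dual equivalence graph on S₆, injectively because no other
-- value moves.  On S₆ the insertion tableau is compatible with d_i, and moves
-- leading every tableau to a fixed one of its shape show that a component is
-- isomorphic to the graph of standard tableaux; this is checked on all of S₆.

open import Defs
open import Algebra.Bundles using (module AbelianGroup)
open import Algebra.Properties.Group using (∙-cancelʳ)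
open import Axiom.UniquenessOfIdentityProofs using (module Decidable⇒UIP)
open import Data.Bool using (Bool; T; _∧_; _∨_; false; if_then_else_; not; true)
open import Data.Bool.ListAction using (all)
open import Data.Bool.Properties using (T-irrelevant; T-∧; T-∨; T-≡; T?) renaming (_≟_ to _≟ᵇ_)
open import Data.Empty using (⊥; ⊥-elim)
open import Data.Fin using (Fin)
open import Data.Fin.Induction using (spo-wellFounded)
open import Data.Integer as ℤ using (ℤ)
import Data.Integer.Properties as ℤP
open import Data.List using (List; []; [_]; _++_; _∷_; concat; concatMap; filterᵇ; foldl; length; lookup; map; reverse)
open import Data.List.Membership.Propositional using (_∈_; _∉_; find; lose)
open import Data.List.Membership.Propositional.Properties using (∈-++⁺ʳ; ∈-++⁺ˡ; ∈-++⁻; ∈-concatMap⁺; ∈-lookup; ∈-map⁺; ∈-map⁻; ∈-upTo⁺; ∈-upTo⁻; ∈-∃++)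
open import Data.List.Properties as ListP using (length-map; map-cong; map-id; map-∘; unfold-reverse; ∷-injective)
open import Data.List.Relation.Binary.Permutation.Propositional using (_↭_; prep; swap; ↭-refl; ↭-sym; ↭-trans; ↭⇒↭ₛ)
open import Data.List.Relation.Binary.Permutation.Propositional.Properties using (All-resp-↭; shift; ↭-length; ∈-resp-↭)
import Data.List.Relation.Binary.Permutation.Setoid.Properties as PermS
open import Data.List.Relation.Unary.All as All using (All; []; _∷_; all?)
import Data.List.Relation.Unary.All.Properties as AllP
open import Data.List.Relation.Unary.AllPairs as AllPairs using (AllPairs; []; _∷_)
import Data.List.Relation.Unary.AllPairs.Properties as AllPairsP
open import Data.List.Relation.Unary.Any as Any using (Any; any?; here; there)
open import Data.List.Relation.Unary.Any.Properties as AnyP using (lookup-index)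
open import Data.List.Relation.Unary.Linked using (linked?)
open import Data.List.Relation.Unary.Unique.Propositional using (Unique)
open import Data.Maybe using (Maybe; just; nothing)
open import Data.Maybe.Properties using (just-injective)
open import Data.Nat as ℕ using (_*_; _+_; _<_; _<ᵇ_; _∸_; _≡ᵇ_; _≤?_; _≤_; _≤ᵇ_; suc; s≤s; zero; z≤n; ℕ; ∣_-_∣)
open import Data.Nat.ListAction using (sum)
import Data.Nat.Properties as ℕP
open import Data.Product using (_,_; _×_; proj₁; proj₂; ∃)
import Data.Product.Properties as ×P
open import Data.Sum as Sum using (_⊎_; inj₁; inj₂)
open import Function.Bundles using (Equivalence; _⇔_; mk⇔)
open import Induction.WellFounded using (Acc; acc)
open import Relation.Binary.Construct.Closure.ReflexiveTransitive using (_◅_; _◅◅_; ε)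
open import Relation.Binary.Definitions using (tri<; tri>; tri≈)
open import Relation.Binary.PropositionalEquality using (_≡_; _≢_; cong; cong₂; isEquivalence; module ≡-Reasoning; refl; setoid; subst; subst₂; sym; trans; ≢-sym)
open import Relation.Binary.Structures using (IsEquivalence; IsStrictPartialOrder)
open import Relation.Nullary using (Dec; no; yes; ¬_)
open import Relation.Nullary.Decidable using (_×-dec_; _→-dec_; from-yes; fromWitness; toWitness)

-- Dual equivalence and row insertion on S₆

-- Whether `Dδ` acts by d_i or by d̃_i depends on cells of the diagram, which no finite table of
-- six-letter words can record. The row function r removes this dependence. On a pistoled triple
-- that it moves, the 3-cycle d̃_i gives the same rows as the transposition `rowDual`, because two
-- of the three values share a row. Thus neither the involutivity of D_i nor the commutation of
-- distant D_i, D_j is proved on fillings: both are identities for `rowDual`, carried back because r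
-- determines the filling.
--
-- The passage to S₆ forgets in which rows the six values lie. What it forgets is the list of these
-- rows in sorted order together with the rows of all other values, and every move of the window
-- preserves this, so nothing is lost inside a component.
--
-- On S₆ a component has to be matched with all tableaux of one shape. Each tableau has a path to
-- one fixed tableau of its shape, and from any w the path of its insertion tableau ends at a vertex
-- which depends only on the component of w. This gives an explicit inverse of insertion: go to that
-- end and walk back along the path of the wanted tableau.

Word : Set
Word = List ℕ

insertions : ℕ → Word → List Word
insertions x []       = (x ∷ []) ∷ []
insertions x (y ∷ ys) = (x ∷ y ∷ ys) ∷ map (y ∷_) (insertions x ys)

perms : ℕ → List Word
perms zero    = [] ∷ []
perms (suc n) = concatMap (insertions (suc n)) (perms n)

rowInsert : ℕ → Word → Word × Maybe ℕ
rowInsert x []       = x ∷ [] , nothing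
rowInsert x (y ∷ ys) with x <ᵇ y
... | true  = x ∷ ys , just y
... | false = let (ys' , b) = rowInsert x ys in y ∷ ys' , b

insert : List Word → ℕ → List Word
insert []       x = (x ∷ []) ∷ []
insert (r ∷ rs) x with rowInsert x r
... | r' , nothing = r' ∷ rs
... | r' , just b  = r' ∷ insert rs b

rsk : Word → List Word
rsk = foldl insert []

opaque
  -- The rows of `rsk` are listed from the bottom, so reversing them gives the row reading word in
  -- French notation. It is kept opaque: later arguments need only what `rskFacts` has checked.
  insertionWord : Word → Word
  insertionWord w = concat (reverse (rsk w))

  shape : Word → List ℕ
  shape w = map length (rsk w)

run : Word → Word → Word
run []      w = w
run (i ∷ p) w = run p (dOp i w)

colours : List ℕ
colours = 2 ∷ 3 ∷ 4 ∷ 5 ∷ []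

-- Single moves alone get stuck in local minima; pairs of moves do not.
moves : List Word
moves = map (_∷ []) colours ++ concatMap (λ i → map (λ j → i ∷ j ∷ []) colours) colours

decimal : Word → ℕ
decimal = foldl (λ m k → 10 * m + k) 0

firstDecreasing : List Word → Word → Word
firstDecreasing []       w = []
firstDecreasing (m ∷ ms) w = if decimal (run m w) <ᵇ decimal w then m else firstDecreasing ms w

descend : ℕ → Word → Word
descend zero    w = []
descend (suc k) w with firstDecreasing moves w
... | []        = []
... | m@(_ ∷ _) = m ++ descend k (run m w)

opaque
  -- The fuel bounds the rounds of one or two moves each. That 16 rounds reach the least tableau of
  -- every shape is not argued but checked, through `Canonical`.
  path : Word → Word
  path = descend 16

-- The partitions of 6, each with the lexicographically least reading word
-- of a standard tableau of that shape.
table : List (List ℕ × Word)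
table =
    (6 ∷ []                         , 1 ∷ 2 ∷ 3 ∷ 4 ∷ 5 ∷ 6 ∷ [])
  ∷ (5 ∷ 1 ∷ []                     , 2 ∷ 1 ∷ 3 ∷ 4 ∷ 5 ∷ 6 ∷ [])
  ∷ (4 ∷ 2 ∷ []                     , 2 ∷ 4 ∷ 1 ∷ 3 ∷ 5 ∷ 6 ∷ [])
  ∷ (4 ∷ 1 ∷ 1 ∷ []                 , 3 ∷ 2 ∷ 1 ∷ 4 ∷ 5 ∷ 6 ∷ [])
  ∷ (3 ∷ 3 ∷ []                     , 2 ∷ 4 ∷ 6 ∷ 1 ∷ 3 ∷ 5 ∷ [])
  ∷ (3 ∷ 2 ∷ 1 ∷ []                 , 3 ∷ 2 ∷ 5 ∷ 1 ∷ 4 ∷ 6 ∷ [])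
  ∷ (3 ∷ 1 ∷ 1 ∷ 1 ∷ []             , 4 ∷ 3 ∷ 2 ∷ 1 ∷ 5 ∷ 6 ∷ [])
  ∷ (2 ∷ 2 ∷ 2 ∷ []                 , 3 ∷ 6 ∷ 2 ∷ 5 ∷ 1 ∷ 4 ∷ [])
  ∷ (2 ∷ 2 ∷ 1 ∷ 1 ∷ []             , 4 ∷ 3 ∷ 2 ∷ 6 ∷ 1 ∷ 5 ∷ [])
  ∷ (2 ∷ 1 ∷ 1 ∷ 1 ∷ 1 ∷ []         , 5 ∷ 4 ∷ 3 ∷ 2 ∷ 1 ∷ 6 ∷ [])
  ∷ (1 ∷ 1 ∷ 1 ∷ 1 ∷ 1 ∷ 1 ∷ []     , 6 ∷ 5 ∷ 4 ∷ 3 ∷ 2 ∷ 1 ∷ [])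
  ∷ []

_≟ʷ_ : (u v : Word) → Dec (u ≡ v)
_≟ʷ_ = ListP.≡-dec ℕP._≟_

-- In the last clause the path is computed from the insertion tableau but applied to the word
-- itself. The clause says that neighbours in the graph on S₆ reach the same end, whence one base
-- point for each component.
Equivariant : Word → ℕ → Set
Equivariant w i =
    insertionWord (dOp i w) ≡ dOp i (insertionWord w)
  × shape (dOp i w) ≡ shape w
  × T (isPerm 6 (dOp i w))
  × dOp i (dOp i w) ≡ w
  × run (path (insertionWord (dOp i w))) (dOp i w) ≡ run (path (insertionWord w)) w

equivariant? : ∀ w i → Dec (Equivariant w i)
equivariant? w i =
  (_ ≟ʷ _) ×-dec (_ ≟ʷ _) ×-dec T? _ ×-dec (_ ≟ʷ _) ×-dec (_ ≟ʷ _)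

-- A tableau inserts to itself, and all tableaux of one shape run to the same word `c`; so they are
-- connected to each other.
Canonical : Word → List ℕ × Word → Set
Canonical w (μ , c) =
  T (isSYTword 6 μ w) → insertionWord w ≡ w × shape w ≡ μ × run (path w) w ≡ c

canonical? : ∀ w t → Dec (Canonical w t)
canonical? w t = T? _ →-dec ((_ ≟ʷ _) ×-dec (_ ≟ʷ _) ×-dec (_ ≟ʷ _))

RSKFacts : Word → Set
RSKFacts w =
    T (isPerm 6 (insertionWord w))
  × T (isSYTword 6 (shape w) (insertionWord w))
  × Any (λ t → shape w ≡ proj₁ t) table
  × All (λ i → sig (insertionWord w) i ≡ sig w i) (1 ∷ colours)
  × All (λ i → 2 ≤ i × i ≤ 5) (path (insertionWord w))
  × All (Equivariant w) colours
  × All (Canonical w) table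

rskFacts? : ∀ w → Dec (RSKFacts w)
rskFacts? w =
  T? _ ×-dec T? _ ×-dec any? (λ t → shape w ≟ʷ proj₁ t) table
  ×-dec all? (λ i → _ ≟ᵇ _) (1 ∷ colours)
  ×-dec all? (λ i → (2 ≤? i) ×-dec (i ≤? 5)) (path (insertionWord w))
  ×-dec all? (equivariant? w) colours
  ×-dec all? (canonical? w) table

opaque
  unfolding insertionWord path

  rskFacts : All RSKFacts (perms 6)
  rskFacts = from-yes (all? rskFacts? (perms 6))

-- Permutations as words

IsPerm : ℕ → Word → Set
IsPerm n π = length π ≡ n × (∀ {k} → 1 ≤ k → k ≤ n → k ∈ π)

∈-range1⁺ : ∀ {n k} → 1 ≤ k → k ≤ n → k ∈ range1 n
∈-range1⁺ {k = suc k} _ k<n = ∈-map⁺ suc (∈-upTo⁺ k<n)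

∈-range1⁻ : ∀ {n k} → k ∈ range1 n → 1 ≤ k × k ≤ n
∈-range1⁻ k∈ with _ , j∈ , refl ← ∈-map⁻ suc k∈ = s≤s z≤n , ∈-upTo⁻ j∈

isPerm⇒IsPerm : ∀ n π → T (isPerm n π) → IsPerm n π
isPerm⇒IsPerm n π t with Equivalence.to T-∧ t
... | len , elems = ℕP.≡ᵇ⇒≡ _ _ len , λ 1≤k k≤n →
  Any.map (ℕP.≡ᵇ⇒≡ _ _) (AnyP.any⁻ _ π (All.lookup (AllP.all⁺ _ _ elems) (∈-range1⁺ 1≤k k≤n)))

IsPerm⇒isPerm : ∀ n π → IsPerm n π → T (isPerm n π)
IsPerm⇒isPerm n π (len , elems) = Equivalence.from T-∧
  ( ℕP.≡⇒≡ᵇ _ _ len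
  , AllP.all⁻ _ (All.tabulate λ k∈ → let (1≤k , k≤n) = ∈-range1⁻ k∈ in
      AnyP.any⁺ _ (Any.map (ℕP.≡⇒≡ᵇ _ _) (elems 1≤k k≤n))))

∈-skip : ∀ {A : Set} {k x : A} xs {ys} → k ≢ x → k ∈ xs ++ [ x ] ++ ys → k ∈ xs ++ ys
∈-skip xs k≢x k∈ with ∈-++⁻ xs k∈
... | inj₁ k∈xs          = ∈-++⁺ˡ k∈xs
... | inj₂ (here k≡x)    = ⊥-elim (k≢x k≡x)
... | inj₂ (there k∈ys)  = ∈-++⁺ʳ xs k∈ys

record Split (n : ℕ) (π : Word) : Set where
  constructor split
  field
    before after : Word
    eq           : π ≡ before ++ [ suc n ] ++ after
    rest         : IsPerm n (before ++ after)

-- `IsPerm` asks for the length n and the presence of 1, ..., n. Removing the largest value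
-- preserves both, and this induction replaces a pigeonhole argument: it yields the enumeration, the
-- range and the distinctness of the letters.
splitMax : ∀ {n π} → IsPerm (suc n) π → Split n π
splitMax {n} {π} (len , elems) with ∈-∃++ (elems (s≤s z≤n) ℕP.≤-refl)
... | xs , ys , refl = split xs ys refl
  ( ℕP.suc-injective (trans (sym (↭-length (shift (suc n) xs ys))) len)
  , λ 1≤k k≤n → ∈-skip xs (ℕP.<⇒≢ (s≤s k≤n)) (elems 1≤k (ℕP.m≤n⇒m≤1+n k≤n)))

∈-insertions : ∀ x xs ys → xs ++ [ x ] ++ ys ∈ insertions x (xs ++ ys)
∈-insertions x []       []       = here refl
∈-insertions x []       (y ∷ ys) = here refl
∈-insertions x (z ∷ xs) ys       = there (∈-map⁺ (z ∷_) (∈-insertions x xs ys))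

∈-perms : ∀ n π → IsPerm n π → π ∈ perms n
∈-perms zero    []      _       = here refl
∈-perms (suc n) π p with splitMax p
... | split xs ys refl rest =
  ∈-concatMap⁺ (insertions (suc n)) (lose (∈-perms n (xs ++ ys) rest) (∈-insertions (suc n) xs ys))

perm-range : ∀ {n π} → IsPerm n π → ∀ {k} → k ∈ π → 1 ≤ k × k ≤ n
perm-range {zero}  {[]} _ ()
perm-range {suc n} p k∈ with splitMax p
... | split xs ys refl rest with ∈-resp-↭ (shift (suc n) xs ys) k∈
...   | here refl = s≤s z≤n , ℕP.≤-refl
...   | there k∈' = let (1≤k , k≤n) = perm-range rest k∈' in 1≤k , ℕP.m≤n⇒m≤1+n k≤n

Unique-resp-↭ : ∀ {xs ys : Word} → xs ↭ ys → Unique xs → Unique ys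
Unique-resp-↭ p = PermS.Unique-resp-↭ (setoid ℕ) (↭⇒↭ₛ p)

perm-unique : ∀ {n π} → IsPerm n π → Unique π
perm-unique {zero}  {[]} _ = []
perm-unique {suc n} p with splitMax p
... | split xs ys refl rest = Unique-resp-↭ (↭-sym (shift (suc n) xs ys))
  (All.tabulate (λ k∈ → ≢-sym (ℕP.<⇒≢ (s≤s (proj₂ (perm-range rest k∈))))) ∷ perm-unique rest)

IsPerm-map : ∀ {n π} (f g : ℕ → ℕ) → (∀ k → f (g k) ≡ k) →
             (∀ {k} → 1 ≤ k → k ≤ n → 1 ≤ g k × g k ≤ n) →
             IsPerm n π → IsPerm n (map f π)
IsPerm-map {π = π} f g fg g-range (len , elems) =
  trans (length-map f π) len ,
  λ 1≤k k≤n → let (1≤gk , gk≤n) = g-range 1≤k k≤n in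
    subst (_∈ _) (fg _) (∈-map⁺ f (elems 1≤gk gk≤n))

-- Fillings

≡ᵇ-refl : ∀ k → (k ≡ᵇ k) ≡ true
≡ᵇ-refl k = Equivalence.to T-≡ (ℕP.≡⇒≡ᵇ k k refl)

≢⇒≡ᵇ-false : ∀ {j k} → j ≢ k → (j ≡ᵇ k) ≡ false
≢⇒≡ᵇ-false {j} {k} j≢k with j ≡ᵇ k in eq
... | false = refl
... | true  = ⊥-elim (j≢k (ℕP.≡ᵇ⇒≡ j k (Equivalence.from T-≡ eq)))

<⇒<ᵇ-true : ∀ {j k} → j < k → (j <ᵇ k) ≡ true
<⇒<ᵇ-true j<k = Equivalence.to T-≡ (ℕP.<⇒<ᵇ j<k)

≮⇒<ᵇ-false : ∀ {j k} → ¬ (j < k) → (j <ᵇ k) ≡ false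
≮⇒<ᵇ-false {j} {k} j≮k with j <ᵇ k in eq
... | false = refl
... | true  = ⊥-elim (j≮k (ℕP.<ᵇ⇒< j k (Equivalence.from T-≡ eq)))

<ᵇ-cong : ∀ {j k j' k'} → (j < k → j' < k') → (j' < k' → j < k) → (j <ᵇ k) ≡ (j' <ᵇ k')
<ᵇ-cong {j} {k} f g with j ℕP.<? k
... | yes j<k = trans (<⇒<ᵇ-true j<k) (sym (<⇒<ᵇ-true (f j<k)))
... | no  j≮k = trans (≮⇒<ᵇ-false j≮k) (sym (≮⇒<ᵇ-false (λ p → j≮k (g p))))

∧⁻ : ∀ a b → T (a ∧ b) → T a × T b
∧⁻ a b = Equivalence.to (T-∧ {a} {b})

∧⁺ : ∀ a b → T a → T b → T (a ∧ b)
∧⁺ a b p q = Equivalence.from (T-∧ {a} {b}) (p , q)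

∨⁻ : ∀ a b → T (a ∨ b) → T a ⊎ T b
∨⁻ a b = Equivalence.to (T-∨ {a} {b})

∨⁺ : ∀ a b → T a ⊎ T b → T (a ∨ b)
∨⁺ a b = Equivalence.from (T-∨ {a} {b})

==ℤ⇒≡ : ∀ x y → T (x ==ℤ y) → x ≡ y
==ℤ⇒≡ x y = toWitness {a? = x ℤP.≟ y}

==ℤ-refl : ∀ x → T (x ==ℤ x)
==ℤ-refl x = fromWitness {a? = x ℤP.≟ x} refl

<ℤ⇒< : ∀ x y → T (x <ℤ y) → x ℤ.< y
<ℤ⇒< x y = toWitness {a? = x ℤP.<? y}

<⇒<ℤ : ∀ x y → x ℤ.< y → T (x <ℤ y)
<⇒<ℤ x y = fromWitness {a? = x ℤP.<? y}

==ᶜ⇔≡ : ∀ {c d} → T (c ==ᶜ d) ⇔ c ≡ d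
==ᶜ⇔≡ {x , y} {x' , y'} = mk⇔
  (λ t → let (p , q) = ∧⁻ (x ==ℤ x') (y ==ℤ y') t in cong₂ _,_ (==ℤ⇒≡ x x' p) (==ℤ⇒≡ y y' q))
  (λ { refl → ∧⁺ (x ==ℤ x) (y ==ℤ y) (==ℤ-refl x) (==ℤ-refl y) })

==ᶜ-refl : ∀ c → (c ==ᶜ c) ≡ true
==ᶜ-refl c = Equivalence.to T-≡ (Equivalence.from (==ᶜ⇔≡ {c}) refl)

≢⇒==ᶜ-false : ∀ {c d} → c ≢ d → (c ==ᶜ d) ≡ false
≢⇒==ᶜ-false {c} {d} c≢d with c ==ᶜ d in eq
... | false = refl
... | true  = ⊥-elim (c≢d (Equivalence.to ==ᶜ⇔≡ (Equivalence.from T-≡ eq)))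

memb⇔∈ : ∀ {c cs} → T (memb c cs) ⇔ c ∈ cs
memb⇔∈ {c} {cs} = mk⇔ (λ t → Any.map (Equivalence.to ==ᶜ⇔≡) (AnyP.any⁻ (c ==ᶜ_) cs t))
              (λ c∈ → AnyP.any⁺ _ (Any.map (Equivalence.from ==ᶜ⇔≡) c∈))

_∈?_ : ∀ c cs → Dec (c ∈ cs)
c ∈? cs with memb c cs in eq
... | true  = yes (Equivalence.to memb⇔∈ (Equivalence.from T-≡ eq))
... | false = no λ c∈ → subst T eq (Equivalence.from memb⇔∈ c∈)

∈⇒memb : ∀ {c cs} → c ∈ cs → memb c cs ≡ true
∈⇒memb c∈ = Equivalence.to T-≡ (Equivalence.from memb⇔∈ c∈)

∉⇒memb : ∀ {c cs} → c ∉ cs → memb c cs ≡ false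
∉⇒memb {c} {cs} c∉ with memb c cs in eq
... | false = refl
... | true  = ⊥-elim (c∉ (Equivalence.to memb⇔∈ (Equivalence.from T-≡ eq)))

≺-irrefl : ∀ {c} → ¬ (c ≺ c)
≺-irrefl (inj₁ y<y)       = ℤP.<-irrefl refl y<y
≺-irrefl (inj₂ (_ , x<x)) = ℤP.<-irrefl refl x<x

≺-asym : ∀ {c d} → c ≺ d → ¬ (d ≺ c)
≺-asym (inj₁ p)          (inj₁ q)          = ℤP.<-asym p q
≺-asym (inj₁ p)          (inj₂ (refl , _)) = ℤP.<-irrefl refl p
≺-asym (inj₂ (refl , _)) (inj₁ q)          = ℤP.<-irrefl refl q
≺-asym (inj₂ (_ , p))    (inj₂ (_ , q))    = ℤP.<-asym p q

≺-total : ∀ {c d} → c ≢ d → c ≺ d ⊎ d ≺ c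
≺-total {x , y} {x' , y'} c≢d with ℤP.<-cmp y y'
... | tri< y<y' _ _ = inj₂ (inj₁ y<y')
... | tri> _ _ y'<y = inj₁ (inj₁ y'<y)
... | tri≈ _ refl _ with ℤP.<-cmp x x'
...   | tri< x<x' _ _ = inj₁ (inj₂ (refl , x<x'))
...   | tri≈ _ refl _ = ⊥-elim (c≢d refl)
...   | tri> _ _ x'<x = inj₂ (inj₂ (refl , x'<x))

-- Cell and value at a common index, without naming the index. Both `val` and the pair `pos`,
-- `cellAt` are evaluated by induction on it, which makes them inverse to each other.
data At (c : Cell) (v : ℕ) : List Cell → Word → Set where
  here  : ∀ {cs π} → At c v (c ∷ cs) (v ∷ π)
  there : ∀ {d w cs π} → At c v cs π → At c v (d ∷ cs) (w ∷ π)

At⇒∈cells : ∀ {c v cs π} → At c v cs π → c ∈ cs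
At⇒∈cells here      = here refl
At⇒∈cells (there p) = there (At⇒∈cells p)

At⇒∈word : ∀ {c v cs π} → At c v cs π → v ∈ π
At⇒∈word here      = here refl
At⇒∈word (there p) = there (At⇒∈word p)

∈cells⇒At : ∀ {c cs π} → length π ≡ length cs → c ∈ cs → ∃ λ v → At c v cs π
∈cells⇒At {π = v ∷ π} len (here refl) = v , here
∈cells⇒At {π = w ∷ π} len (there c∈)  =
  let (v , p) = ∈cells⇒At (ℕP.suc-injective len) c∈ in v , there p

∈word⇒At : ∀ {v cs π} → length π ≡ length cs → v ∈ π → ∃ λ c → At c v cs π
∈word⇒At {cs = c ∷ cs} len (here refl) = c , here
∈word⇒At {cs = d ∷ cs} len (there v∈)  =
  let (c , p) = ∈word⇒At (ℕP.suc-injective len) v∈ in c , there p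

At-map : ∀ {c v cs π} (f : ℕ → ℕ) → At c v cs π → At c (f v) cs (map f π)
At-map f here      = here
At-map f (there p) = there (At-map f p)

At⇒val : ∀ {c v cs π} → AllPairs _≺_ cs → At c v cs π → val cs π c ≡ v
At⇒val {c} _ here rewrite ==ᶜ-refl c = refl
At⇒val {c} (c≺ ∷ cs↗) (there {d = d} p)
  rewrite ≢⇒==ᶜ-false {c} {d} (λ { refl → ≺-irrefl (All.lookup c≺ (At⇒∈cells p)) }) = At⇒val cs↗ p

At⇒cellAt : ∀ {c v cs π} → Unique π → At c v cs π → cellAt cs (pos v π) ≡ just c
At⇒cellAt {v = v} _ here rewrite ≡ᵇ-refl v = refl
At⇒cellAt {v = v} (w≢ ∷ π!) (there {w = w} p)
  rewrite ≢⇒≡ᵇ-false {v} {w} (≢-sym (All.lookup w≢ (At⇒∈word p))) = At⇒cellAt π! p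

At-mono : ∀ {c v c' v' cs π} → AllPairs _≺_ cs → Unique π →
          At c v cs π → At c' v' cs π → c ≺ c' → pos v π < pos v' π
At-mono _ _ here here c≺c = ⊥-elim (≺-irrefl c≺c)
At-mono {v = v} {v' = v'} _ (v≢ ∷ _) here (there q) _
  rewrite ≡ᵇ-refl v | ≢⇒≡ᵇ-false {v'} {v} (≢-sym (All.lookup v≢ (At⇒∈word q))) = s≤s z≤n
At-mono (c'≺ ∷ _) _ (there p) here c≺c' = ⊥-elim (≺-asym c≺c' (All.lookup c'≺ (At⇒∈cells p)))
At-mono {v = v} {v' = v'} (_ ∷ cs↗) (w≢ ∷ π!) (there {w = w} p) (there q) c≺c'
  rewrite ≢⇒≡ᵇ-false {v} {w} (≢-sym (All.lookup w≢ (At⇒∈word p)))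
        | ≢⇒≡ᵇ-false {v'} {w} (≢-sym (All.lookup w≢ (At⇒∈word q))) = s≤s (At-mono cs↗ π! p q c≺c')

At-ext : ∀ cs {π π'} → length π ≡ length cs → length π' ≡ length cs →
         (∀ {c} → c ∈ cs → ∃ λ v → At c v cs π × At c v cs π') →
         AllPairs _≺_ cs → π ≡ π'
At-ext []       {[]}    {[]}     _ _ _ _ = refl
At-ext (c ∷ cs) {v ∷ π} {v' ∷ π'} l l' f (c≺ ∷ cs↗) =
  cong₂ _∷_ (heads (f (here refl)))
    (At-ext cs (ℕP.suc-injective l) (ℕP.suc-injective l') (λ d∈ → tails d∈ (f (there d∈))) cs↗)
  where
  c∉ : c ∉ cs
  c∉ c∈ = ≺-irrefl (All.lookup c≺ c∈)
  heads : ∃ (λ w → At c w (c ∷ cs) (v ∷ π) × At c w (c ∷ cs) (v' ∷ π')) → v ≡ v'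
  heads (_ , here    , here)    = refl
  heads (_ , there p , _)       = ⊥-elim (c∉ (At⇒∈cells p))
  heads (_ , here    , there q) = ⊥-elim (c∉ (At⇒∈cells q))
  tails : ∀ {d} → d ∈ cs → ∃ (λ w → At d w (c ∷ cs) (v ∷ π) × At d w (c ∷ cs) (v' ∷ π')) →
          ∃ (λ w → At d w cs π × At d w cs π')
  tails d∈ (w , there p , there q) = w , p , q
  tails d∈ (w , here    , _)       = ⊥-elim (c∉ d∈)
  tails d∈ (w , there p , here)    = ⊥-elim (c∉ d∈)

-- Inversion-free fillings

Inv : ℕ → ℕ → ℕ → Set
Inv tc td te = (te < td × td < tc) ⊎ (tc ≤ te × te < td) ⊎ (td < tc × tc ≤ te)

invTriple⇔Inv : ∀ tc td te → T (invTriple tc td te) ⇔ Inv tc td te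
invTriple⇔Inv tc td te = mk⇔ to from
  where
  a₁ = te <ᵇ td
  a₂ = td <ᵇ tc
  a₃ = tc ≤ᵇ te
  to : T (invTriple tc td te) → Inv tc td te
  to t with ∨⁻ (a₁ ∧ a₂) (a₃ ∧ a₁ ∨ a₂ ∧ a₃) t
  ... | inj₁ u = let (p , q) = ∧⁻ a₁ a₂ u in inj₁ (ℕP.<ᵇ⇒< te td p , ℕP.<ᵇ⇒< td tc q)
  ... | inj₂ u with ∨⁻ (a₃ ∧ a₁) (a₂ ∧ a₃) u
  ...   | inj₁ w = let (p , q) = ∧⁻ a₃ a₁ w in inj₂ (inj₁ (ℕP.≤ᵇ⇒≤ tc te p , ℕP.<ᵇ⇒< te td q))
  ...   | inj₂ w = let (p , q) = ∧⁻ a₂ a₃ w in inj₂ (inj₂ (ℕP.<ᵇ⇒< td tc p , ℕP.≤ᵇ⇒≤ tc te q))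
  from : Inv tc td te → T (invTriple tc td te)
  from (inj₁ (p , q)) =
    ∨⁺ (a₁ ∧ a₂) _ (inj₁ (∧⁺ a₁ a₂ (ℕP.<⇒<ᵇ p) (ℕP.<⇒<ᵇ q)))
  from (inj₂ (inj₁ (p , q))) =
    ∨⁺ (a₁ ∧ a₂) _ (inj₂ (∨⁺ (a₃ ∧ a₁) _ (inj₁ (∧⁺ a₃ a₁ (ℕP.≤⇒≤ᵇ p) (ℕP.<⇒<ᵇ q)))))
  from (inj₂ (inj₂ (p , q))) =
    ∨⁺ (a₁ ∧ a₂) _ (inj₂ (∨⁺ (a₃ ∧ a₁) _ (inj₂ (∧⁺ a₂ a₃ (ℕP.<⇒<ᵇ p) (ℕP.≤⇒≤ᵇ q)))))

-- The three clauses follow the position c = (x , y): c and the cell below it present, only c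
-- present, only the cell below present.
record InvFree (cs : List Cell) (f : Cell → ℕ) : Set where
  field
    triple : ∀ {x x' y} → (x , y) ∈ cs → (x' , y) ∈ cs → x ℤ.< x' → below (x , y) ∈ cs →
             ¬ Inv (f (x , y)) (f (x' , y)) (f (below (x , y)))
    row    : ∀ {x x' y} → (x , y) ∈ cs → (x' , y) ∈ cs → x ℤ.< x' → below (x , y) ∉ cs →
             ¬ (f (x' , y) < f (x , y))
    diag   : ∀ {x x' y} → below (x , y) ∈ cs → (x' , y) ∈ cs → x ℤ.< x' → (x , y) ∉ cs →
             ¬ (f (below (x , y)) < f (x' , y))

sum≡0⇒ : ∀ {A : Set} (g : A → ℕ) xs → sum (map g xs) ≡ 0 → ∀ {x} → x ∈ xs → g x ≡ 0
sum≡0⇒ g (x ∷ xs) eq (here refl) = ℕP.m+n≡0⇒m≡0 (g x) eq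
sum≡0⇒ g (x ∷ xs) eq (there x∈)  = sum≡0⇒ g xs (ℕP.m+n≡0⇒n≡0 (g x) eq) x∈

⇒sum≡0 : ∀ {A : Set} (g : A → ℕ) xs → (∀ {x} → x ∈ xs → g x ≡ 0) → sum (map g xs) ≡ 0
⇒sum≡0 g []       _ = refl
⇒sum≡0 g (x ∷ xs) h = cong₂ _+_ (h (here refl)) (⇒sum≡0 g xs (λ x∈ → h (there x∈)))

b2n*b2n≡0⇒ : ∀ {p q} → b2n p * b2n q ≡ 0 → T p → ¬ T q
b2n*b2n≡0⇒ {true} {true} ()

⇒b2n*b2n≡0 : ∀ {p q} → (T p → ¬ T q) → b2n p * b2n q ≡ 0
⇒b2n*b2n≡0 {false}         _ = refl
⇒b2n*b2n≡0 {true}  {false} _ = refl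
⇒b2n*b2n≡0 {true}  {true}  h = ⊥-elim (h _ _)

-- Together with `rowCond` and `diagCond` these are the Boolean factors in `invW`, named so that its
-- sums unfold to them by conversion.
rowTerm : List Cell → Word → Cell → Cell → Bool
rowTerm cs π c d = if memb (below c) cs
  then invTriple (val cs π c) (val cs π d) (val cs π (below c))
  else (val cs π d <ᵇ val cs π c)

rowCond : Cell → Cell → Bool
rowCond c d = (proj₂ c ==ℤ proj₂ d) ∧ (proj₁ c <ℤ proj₁ d)

diagCond : List Cell → Cell → Cell → Bool
diagCond cs e d = (proj₂ e ==ℤ (proj₂ d ℤ.- ℤ.1ℤ)) ∧ (proj₁ e <ℤ proj₁ d)
                  ∧ not (memb (proj₁ e , proj₂ d) cs)

invW≡0⇒InvFree : ∀ cs π → invW cs π ≡ 0 → InvFree cs (val cs π)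
invW≡0⇒InvFree cs π eq = record
  { triple = λ {x} {x'} {y} c∈ d∈ x<x' e∈ i →
      first c∈ d∈ (rowCond⁺ y x<x')
        (subst (λ b → T (if b then triple' x x' y else row' x x' y)) (sym (∈⇒memb e∈)) (Equivalence.from (invTriple⇔Inv _ _ _) i))
  ; row = λ {x} {x'} {y} c∈ d∈ x<x' e∉ lt →
      first c∈ d∈ (rowCond⁺ y x<x')
        (subst (λ b → T (if b then triple' x x' y else row' x x' y)) (sym (∉⇒memb e∉)) (ℕP.<⇒<ᵇ lt))
  ; diag = λ {x} {x'} {y} e∈ d∈ x<x' c∉ lt →
      second e∈ d∈
        (∧⁺ ((y ℤ.- ℤ.1ℤ) ==ℤ (y ℤ.- ℤ.1ℤ)) _ (==ℤ-refl (y ℤ.- ℤ.1ℤ))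
          (∧⁺ (x <ℤ x') _ (<⇒<ℤ x x' x<x') (subst (λ b → T (not b)) (sym (∉⇒memb c∉)) _)))
        (ℕP.<⇒<ᵇ lt)
  }
  where
  f = val cs π
  triple' row' : ℤ → ℤ → ℤ → Bool
  triple' x x' y = invTriple (f (x , y)) (f (x' , y)) (f (below (x , y)))
  row' x x' y = f (x' , y) <ᵇ f (x , y)
  rowCond⁺ : ∀ {x x'} y → x ℤ.< x' → T (rowCond (x , y) (x' , y))
  rowCond⁺ {x} {x'} y x<x' = ∧⁺ (y ==ℤ y) _ (==ℤ-refl y) (<⇒<ℤ x x' x<x')
  first : ∀ {c d} → c ∈ cs → d ∈ cs → T (rowCond c d) → ¬ T (rowTerm cs π c d)
  first {c} {d} c∈ d∈ = b2n*b2n≡0⇒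
    (sum≡0⇒ (λ c' → b2n (rowCond c' d) * b2n (rowTerm cs π c' d)) cs
      (sum≡0⇒ (λ d' → sum (map (λ c' → b2n (rowCond c' d') * b2n (rowTerm cs π c' d')) cs)) cs
        (ℕP.m+n≡0⇒m≡0 _ eq) d∈) c∈)
  second : ∀ {e d} → e ∈ cs → d ∈ cs → T (diagCond cs e d) → ¬ T (f e <ᵇ f d)
  second {e} {d} e∈ d∈ = b2n*b2n≡0⇒
    (sum≡0⇒ (λ e' → b2n (diagCond cs e' d) * b2n (f e' <ᵇ f d)) cs
      (sum≡0⇒ (λ d' → sum (map (λ e' → b2n (diagCond cs e' d') * b2n (f e' <ᵇ f d')) cs)) cs
        (ℕP.m+n≡0⇒n≡0 (sum (map (λ d' → sum (map (λ c' → b2n (rowCond c' d') * b2n (rowTerm cs π c' d')) cs)) cs)) eq) d∈) e∈)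

InvFree⇒invW≡0 : ∀ cs π → InvFree cs (val cs π) → invW cs π ≡ 0
InvFree⇒invW≡0 cs π h = cong₂ _+_
  (⇒sum≡0 (λ d → sum (map (λ c → b2n (rowCond c d) * b2n (rowTerm cs π c d)) cs)) cs λ {d} d∈ →
     ⇒sum≡0 (λ c → b2n (rowCond c d) * b2n (rowTerm cs π c d)) cs λ {c} c∈ →
       ⇒b2n*b2n≡0 {rowCond c d} (first c∈ d∈))
  (⇒sum≡0 (λ d → sum (map (λ e → b2n (diagCond cs e d) * b2n (f e <ᵇ f d)) cs)) cs λ {d} d∈ →
     ⇒sum≡0 (λ e → b2n (diagCond cs e d) * b2n (f e <ᵇ f d)) cs λ {e} e∈ →
       ⇒b2n*b2n≡0 {diagCond cs e d} (second e∈ d∈))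
  where
  f = val cs π
  first : ∀ {c d} → c ∈ cs → d ∈ cs → T (rowCond c d) → ¬ T (rowTerm cs π c d)
  first {c@(x , y)} {d@(x' , y')} c∈ d∈ t u
    with (p , q) ← ∧⁻ (y ==ℤ y') (x <ℤ x') t
    with refl ← ==ℤ⇒≡ y y' p
    with memb (below c) cs in m
  ... | true  = InvFree.triple h c∈ d∈ (<ℤ⇒< x x' q)
          (Equivalence.to memb⇔∈ (Equivalence.from T-≡ m)) (Equivalence.to (invTriple⇔Inv _ _ _) u)
  ... | false = InvFree.row h c∈ d∈ (<ℤ⇒< x x' q)
          (λ e∈ → subst T m (Equivalence.from memb⇔∈ e∈)) (ℕP.<ᵇ⇒< (f d) (f c) u)
  second : ∀ {e d} → e ∈ cs → d ∈ cs → T (diagCond cs e d) → ¬ T (f e <ᵇ f d)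
  second {e@(x , z)} {d@(x' , y)} e∈ d∈ t u
    with (p , qr) ← ∧⁻ (z ==ℤ (y ℤ.- ℤ.1ℤ)) ((x <ℤ x') ∧ not (memb (x , y) cs)) t
    with (q , r) ← ∧⁻ (x <ℤ x') (not (memb (x , y) cs)) qr
    with refl ← ==ℤ⇒≡ z (y ℤ.- ℤ.1ℤ) p =
    InvFree.diag h e∈ d∈ (<ℤ⇒< x x' q)
      (λ c∈ → subst (λ b → T (not b)) (∈⇒memb c∈) r) (ℕP.<ᵇ⇒< (f e) (f d) u)

filterᵇ-cong : ∀ {A : Set} {p q : A → Bool} (xs : List A) →
               (∀ {x} → x ∈ xs → p x ≡ q x) → filterᵇ p xs ≡ filterᵇ q xs
filterᵇ-cong             []       _ = refl
filterᵇ-cong {p = p} {q} (x ∷ xs) h with p x | q x | h (here refl)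
... | true  | .true  | refl = cong (x ∷_) (filterᵇ-cong xs (λ x∈ → h (there x∈)))
... | false | .false | refl = filterᵇ-cong xs (λ x∈ → h (there x∈))

descentsW-cong : ∀ cs π π' →
  (∀ {c} → c ∈ cs → below c ∈ cs →
     (val cs π (below c) <ᵇ val cs π c) ≡ (val cs π' (below c) <ᵇ val cs π' c)) →
  descentsW cs π ≡ descentsW cs π'
descentsW-cong cs π π' h = filterᵇ-cong cs go
  where
  go : ∀ {c} → c ∈ cs →
       memb (below c) cs ∧ (val cs π (below c) <ᵇ val cs π c) ≡
       memb (below c) cs ∧ (val cs π' (below c) <ᵇ val cs π' c)
  go {c} c∈ with memb (below c) cs in m
  ... | true  = h c∈ (Equivalence.to memb⇔∈ (Equivalence.from T-≡ m))
  ... | false = refl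

-- Relabelling three consecutive values

≡ᵇ-cong : ∀ {j k j' k'} → (j ≡ k → j' ≡ k') → (j' ≡ k' → j ≡ k) → (j ≡ᵇ k) ≡ (j' ≡ᵇ k')
≡ᵇ-cong {j} {k} {j'} f g with j ℕP.≟ k
... | yes refl rewrite sym (f refl) = trans (≡ᵇ-refl j) (sym (≡ᵇ-refl j'))
... | no  j≢k  = trans (≢⇒≡ᵇ-false j≢k) (sym (≢⇒≡ᵇ-false (λ e → j≢k (g e))))

pos-map : ∀ (g h : ℕ → ℕ) → (∀ k → g (h k) ≡ k) → (∀ k → h (g k) ≡ k) →
          ∀ k π → pos k (map g π) ≡ pos (h k) π
pos-map g h gh hg k []      = refl
pos-map g h gh hg k (w ∷ π) = cong₂ (λ b p → if b then 0 else suc p)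
  (≡ᵇ-cong {k} {g w} {h k} {w} (λ e → trans (cong h e) (hg w)) (λ e → trans (sym (gh k)) (cong g e)))
  (pos-map g h gh hg k π)

swapV-left : ∀ a b → swapV a b a ≡ b
swapV-left a b rewrite ≡ᵇ-refl a = refl

swapV-right : ∀ a b → swapV a b b ≡ a
swapV-right a b with b ≡ᵇ a in eq
... | true  = ℕP.≡ᵇ⇒≡ b a (subst T (sym eq) _)
... | false rewrite ≡ᵇ-refl b = refl

swapV-other : ∀ a b {k} → k ≢ a → k ≢ b → swapV a b k ≡ k
swapV-other a b {k} k≢a k≢b rewrite ≢⇒≡ᵇ-false k≢a | ≢⇒≡ᵇ-false k≢b = refl

swapV-involutive : ∀ a b k → swapV a b (swapV a b k) ≡ k
swapV-involutive a b k with k ℕP.≟ a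
... | yes refl = trans (cong (swapV a b) (swapV-left a b)) (swapV-right a b)
... | no  k≢a with k ℕP.≟ b
...   | yes refl = trans (cong (swapV a b) (swapV-right a b)) (swapV-left a b)
...   | no  k≢b  = trans (cong (swapV a b) (swapV-other a b k≢a k≢b)) (swapV-other a b k≢a k≢b)

cyc3-1 : ∀ p q r → cyc3 p q r p ≡ q
cyc3-1 p q r rewrite ≡ᵇ-refl p = refl

cyc3-2 : ∀ p q r → p ≢ q → cyc3 p q r q ≡ r
cyc3-2 p q r p≢q rewrite ≢⇒≡ᵇ-false (≢-sym p≢q) | ≡ᵇ-refl q = refl

cyc3-3 : ∀ p q r → p ≢ r → q ≢ r → cyc3 p q r r ≡ p
cyc3-3 p q r p≢r q≢r rewrite ≢⇒≡ᵇ-false (≢-sym p≢r) | ≢⇒≡ᵇ-false (≢-sym q≢r) | ≡ᵇ-refl r = refl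

cyc3-other : ∀ p q r {k} → k ≢ p → k ≢ q → k ≢ r → cyc3 p q r k ≡ k
cyc3-other p q r k≢p k≢q k≢r rewrite ≢⇒≡ᵇ-false k≢p | ≢⇒≡ᵇ-false k≢q | ≢⇒≡ᵇ-false k≢r = refl

cyc3-inverse : ∀ p q r → p ≢ q → p ≢ r → q ≢ r → ∀ k → cyc3 p q r (cyc3 r q p k) ≡ k
cyc3-inverse p q r p≢q p≢r q≢r k with k ℕP.≟ p | k ℕP.≟ q | k ℕP.≟ r
... | yes refl | _ | _ = trans (cong (cyc3 p q r) (cyc3-3 r q p (≢-sym p≢r) (≢-sym p≢q))) (cyc3-3 p q r p≢r q≢r)
... | no _ | yes refl | _ = trans (cong (cyc3 p q r) (cyc3-2 r q p (≢-sym q≢r))) (cyc3-1 p q r)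
... | no _ | no _ | yes refl = trans (cong (cyc3 p q r) (cyc3-1 r q p)) (cyc3-2 p q r p≢q)
... | no k≢p | no k≢q | no k≢r =
  trans (cong (cyc3 p q r) (cyc3-other r q p k≢r k≢q k≢p)) (cyc3-other p q r k≢p k≢q k≢r)

Near : ℕ → ℕ → Set
Near m k = k ≡ m ⊎ k ≡ suc m ⊎ k ≡ suc (suc m)

near-or-not : ∀ m k → Near m k ⊎ (k < m ⊎ suc (suc m) < k)
near-or-not zero    zero                = inj₁ (inj₁ refl)
near-or-not zero    (suc zero)          = inj₁ (inj₂ (inj₁ refl))
near-or-not zero    (suc (suc zero))    = inj₁ (inj₂ (inj₂ refl))
near-or-not zero    (suc (suc (suc k))) = inj₂ (inj₂ (s≤s (s≤s (s≤s z≤n))))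
near-or-not (suc m) zero                = inj₂ (inj₁ (s≤s z≤n))
near-or-not (suc m) (suc k)             = Sum.map
  (Sum.map (cong suc) (Sum.map (cong suc) (cong suc))) (Sum.map s≤s s≤s) (near-or-not m k)

near-lower : ∀ {m k} → Near m k → m ≤ k
near-lower (inj₁ refl)        = ℕP.≤-refl
near-lower (inj₂ (inj₁ refl)) = ℕP.n≤1+n _
near-lower (inj₂ (inj₂ refl)) = ℕP.m≤n⇒m≤1+n (ℕP.n≤1+n _)

near-upper : ∀ {m k} → Near m k → k ≤ suc (suc m)
near-upper (inj₁ refl)        = ℕP.m≤n⇒m≤1+n (ℕP.n≤1+n _)
near-upper (inj₂ (inj₁ refl)) = ℕP.n≤1+n _
near-upper (inj₂ (inj₂ refl)) = ℕP.≤-refl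

far-not-near : ∀ {m k} → k < m ⊎ suc (suc m) < k → ¬ Near m k
far-not-near (inj₁ k<m) p = ℕP.<⇒≱ k<m (near-lower p)
far-not-near (inj₂ m<k) p = ℕP.<⇒≱ m<k (near-upper p)

-- The inverse is part of the data because the value k of the relabelled word stands where `inv k`
-- stood before.
record Relabel (m : ℕ) (g : ℕ → ℕ) : Set where
  field
    inv    : ℕ → ℕ
    g-inv  : ∀ k → g (inv k) ≡ k
    inv-g  : ∀ k → inv (g k) ≡ k
    far    : ∀ {k} → ¬ Near m k → g k ≡ k
    near   : ∀ {k} → Near m k → Near m (g k)

  inv-near : ∀ {k} → Near m k → Near m (inv k)
  inv-near {k} k~ with near-or-not m (inv k)
  ... | inj₁ p = p
  ... | inj₂ p = ⊥-elim (far-not-near p (subst (Near m) (trans (sym (g-inv k)) (far (far-not-near p))) k~))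

  inv-far : ∀ {k} → ¬ Near m k → inv k ≡ k
  inv-far {k} k≁ = trans (cong inv (sym (far k≁))) (inv-g k)

  pos-relabel : ∀ k π → pos k (map g π) ≡ pos (inv k) π
  pos-relabel = pos-map g inv g-inv inv-g

  relabel-perm : ∀ {n π} → 1 ≤ m → suc (suc m) ≤ n → IsPerm n π → IsPerm n (map g π)
  relabel-perm {n} 1≤m m+2≤n = IsPerm-map g inv g-inv range
    where
    range : ∀ {k} → 1 ≤ k → k ≤ n → 1 ≤ inv k × inv k ≤ n
    range {k} 1≤k k≤n with near-or-not m k
    ... | inj₁ k~ = let k~' = inv-near k~ in
      ℕP.≤-trans 1≤m (near-lower k~') , ℕP.≤-trans (near-upper k~') m+2≤n
    ... | inj₂ k≁ rewrite inv-far (far-not-near k≁) = 1≤k , k≤n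

  -- A permutation of an interval of values keeps every comparison with a value outside the
  -- interval, so only pairs inside need attention.
  mono-unless-near : ∀ {j k} → (Near m j → Near m k → g j < g k) → j < k → g j < g k
  mono-unless-near {j} {k} h j<k with near-or-not m j | near-or-not m k
  ... | inj₁ j~ | inj₁ k~ = h j~ k~
  ... | inj₁ j~ | inj₂ (inj₁ k<m) = ⊥-elim (ℕP.<⇒≱ (ℕP.<-trans j<k k<m) (near-lower j~))
  ... | inj₁ j~ | inj₂ (inj₂ m<k) rewrite far (far-not-near {m} {k} (inj₂ m<k)) =
    ℕP.≤-<-trans (near-upper (near j~)) m<k
  ... | inj₂ (inj₁ j<m) | inj₁ k~ rewrite far (far-not-near {m} {j} (inj₁ j<m)) =
    ℕP.<-≤-trans j<m (near-lower (near k~))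
  ... | inj₂ (inj₂ m<j) | inj₁ k~ = ⊥-elim (ℕP.<⇒≱ (ℕP.<-trans m<j j<k) (near-upper k~))
  ... | inj₂ j≁ | inj₂ k≁ rewrite far (far-not-near {m} {j} j≁) | far (far-not-near {m} {k} k≁) = j<k

swapV-relabel : ∀ {m} a b → Near m a → Near m b → Relabel m (swapV a b)
swapV-relabel {m} a b a~ b~ = record
  { inv   = swapV a b
  ; g-inv = swapV-involutive a b
  ; inv-g = swapV-involutive a b
  ; far   = λ k≁ → swapV-other a b (λ { refl → k≁ a~ }) (λ { refl → k≁ b~ })
  ; near  = λ {k} → near' {k}
  }
  where
  near' : ∀ {k} → Near m k → Near m (swapV a b k)
  near' {k} k~ with k ℕP.≟ a | k ℕP.≟ b
  ... | yes refl | _        rewrite swapV-left a b  = b~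
  ... | no _     | yes refl rewrite swapV-right a b = a~
  ... | no k≢a   | no k≢b   rewrite swapV-other a b k≢a k≢b = k~

cyc3-relabel : ∀ {m} p q r → p ≢ q → p ≢ r → q ≢ r → Near m p → Near m q → Near m r → Relabel m (cyc3 p q r)
cyc3-relabel {m} p q r p≢q p≢r q≢r p~ q~ r~ = record
  { inv   = cyc3 r q p
  ; g-inv = cyc3-inverse p q r p≢q p≢r q≢r
  ; inv-g = cyc3-inverse r q p (≢-sym q≢r) (≢-sym p≢r) (≢-sym p≢q)
  ; far   = λ k≁ → cyc3-other p q r (λ { refl → k≁ p~ }) (λ { refl → k≁ q~ }) (λ { refl → k≁ r~ })
  ; near  = λ {k} → near' {k}
  }
  where
  near' : ∀ {k} → Near m k → Near m (cyc3 p q r k)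
  near' {k} k~ with k ℕP.≟ p | k ℕP.≟ q | k ℕP.≟ r
  ... | yes refl | _ | _ rewrite cyc3-1 p q r = q~
  ... | no _ | yes refl | _ rewrite cyc3-2 p q r p≢q = r~
  ... | no _ | no _ | yes refl rewrite cyc3-3 p q r p≢r q≢r = p~
  ... | no k≢p | no k≢q | no k≢r rewrite cyc3-other p q r k≢p k≢q k≢r = k~

relabel-id : ∀ m → Relabel m (λ k → k)
relabel-id m = record { inv = λ k → k ; g-inv = λ _ → refl ; inv-g = λ _ → refl ; far = λ _ → refl ; near = λ k~ → k~ }

-- The action of dᵢ (i = m + 1) on values, given which of the pairs
-- (i-1, i), (i, i+1), (i-1, i+1) appear in increasing order.
dual : Bool → Bool → Bool → ℕ → ℕ → ℕ
dual false true  s m = swapV (suc m) (if s then suc (suc m) else m)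
dual true  false s m = swapV (suc m) (if s then m else suc (suc m))
dual true  true  s m = λ k → k
dual false false s m = λ k → k

dual-cong : ∀ {p p' q q' s s'} m → p ≡ p' → q ≡ q' → s ≡ s' → dual p q s m ≡ dual p' q' s' m
dual-cong m refl refl refl = refl

dual-involutive : ∀ p q s m k → dual p q s m (dual p q s m k) ≡ k
dual-involutive false true  s m k = swapV-involutive (suc m) _ k
dual-involutive true  false s m k = swapV-involutive (suc m) _ k
dual-involutive true  true  s m k = refl
dual-involutive false false s m k = refl

dual-relabel : ∀ p q s m → Relabel m (dual p q s m)
dual-relabel false true  true  m = swapV-relabel _ _ (inj₂ (inj₁ refl)) (inj₂ (inj₂ refl))
dual-relabel false true  false m = swapV-relabel _ _ (inj₂ (inj₁ refl)) (inj₁ refl)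
dual-relabel true  false true  m = swapV-relabel _ _ (inj₂ (inj₁ refl)) (inj₁ refl)
dual-relabel true  false false m = swapV-relabel _ _ (inj₂ (inj₁ refl)) (inj₂ (inj₂ refl))
dual-relabel true  true  s     m = relabel-id m
dual-relabel false false s     m = relabel-id m

<ᵇ-flip : ∀ {j k} → j ≢ k → (k <ᵇ j) ≡ not (j <ᵇ k)
<ᵇ-flip {j} {k} j≢k with j ℕP.<? k
... | yes j<k rewrite <⇒<ᵇ-true j<k | ≮⇒<ᵇ-false (ℕP.<-asym j<k) = refl
... | no  j≮k rewrite ≮⇒<ᵇ-false j≮k = <⇒<ᵇ-true (ℕP.≤∧≢⇒< (ℕP.≮⇒≥ j≮k) (≢-sym j≢k))

dOp-dual : ∀ m π → pos m π ≢ pos (suc m) π → pos (suc m) π ≢ pos (suc (suc m)) π →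
  dOp (suc m) π ≡ map (dual (pos m π <ᵇ pos (suc m) π) (pos (suc m) π <ᵇ pos (suc (suc m)) π)
                            (pos m π <ᵇ pos (suc (suc m)) π) m) π
dOp-dual m π a≢b b≢c rewrite <ᵇ-flip a≢b | <ᵇ-flip b≢c
  with pos m π <ᵇ pos (suc m) π | pos (suc m) π <ᵇ pos (suc (suc m)) π
... | true  | true  = sym (map-id π)
... | false | false = sym (map-id π)
... | false | true  = refl
... | true  | false = refl

dtOp-between : ∀ m π → pos m π ≢ pos (suc m) π → pos (suc m) π ≢ pos (suc (suc m)) π →
  (pos m π <ᵇ pos (suc m) π) ≡ (pos (suc m) π <ᵇ pos (suc (suc m)) π) → dtOp (suc m) π ≡ π
dtOp-between m π a≢b b≢c eq rewrite <ᵇ-flip a≢b | <ᵇ-flip b≢c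
  with pos m π <ᵇ pos (suc m) π | pos (suc m) π <ᵇ pos (suc (suc m)) π
... | true  | true  = refl
... | false | false = refl
... | false | true  with () ← eq
... | true  | false with () ← eq

-- Of the four orders moved by d̃_i only i, i+1, i-1 and (in `dtOp-last`) i+1, i-1, i are computed:
-- by `pistoled-first` and `pistoled-last` a pistoled triple of an inversion-free filling shows no
-- other.
dtOp-first : ∀ m π → pos (suc m) π < pos (suc (suc m)) π → pos (suc (suc m)) π < pos m π →
  dtOp (suc m) π ≡ map (cyc3 (suc m) (suc (suc m)) m) π
dtOp-first m π b<c c<a
  rewrite <⇒<ᵇ-true (ℕP.<-trans b<c c<a) | <⇒<ᵇ-true b<c | ≮⇒<ᵇ-false (ℕP.<-asym c<a) = refl

dtOp-last : ∀ m π → pos (suc (suc m)) π < pos m π → pos m π < pos (suc m) π →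
  dtOp (suc m) π ≡ map (cyc3 (suc (suc m)) (suc m) m) π
dtOp-last m π c<a a<b
  rewrite ≮⇒<ᵇ-false (ℕP.<-asym a<b) | <⇒<ᵇ-true a<b | <⇒<ᵇ-true (ℕP.<-trans c<a a<b) | ≮⇒<ᵇ-false (ℕP.<-asym c<a) = refl

-- The involutions on inversion-free fillings

pred-< : ∀ y → y ℤ.- ℤ.1ℤ ℤ.< y
pred-< y = subst (y ℤ.- ℤ.1ℤ ℤ.<_) (ℤP.+-identityʳ y) (ℤP.+-monoʳ-< y ℤ.-<+)

pred-≢ : ∀ {y} → y ℤ.- ℤ.1ℤ ≢ y
pred-≢ {y} eq = ℤP.<-irrefl eq (pred-< y)

no-gap : ∀ {j k l : ℕ} → j < k → k < l → l ≡ suc j → ⊥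
no-gap j<k k<l refl = ℕP.<⇒≱ k<l j<k

mid-gap : ∀ {j k l : ℕ} → j < k → k < l → l ≡ suc (suc j) → k ≡ suc j
mid-gap j<k k<l refl = ℕP.≤-antisym (ℕP.≤-pred k<l) j<k

-- Pistols and the reading order

InPistol : Cell → Cell → Set
InPistol (x₀ , y₀) (x , y) = (y ≡ y₀ × x₀ ℤ.≤ x) ⊎ (y ≡ y₀ ℤ.- ℤ.1ℤ × x ℤ.≤ x₀)

inPistol⇔ : ∀ s c → T (inPistol s (just c)) ⇔ InPistol s c
inPistol⇔ (x₀ , y₀) (x , y) = mk⇔ to from
  where
  to : T (inPistol (x₀ , y₀) (just (x , y))) → InPistol (x₀ , y₀) (x , y)
  to t = Sum.map
    (λ u → let (p , q) = ∧⁻ (y ==ℤ y₀) _ u in ==ℤ⇒≡ y y₀ p , toWitness {a? = x₀ ℤP.≤? x} q)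
    (λ u → let (p , q) = ∧⁻ (y ==ℤ (y₀ ℤ.- ℤ.1ℤ)) _ u in ==ℤ⇒≡ y (y₀ ℤ.- ℤ.1ℤ) p , toWitness {a? = x ℤP.≤? x₀} q)
    (∨⁻ ((y ==ℤ y₀) ∧ (x₀ ≤ℤ x)) _ t)
  from : InPistol (x₀ , y₀) (x , y) → T (inPistol (x₀ , y₀) (just (x , y)))
  from (inj₁ (refl , q)) = ∨⁺ ((y ==ℤ y) ∧ (x₀ ≤ℤ x)) _
    (inj₁ (∧⁺ (y ==ℤ y) _ (==ℤ-refl y) (fromWitness {a? = x₀ ℤP.≤? x} q)))
  from (inj₂ (refl , q)) = ∨⁺ ((y ==ℤ y₀) ∧ (x₀ ≤ℤ x)) _
    (inj₂ (∧⁺ (y ==ℤ y) _ (==ℤ-refl y) (fromWitness {a? = x ℤP.≤? x₀} q)))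

≺⇒row≥ : ∀ {c d} → c ≺ d → proj₂ d ℤ.≤ proj₂ c
≺⇒row≥ (inj₁ y'<y)     = ℤP.<⇒≤ y'<y
≺⇒row≥ (inj₂ (refl , _)) = ℤP.≤-refl

≺⇒col< : ∀ {c d} → c ≺ d → proj₂ c ≡ proj₂ d → proj₁ c ℤ.< proj₁ d
≺⇒col< (inj₁ y'<y)     refl = ⊥-elim (ℤP.<-irrefl refl y'<y)
≺⇒col< (inj₂ (_ , x<x')) _ = x<x'

<⇒≤pred : ∀ {i j} → i ℤ.< j → i ℤ.≤ j ℤ.- ℤ.1ℤ
<⇒≤pred {i} {j} i<j = subst (i ℤ.≤_) (ℤP.+-comm ℤ.-1ℤ j) (ℤP.i<j⇒i≤pred[j] i<j)

pistol-row : ∀ {s c} → InPistol s c → proj₂ c ℤ.≤ proj₂ s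
pistol-row (inj₁ (refl , _)) = ℤP.≤-refl
pistol-row (inj₂ (refl , _)) = ℤP.<⇒≤ (pred-< _)

-- A pistol is an interval of the reading order: from its first cell to the end of the row, then the
-- row below up to the same column. Since d_i exchanges the two outer letters of a triple, a common
-- pistol of these two would contain the middle one as well.
pistol-convex : ∀ {s p q r} → InPistol s p → InPistol s r → p ≺ q → q ≺ r → InPistol s q
pistol-convex {x₀ , y₀} {xp , yp} {xq , yq} {xr , yr} p∈ r∈ p≺q q≺r with yq ℤP.≟ y₀
... | yes refl with p∈
...   | inj₁ (eq , x₀≤x)  = inj₁ (refl , ℤP.≤-trans x₀≤x (ℤP.<⇒≤ (≺⇒col< p≺q eq)))
...   | inj₂ (refl , _)   = ⊥-elim (ℤP.<⇒≱ (pred-< yq) (≺⇒row≥ p≺q))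
pistol-convex {x₀ , y₀} {xp , yp} {xq , yq} {xr , yr} p∈ r∈ p≺q q≺r | no q≢ with r∈
...   | inj₁ (refl , _) = ⊥-elim (q≢ (ℤP.≤-antisym (ℤP.≤-trans (≺⇒row≥ p≺q) (pistol-row p∈)) (≺⇒row≥ q≺r)))
...   | inj₂ (refl , x≤x₀) = inj₂ (q-row , ℤP.≤-trans (ℤP.<⇒≤ (≺⇒col< q≺r q-row)) x≤x₀)
  where
  q-row : yq ≡ y₀ ℤ.- ℤ.1ℤ
  q-row = ℤP.≤-antisym (<⇒≤pred (ℤP.≤∧≢⇒< (ℤP.≤-trans (≺⇒row≥ p≺q) (pistol-row p∈)) q≢)) (≺⇒row≥ q≺r)

Pistoled : List Cell → Cell → Cell → Cell → Set
Pistoled cs a b c = ∃ λ s → s ∈ cs × InPistol s a × InPistol s b × InPistol s c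

pistoled⇔ : ∀ cs {p q r a b c} → cellAt cs p ≡ just a → cellAt cs q ≡ just b → cellAt cs r ≡ just c →
  T (pistoled cs (p ∷ q ∷ r ∷ [])) ⇔ Pistoled cs a b c
pistoled⇔ cs {p} {q} {r} {a} {b} {c} pa qb rc = mk⇔ to from
  where
  to : T (pistoled cs (p ∷ q ∷ r ∷ [])) → Pistoled cs a b c
  to t with s , s∈ , u ← find (AnyP.any⁻ (λ s → all (λ i → inPistol s (cellAt cs i)) (p ∷ q ∷ r ∷ [])) cs t)
    rewrite pa | qb | rc
    with u₁ , u′ ← ∧⁻ (inPistol s (just a)) _ u
    with u₂ , u″ ← ∧⁻ (inPistol s (just b)) _ u′
    with u₃ , _ ← ∧⁻ (inPistol s (just c)) _ u″ =
    s , s∈ , Equivalence.to (inPistol⇔ s a) u₁ , Equivalence.to (inPistol⇔ s b) u₂ , Equivalence.to (inPistol⇔ s c) u₃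
  from : Pistoled cs a b c → T (pistoled cs (p ∷ q ∷ r ∷ []))
  from (s , s∈ , a~ , b~ , c~) rewrite pa | qb | rc =
    AnyP.any⁺ (λ s → inPistol s (just a) ∧ inPistol s (just b) ∧ inPistol s (just c) ∧ true) (lose s∈
      (∧⁺ (inPistol s (just a)) _ (Equivalence.from (inPistol⇔ s a) a~)
        (∧⁺ (inPistol s (just b)) _ (Equivalence.from (inPistol⇔ s b) b~)
          (∧⁺ (inPistol s (just c)) _ (Equivalence.from (inPistol⇔ s c) c~) _))))

dual-inv : ∀ p q s m k → Relabel.inv (dual-relabel p q s m) k ≡ dual p q s m k
dual-inv false true  true  m k = refl
dual-inv false true  false m k = refl
dual-inv true  false true  m k = refl
dual-inv true  false false m k = refl
dual-inv true  true  s     m k = refl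
dual-inv false false s     m k = refl

-- d_{m+1} on the word in which each row has been sorted increasingly; ρ k is
-- the row of the value k.
rowDual : ℕ → (ℕ → ℤ) → ℕ → ℕ
rowDual m ρ = dual (ρ (suc m) ≤ℤ ρ m) (ρ (suc (suc m)) ≤ℤ ρ (suc m)) (ρ (suc (suc m)) ≤ℤ ρ m) m

≤ℤ-true : ∀ {x y} → x ℤ.≤ y → (x ≤ℤ y) ≡ true
≤ℤ-true {x} {y} x≤y = Equivalence.to T-≡ (fromWitness {a? = x ℤP.≤? y} x≤y)

≤ℤ-false : ∀ {x y} → y ℤ.< x → (x ≤ℤ y) ≡ false
≤ℤ-false {x} {y} y<x with x ≤ℤ y in eq
... | false = refl
... | true  = ⊥-elim (ℤP.<⇒≱ y<x (toWitness {a? = x ℤP.≤? y} (Equivalence.from T-≡ eq)))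

swapV-mono-upper : ∀ {m j k} → Near m j → Near m k → (j ≡ suc m → k ≡ suc (suc m) → ⊥) → j < k →
  swapV (suc m) (suc (suc m)) j < swapV (suc m) (suc (suc m)) k
swapV-mono-upper {m} (inj₁ refl) (inj₁ refl) _ lt = ⊥-elim (ℕP.<-irrefl refl lt)
swapV-mono-upper {m} (inj₁ refl) (inj₂ (inj₁ refl)) _ lt
  rewrite swapV-other (suc m) (suc (suc m)) {m} (ℕP.<⇒≢ (ℕP.n<1+n m)) (ℕP.<⇒≢ (ℕP.m<n⇒m<1+n (ℕP.n<1+n m)))
        | swapV-left (suc m) (suc (suc m)) = ℕP.m<n⇒m<1+n (ℕP.n<1+n m)
swapV-mono-upper {m} (inj₁ refl) (inj₂ (inj₂ refl)) _ lt
  rewrite swapV-other (suc m) (suc (suc m)) {m} (ℕP.<⇒≢ (ℕP.n<1+n m)) (ℕP.<⇒≢ (ℕP.m<n⇒m<1+n (ℕP.n<1+n m)))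
        | swapV-right (suc m) (suc (suc m)) = ℕP.n<1+n m
swapV-mono-upper {m} (inj₂ (inj₁ refl)) (inj₁ refl) _ lt = ⊥-elim (ℕP.<-asym lt (ℕP.n<1+n m))
swapV-mono-upper {m} (inj₂ (inj₁ refl)) (inj₂ (inj₁ refl)) _ lt = ⊥-elim (ℕP.<-irrefl refl lt)
swapV-mono-upper {m} (inj₂ (inj₁ refl)) (inj₂ (inj₂ refl)) h lt = ⊥-elim (h refl refl)
swapV-mono-upper {m} (inj₂ (inj₂ refl)) k~ _ lt = ⊥-elim (ℕP.<⇒≱ lt (near-upper k~))

swapV-mono-lower : ∀ {m j k} → Near m j → Near m k → (j ≡ m → k ≡ suc m → ⊥) → j < k →
  swapV (suc m) m j < swapV (suc m) m k
swapV-mono-lower {m} j~ (inj₁ refl) _ lt = ⊥-elim (ℕP.<⇒≱ lt (near-lower j~))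
swapV-mono-lower {m} (inj₁ refl) (inj₂ (inj₁ refl)) h lt = ⊥-elim (h refl refl)
swapV-mono-lower {m} (inj₂ (inj₁ refl)) (inj₂ (inj₁ refl)) _ lt = ⊥-elim (ℕP.<-irrefl refl lt)
swapV-mono-lower {m} (inj₂ (inj₂ refl)) (inj₂ (inj₁ refl)) _ lt = ⊥-elim (ℕP.<-asym lt (ℕP.n<1+n (suc m)))
swapV-mono-lower {m} (inj₁ refl) (inj₂ (inj₂ refl)) _ lt
  rewrite swapV-right (suc m) m
        | swapV-other (suc m) m {suc (suc m)} (≢-sym (ℕP.<⇒≢ (ℕP.n<1+n (suc m)))) (≢-sym (ℕP.<⇒≢ (ℕP.m<n⇒m<1+n (ℕP.n<1+n m)))) =
    ℕP.n<1+n (suc m)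
swapV-mono-lower {m} (inj₂ (inj₁ refl)) (inj₂ (inj₂ refl)) _ lt
  rewrite swapV-left (suc m) m
        | swapV-other (suc m) m {suc (suc m)} (≢-sym (ℕP.<⇒≢ (ℕP.n<1+n (suc m)))) (≢-sym (ℕP.<⇒≢ (ℕP.m<n⇒m<1+n (ℕP.n<1+n m)))) =
    ℕP.m<n⇒m<1+n (ℕP.n<1+n m)
swapV-mono-lower {m} (inj₂ (inj₂ refl)) (inj₂ (inj₂ refl)) _ lt = ⊥-elim (ℕP.<-irrefl refl lt)

-- A value absent from the word has position `length π`, hence no cell. The default row makes the
-- row function total, and it is the same for all fillings of a diagram.
rowOf : Maybe Cell → ℤ
rowOf (just (_ , y)) = y
rowOf nothing        = ℤ.0ℤ

rowOfValue : List Cell → Word → ℕ → ℤ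
rowOfValue cs π k = rowOf (cellAt cs (pos k π))

-- A filling, its relabellings and their inversions

module Filling (cs : List Cell) (cs↗ : AllPairs _≺_ cs) (π : Word) (π-perm : IsPerm (length cs) π) where

  f : Cell → ℕ
  f = val cs π

  ρ : ℕ → ℤ
  ρ = rowOfValue cs π

  f-At : ∀ {c} → c ∈ cs → At c (f c) cs π
  f-At c∈ with v , p ← ∈cells⇒At (proj₁ π-perm) c∈ = subst (λ w → At _ w cs π) (sym (At⇒val cs↗ p)) p

  f-cellAt : ∀ {c} → c ∈ cs → cellAt cs (pos (f c) π) ≡ just c
  f-cellAt c∈ = At⇒cellAt (perm-unique π-perm) (f-At c∈)

  f-range : ∀ {c} → c ∈ cs → 1 ≤ f c × f c ≤ length cs
  f-range c∈ = perm-range π-perm (At⇒∈word (f-At c∈))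

  ρ-f : ∀ {x y} → (x , y) ∈ cs → ρ (f (x , y)) ≡ y
  ρ-f c∈ = cong rowOf (f-cellAt c∈)

  f-inj : ∀ {c d} → c ∈ cs → d ∈ cs → f c ≡ f d → c ≡ d
  f-inj c∈ d∈ eq = just-injective
    (trans (sym (f-cellAt c∈)) (trans (cong (λ k → cellAt cs (pos k π)) eq) (f-cellAt d∈)))

  f-mono : ∀ {c d} → c ∈ cs → d ∈ cs → c ≺ d → pos (f c) π < pos (f d) π
  f-mono c∈ d∈ = At-mono cs↗ (perm-unique π-perm) (f-At c∈) (f-At d∈)

  f-reflect : ∀ {c d} → c ∈ cs → d ∈ cs → pos (f c) π < pos (f d) π → c ≺ d
  f-reflect c∈ d∈ lt with ≺-total (λ { refl → ℕP.<-irrefl refl lt })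
  ... | inj₁ c≺d = c≺d
  ... | inj₂ d≺c = ⊥-elim (ℕP.<-asym lt (f-mono d∈ c∈ d≺c))

  record Located (k : ℕ) : Set where
    constructor located
    field
      {col row} : ℤ
      cell∈     : (col , row) ∈ cs
      value     : f (col , row) ≡ k

  locate : ∀ {k} → 1 ≤ k → k ≤ length cs → Located k
  locate 1≤k k≤n with c , p ← ∈word⇒At (proj₁ π-perm) (proj₂ π-perm 1≤k k≤n) =
    located (At⇒∈cells p) (At⇒val cs↗ p)

  Monotone : (ℕ → ℕ) → Cell → Cell → Set
  Monotone g c d = (f c < f d → g (f c) < g (f d)) × (f d < f c → g (f d) < g (f c))

  reflect-< : ∀ g {c d} → Monotone g c d → g (f c) < g (f d) → f c < f d
  reflect-< g {c} {d} (_ , h) lt with ℕP.<-cmp (f c) (f d)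
  ... | tri< c<d _ _ = c<d
  ... | tri≈ _ eq _ = ⊥-elim (ℕP.<-irrefl (cong g eq) lt)
  ... | tri> _ _ d<c = ⊥-elim (ℕP.<-asym lt (h d<c))

  reflect-≤ : ∀ g {c d} → Monotone g c d → g (f c) ≤ g (f d) → f c ≤ f d
  reflect-≤ g (_ , h) le = ℕP.≮⇒≥ (λ d<c → ℕP.<⇒≱ (h d<c) le)

  Monotone-sym : ∀ g {c d} → Monotone g c d → Monotone g d c
  Monotone-sym g (h , k) = k , h

  reflect-Inv : ∀ g {c d e} → Monotone g c d → Monotone g d e → Monotone g c e →
    Inv (g (f c)) (g (f d)) (g (f e)) → Inv (f c) (f d) (f e)
  reflect-Inv g {c} {d} {e} cd de ce = Sum.map
    (λ (p , q) → reflect-< g (Monotone-sym g {d} {e} de) p , reflect-< g (Monotone-sym g {c} {d} cd) q)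
    (Sum.map (λ (p , q) → reflect-≤ g ce p , reflect-< g (Monotone-sym g {d} {e} de) q)
             (λ (p , q) → reflect-< g (Monotone-sym g {c} {d} cd) p , reflect-≤ g ce q))

  val-map : ∀ g {c} → c ∈ cs → val cs (map g π) c ≡ g (f c)
  val-map g c∈ = At⇒val cs↗ (At-map g (f-At c∈))

  -- Inversions and descents depend only on the comparisons listed here. The second alternative of
  -- `triple-mono` is for the one triple whose comparisons d̃_i does change.
  module Transfer (free : InvFree cs f) (g : ℕ → ℕ)
    (triple-mono : ∀ {x x' y} → (x , y) ∈ cs → (x' , y) ∈ cs → x ℤ.< x' → below (x , y) ∈ cs →
      (Monotone g (x , y) (x' , y) × Monotone g (x' , y) (below (x , y)) × Monotone g (x , y) (below (x , y)))
      ⊎ ¬ Inv (g (f (x , y))) (g (f (x' , y))) (g (f (below (x , y)))))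
    (row-mono : ∀ {x x' y} → (x , y) ∈ cs → (x' , y) ∈ cs → x ℤ.< x' → below (x , y) ∉ cs →
      Monotone g (x , y) (x' , y))
    (diag-mono : ∀ {x x' y} → below (x , y) ∈ cs → (x' , y) ∈ cs → x ℤ.< x' → (x , y) ∉ cs →
      Monotone g (below (x , y)) (x' , y))
    (column-mono : ∀ {c} → c ∈ cs → below c ∈ cs → Monotone g (below c) c)
    where

    free-map : InvFree cs (val cs (map g π))
    free-map = record
      { triple = triple'
      ; row = λ c∈ d∈ x<x' e∉ lt → InvFree.row free c∈ d∈ x<x' e∉
          (reflect-< g (Monotone-sym g (row-mono c∈ d∈ x<x' e∉)) (subst₂ _<_ (val-map g d∈) (val-map g c∈) lt))
      ; diag = λ e∈ d∈ x<x' c∉ lt → InvFree.diag free e∈ d∈ x<x' c∉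
          (reflect-< g (diag-mono e∈ d∈ x<x' c∉) (subst₂ _<_ (val-map g e∈) (val-map g d∈) lt))
      }
      where
      triple' : ∀ {x x' y} → (x , y) ∈ cs → (x' , y) ∈ cs → x ℤ.< x' → below (x , y) ∈ cs →
        ¬ Inv (val cs (map g π) (x , y)) (val cs (map g π) (x' , y)) (val cs (map g π) (below (x , y)))
      triple' c∈ d∈ x<x' e∈ i rewrite val-map g c∈ | val-map g d∈ | val-map g e∈
        with triple-mono c∈ d∈ x<x' e∈
      ... | inj₁ (cd , de , ce) = InvFree.triple free c∈ d∈ x<x' e∈ (reflect-Inv g cd de ce i)
      ... | inj₂ ¬i = ¬i i

    descents-map : descentsW cs (map g π) ≡ descentsW cs π
    descents-map = descentsW-cong cs (map g π) π go
      where
      go : ∀ {c} → c ∈ cs → below c ∈ cs →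
        (val cs (map g π) (below c) <ᵇ val cs (map g π) c) ≡ (f (below c) <ᵇ f c)
      go c∈ e∈ rewrite val-map g c∈ | val-map g e∈ =
        <ᵇ-cong (reflect-< g (column-mono c∈ e∈)) (proj₁ (column-mono c∈ e∈))

  Copistoled : Cell → Cell → Set
  Copistoled c d = ∃ λ s → s ∈ cs × InPistol s c × InPistol s d

  -- Every comparison that decides an inversion or a descent is between two cells of one pistol.
  -- This is what pistols are for: exchanging consecutive values which share none is harmless.
  module CopistolTransfer (free : InvFree cs f) (g : ℕ → ℕ)
    (mono : ∀ {c d} → c ∈ cs → d ∈ cs → Copistoled c d → Monotone g c d) where

    private
      triple-mono : ∀ {x x' y} → (x , y) ∈ cs → (x' , y) ∈ cs → x ℤ.< x' → below (x , y) ∈ cs →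
        (Monotone g (x , y) (x' , y) × Monotone g (x' , y) (below (x , y)) × Monotone g (x , y) (below (x , y)))
        ⊎ ¬ Inv (g (f (x , y))) (g (f (x' , y))) (g (f (below (x , y))))
      triple-mono {x} {x'} {y} c∈ d∈ x<x' e∈ =
        let c~ = inj₁ (refl , ℤP.≤-refl)
            d~ = inj₁ (refl , ℤP.<⇒≤ x<x')
            e~ = inj₂ (refl , ℤP.≤-refl)
        in inj₁ ( mono c∈ d∈ ((x , y) , c∈ , c~ , d~)
                , mono d∈ e∈ ((x , y) , c∈ , d~ , e~)
                , mono c∈ e∈ ((x , y) , c∈ , c~ , e~))

      row-mono : ∀ {x x' y} → (x , y) ∈ cs → (x' , y) ∈ cs → x ℤ.< x' → below (x , y) ∉ cs →
        Monotone g (x , y) (x' , y)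
      row-mono {x} {x'} {y} c∈ d∈ x<x' e∉ =
        mono c∈ d∈ ((x , y) , c∈ , inj₁ (refl , ℤP.≤-refl) , inj₁ (refl , ℤP.<⇒≤ x<x'))

      diag-mono : ∀ {x x' y} → below (x , y) ∈ cs → (x' , y) ∈ cs → x ℤ.< x' → (x , y) ∉ cs →
        Monotone g (below (x , y)) (x' , y)
      diag-mono {x} {x'} {y} e∈ d∈ x<x' c∉ =
        -- The cell (x , y) is missing, so the pistol has to start at the other cell, which lies
        -- further right in its row.
        mono e∈ d∈ ((x' , y) , d∈ , inj₂ (refl , ℤP.<⇒≤ x<x') , inj₁ (refl , ℤP.≤-refl))

      column-mono : ∀ {c} → c ∈ cs → below c ∈ cs → Monotone g (below c) c
      column-mono {c} c∈ e∈ = mono e∈ c∈ (c , c∈ , inj₂ (refl , ℤP.≤-refl) , inj₁ (refl , ℤP.≤-refl))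

    open Transfer free g triple-mono row-mono diag-mono column-mono public

  -- The three near values sit in an L-shape p, q, below p; the relabelling only
  -- changes the relative order of q with the other two.
  module CornerTransfer (free : InvFree cs f) {m : ℕ} {g : ℕ → ℕ} (g-relabel : Relabel m g)
    {x₁ x₂ y₁ : ℤ} (p∈ : (x₁ , y₁) ∈ cs) (p'∈ : below (x₁ , y₁) ∈ cs) (x₁<x₂ : x₁ ℤ.< x₂)
    (near-cell : ∀ {c} → c ∈ cs → Near m (f c) → c ≡ (x₁ , y₁) ⊎ c ≡ (x₂ , y₁) ⊎ c ≡ below (x₁ , y₁))
    (pp'-mono : Monotone g (x₁ , y₁) (below (x₁ , y₁)))
    (corner : ¬ Inv (g (f (x₁ , y₁))) (g (f (x₂ , y₁))) (g (f (below (x₁ , y₁)))))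
    where

    private
      p q p' : Cell
      p  = x₁ , y₁
      q  = x₂ , y₁
      p' = below p

      -- The comparisons whose outcome may change. The lemmas below show that q is compared with p
      -- or p' only in the triple p, q, p' itself, which is handled by `corner`.
      Clash : Cell → Cell → Set
      Clash c d = c ≡ q × (d ≡ p ⊎ d ≡ p')

      mono-< : ∀ {c d} → c ∈ cs → d ∈ cs → ¬ Clash c d → ¬ Clash d c → f c < f d → g (f c) < g (f d)
      mono-< {c} {d} c∈ d∈ ¬cd ¬dc c<d = Relabel.mono-unless-near g-relabel near-mono c<d
        where
        near-mono : Near m (f c) → Near m (f d) → g (f c) < g (f d)
        near-mono c~ d~ with near-cell c∈ c~ | near-cell d∈ d~
        ... | inj₁ refl | inj₁ refl = ⊥-elim (ℕP.<-irrefl refl c<d)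
        ... | inj₁ refl | inj₂ (inj₁ refl) = ⊥-elim (¬dc (refl , inj₁ refl))
        ... | inj₁ refl | inj₂ (inj₂ refl) = proj₁ pp'-mono c<d
        ... | inj₂ (inj₁ refl) | inj₁ refl = ⊥-elim (¬cd (refl , inj₁ refl))
        ... | inj₂ (inj₁ refl) | inj₂ (inj₁ refl) = ⊥-elim (ℕP.<-irrefl refl c<d)
        ... | inj₂ (inj₁ refl) | inj₂ (inj₂ refl) = ⊥-elim (¬cd (refl , inj₂ refl))
        ... | inj₂ (inj₂ refl) | inj₁ refl = proj₂ pp'-mono c<d
        ... | inj₂ (inj₂ refl) | inj₂ (inj₁ refl) = ⊥-elim (¬dc (refl , inj₂ refl))
        ... | inj₂ (inj₂ refl) | inj₂ (inj₂ refl) = ⊥-elim (ℕP.<-irrefl refl c<d)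

      mono : ∀ {c d} → c ∈ cs → d ∈ cs → ¬ Clash c d → ¬ Clash d c → Monotone g c d
      mono c∈ d∈ ¬cd ¬dc = mono-< c∈ d∈ ¬cd ¬dc , mono-< d∈ c∈ ¬dc ¬cd

      row-clash₁ : ∀ {x x' y} → x ℤ.< x' → ¬ Clash (x , y) (x' , y)
      row-clash₁ x<x' (refl , inj₁ refl) = ℤP.<-asym x<x' x₁<x₂
      row-clash₁ x<x' (refl , inj₂ eq)   = pred-≢ (sym (cong proj₂ eq))

      row-clash₂ : ∀ {x x' y} → (x , y) ≢ p → ¬ Clash (x' , y) (x , y)
      row-clash₂ c≢p (refl , inj₁ eq) = c≢p eq
      row-clash₂ c≢p (refl , inj₂ eq) = pred-≢ (sym (cong proj₂ eq))

      below-injective : ∀ {c d} → below c ≡ below d → c ≡ d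
      below-injective eq = cong₂ _,_ (cong proj₁ eq) (∙-cancelʳ (AbelianGroup.group ℤP.+-0-abelianGroup) ℤ.-1ℤ _ _ (cong proj₂ eq))

      below-clash : ∀ {e d} → proj₂ e ≡ proj₂ d ℤ.- ℤ.1ℤ → ¬ Clash e d
      below-clash eq (refl , inj₁ refl) = pred-≢ (sym eq)
      below-clash eq (refl , inj₂ refl) =
        ℤP.<-irrefl (sym eq) (ℤP.<-trans (pred-< (y₁ ℤ.- ℤ.1ℤ)) (pred-< y₁))

      above-clash : ∀ {c d} → proj₂ d ≡ proj₂ c → c ≢ p → ¬ Clash d (below c)
      above-clash eq c≢p (refl , inj₁ e) = pred-≢ (trans (cong proj₂ e) eq)
      above-clash eq c≢p (refl , inj₂ e) = c≢p (below-injective e)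

      column-clash : ∀ {c} → ¬ Clash c (below c)
      column-clash (refl , inj₁ e) = pred-≢ (cong proj₂ e)
      column-clash (refl , inj₂ e) = ℤP.<-irrefl (sym (cong proj₁ e)) x₁<x₂

      _≟ᶜ_ : (c d : Cell) → Dec (c ≡ d)
      _≟ᶜ_ = ×P.≡-dec ℤP._≟_ ℤP._≟_

      triple-mono : ∀ {x x' y} → (x , y) ∈ cs → (x' , y) ∈ cs → x ℤ.< x' → below (x , y) ∈ cs →
        (Monotone g (x , y) (x' , y) × Monotone g (x' , y) (below (x , y)) × Monotone g (x , y) (below (x , y)))
        ⊎ ¬ Inv (g (f (x , y))) (g (f (x' , y))) (g (f (below (x , y))))
      triple-mono {x} {x'} {y} c∈ d∈ x<x' e∈ with (x , y) ≟ᶜ p | (x' , y) ≟ᶜ q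
      ... | yes refl | yes refl = inj₂ corner
      ... | yes refl | no d≢q = inj₁
        ( mono c∈ d∈ (row-clash₁ x<x') (λ cl → d≢q (proj₁ cl))
        , mono d∈ e∈ (λ cl → d≢q (proj₁ cl)) (below-clash refl)
        , mono c∈ e∈ column-clash (below-clash refl))
      ... | no c≢p | _ = inj₁
        ( mono c∈ d∈ (row-clash₁ x<x') (row-clash₂ c≢p)
        , mono d∈ e∈ (above-clash refl c≢p) (below-clash refl)
        , mono c∈ e∈ column-clash (below-clash refl))

      row-mono : ∀ {x x' y} → (x , y) ∈ cs → (x' , y) ∈ cs → x ℤ.< x' → below (x , y) ∉ cs →
        Monotone g (x , y) (x' , y)
      row-mono c∈ d∈ x<x' e∉ = mono c∈ d∈ (row-clash₁ x<x') (row-clash₂ (λ { refl → e∉ p'∈ }))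

      diag-mono : ∀ {x x' y} → below (x , y) ∈ cs → (x' , y) ∈ cs → x ℤ.< x' → (x , y) ∉ cs →
        Monotone g (below (x , y)) (x' , y)
      diag-mono e∈ d∈ x<x' c∉ = mono e∈ d∈ (below-clash refl) (above-clash refl (λ { refl → c∉ p∈ }))

      column-mono : ∀ {c} → c ∈ cs → below c ∈ cs → Monotone g (below c) c
      column-mono c∈ e∈ = mono e∈ c∈ (below-clash refl) column-clash

    open Transfer free g triple-mono row-mono diag-mono column-mono public

  module _ (free : InvFree cs f) where
    open InvFree free

    -- With distinct entries a triple is no inversion exactly for e < c < d and its cyclic
    -- rotations. Of these only e < c < d itself has e < d, and if c is missing then e < d is an
    -- inversion pair.
    above-between : ∀ {x x' y} → below (x , y) ∈ cs → (x' , y) ∈ cs → x ℤ.< x' →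
      f (below (x , y)) < f (x' , y) →
      (x , y) ∈ cs × f (below (x , y)) < f (x , y) × f (x , y) < f (x' , y)
    above-between {x} {x'} {y} e∈ d∈ x<x' e<d with (x , y) ∈? cs
    ... | no c∉ = ⊥-elim (diag e∈ d∈ x<x' c∉ e<d)
    ... | yes c∈ with ℕP.<-cmp (f (x , y)) (f (x' , y))
    ...   | tri≈ _ eq _ = ⊥-elim (ℤP.<-irrefl (cong proj₁ (f-inj c∈ d∈ eq)) x<x')
    ...   | tri> _ _ d<c = ⊥-elim (triple c∈ d∈ x<x' e∈ (inj₁ (e<d , d<c)))
    ...   | tri< c<d _ _ with f (x , y) ℕP.≤? f (below (x , y))
    ...     | yes c≤e = ⊥-elim (triple c∈ d∈ x<x' e∈ (inj₂ (inj₁ (c≤e , e<d))))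
    ...     | no  c≰e = c∈ , ℕP.≰⇒> c≰e , c<d

    -- By the same cyclic rule d < c leaves only d < e < c, and if e is missing then d < c is an
    -- inversion pair.
    row-inversion : ∀ {x x' y} → (x , y) ∈ cs → (x' , y) ∈ cs → x ℤ.< x' → f (x' , y) < f (x , y) →
      below (x , y) ∈ cs × f (x' , y) < f (below (x , y)) × f (below (x , y)) < f (x , y)
    row-inversion {x} {x'} {y} c∈ d∈ x<x' d<c with below (x , y) ∈? cs
    ... | no e∉ = ⊥-elim (row c∈ d∈ x<x' e∉ d<c)
    ... | yes e∈ with ℕP.<-cmp (f (below (x , y))) (f (x' , y))
    ...   | tri< e<d _ _ = ⊥-elim (triple c∈ d∈ x<x' e∈ (inj₁ (e<d , d<c)))
    ...   | tri≈ _ eq _ = ⊥-elim (pred-≢ (cong proj₂ (f-inj e∈ d∈ eq)))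
    ...   | tri> _ _ d<e with f (x , y) ℕP.≤? f (below (x , y))
    ...     | yes c≤e = ⊥-elim (triple c∈ d∈ x<x' e∈ (inj₂ (inj₂ (d<c , c≤e))))
    ...     | no  c≰e = e∈ , d<e , ℕP.≰⇒> c≰e

    -- If k+1 stood to the left of k, the entry below k+1 would lie strictly between the two.
    consecutive : ∀ {x x' y k} → (x , y) ∈ cs → (x' , y) ∈ cs → f (x , y) ≡ k → f (x' , y) ≡ suc k → x ℤ.< x'
    consecutive {x} {x'} {y} {k} c∈ d∈ p q with ℤP.<-cmp x x'
    ... | tri< x<x' _ _ = x<x'
    ... | tri≈ _ refl _ = ⊥-elim (ℕP.1+n≢n (trans (sym q) p))
    ... | tri> _ _ x'<x with e∈ , lt , gt ← row-inversion d∈ c∈ x'<x (subst (_< f (x' , y)) (sym p) (subst (k <_) (sym q) (ℕP.n<1+n k))) =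
      ⊥-elim (no-gap lt gt (trans q (cong suc (sym p))))

    order-consecutive : ∀ {c d k} → c ∈ cs → d ∈ cs → f c ≡ k → f d ≡ suc k →
      (proj₂ d ℤ.≤ proj₂ c → c ≺ d) × (proj₂ c ℤ.< proj₂ d → d ≺ c)
    order-consecutive {x , y} {x' , y'} c∈ d∈ p q = to , λ y<y' → inj₁ y<y'
      where
      to : y' ℤ.≤ y → (x , y) ≺ (x' , y')
      to y'≤y with y ℤP.≟ y'
      ... | yes refl = inj₂ (refl , consecutive c∈ d∈ p q)
      ... | no y≢y'  = inj₁ (ℤP.≤∧≢⇒< y'≤y (≢-sym y≢y'))

    module _ {m : ℕ} {xa ya xb yb xc yc : ℤ}
             (a∈ : (xa , ya) ∈ cs) (b∈ : (xb , yb) ∈ cs) (c∈ : (xc , yc) ∈ cs)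
             (fa : f (xa , ya) ≡ m) (fb : f (xb , yb) ≡ suc m) (fc : f (xc , yc) ≡ suc (suc m)) where

      private
        a<b : f (xa , ya) < f (xb , yb)
        a<b rewrite fa | fb = ℕP.n<1+n m

        b<c : f (xb , yb) < f (xc , yc)
        b<c rewrite fb | fc = ℕP.n<1+n (suc m)

        a<c : f (xa , ya) < f (xc , yc)
        a<c = ℕP.<-trans a<b b<c

        b≡1+a : f (xb , yb) ≡ suc (f (xa , ya))
        b≡1+a = trans fb (cong suc (sym fa))

        c≡1+b : f (xc , yc) ≡ suc (f (xb , yb))
        c≡1+b = trans fc (cong suc (sym fb))

        c≡2+a : f (xc , yc) ≡ suc (suc (f (xa , ya)))
        c≡2+a = trans fc (cong (λ k → suc (suc k)) (sym fa))

        is-b : ∀ {d} → d ∈ cs → f (xa , ya) < f d → f d < f (xc , yc) → d ≡ (xb , yb)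
        is-b d∈ lt gt = f-inj d∈ b∈ (trans (mid-gap lt gt c≡2+a) (sym b≡1+a))

        a≢c : (xa , ya) ≢ (xc , yc)
        a≢c eq = ℕP.<-irrefl (cong f eq) a<c

      -- The entry below i+1 must lie strictly between i-1 and i+1, so it is i.
      misordered : ya ≡ yc → xc ℤ.< xa → (xb , yb) ≡ below (xc , yc)
      misordered refl xc<xa with e∈ , lt , gt ← row-inversion c∈ a∈ xc<xa a<c = sym (is-b e∈ lt gt)

      -- In a row i+1 precedes i-1 only with i below i+1, and then the pistol starting at i+1 holds
      -- all three. For other triples π and the word with sorted rows therefore order i-1 and i+1
      -- alike.
      order-outer : ¬ Pistoled cs (xa , ya) (xb , yb) (xc , yc) → yc ℤ.≤ ya → (xa , ya) ≺ (xc , yc)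
      order-outer ¬pist yc≤ya with ℤP.<-cmp yc ya
      ... | tri< yc<ya _ _ = inj₁ yc<ya
      ... | tri> yc≮ya yc≢ya _ = ⊥-elim (yc≮ya (ℤP.≤∧≢⇒< yc≤ya yc≢ya))
      ... | tri≈ _ refl _ with ℤP.<-cmp xa xc
      ...   | tri< xa<xc _ _ = inj₂ (refl , xa<xc)
      ...   | tri≈ _ refl _ = ⊥-elim (a≢c refl)
      ...   | tri> _ _ xc<xa with refl ← misordered refl xc<xa =
        ⊥-elim (¬pist ((xc , yc) , c∈ , inj₁ (refl , ℤP.<⇒≤ xc<xa) , inj₂ (refl , ℤP.≤-refl) , inj₁ (refl , ℤP.≤-refl)))

      b-above-a : (xb , yb) ≺ (xa , ya) → ya ℤ.< yb
      b-above-a (inj₁ lt) = lt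
      b-above-a (inj₂ (refl , xb<xa)) = ⊥-elim (ℤP.<-asym xb<xa (consecutive a∈ b∈ fa fb))

      c-above-b : (xc , yc) ≺ (xb , yb) → yb ℤ.< yc
      c-above-b (inj₁ lt) = lt
      c-above-b (inj₂ (refl , xc<xb)) = ⊥-elim (ℤP.<-asym xc<xb (consecutive b∈ c∈ fb fc))

      -- Here i lies in the upper and i-1 in the lower row of the pistol. Were i-1 further left, the
      -- entry above it would lie strictly between i-1 and i; so they share a column. In the lower
      -- row i+1 would stand left of i-1, and `misordered` would put i there too.
      pistoled-first : Pistoled cs (xa , ya) (xb , yb) (xc , yc) → (xb , yb) ≺ (xa , ya) →
        (xa , ya) ≡ below (xb , yb) × yb ≡ yc × xb ℤ.< xc
      pistoled-first ((x₀ , y₀) , _ , a~ , b~ , c~) b≺a with b-above-a b≺a | a~ | b~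
      ... | ya<yb | inj₁ (refl , _) | _ = ⊥-elim (ℤP.<⇒≱ ya<yb (pistol-row b~))
      ... | ya<yb | inj₂ (refl , _) | inj₂ (refl , _) = ⊥-elim (ℤP.<-irrefl refl ya<yb)
      ... | ya<yb | inj₂ (refl , xa≤x₀) | inj₁ (refl , x₀≤xb) with ℤP.<-cmp xa xb
      ...   | tri> _ _ xb<xa = ⊥-elim (ℤP.<⇒≱ xb<xa (ℤP.≤-trans xa≤x₀ x₀≤xb))
      ...   | tri< xa<xb _ _ with _ , lt , gt ← above-between a∈ b∈ xa<xb a<b = ⊥-elim (no-gap lt gt b≡1+a)
      ...   | tri≈ _ refl _ with c~
      ...     | inj₁ (refl , _) = refl , refl , consecutive b∈ c∈ fb fc
      ...     | inj₂ (refl , xc≤x₀) with ℤP.<-cmp xc xa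
      ...       | tri< xc<xa _ _ = ⊥-elim (ℤP.<-irrefl (sym (cong proj₂ (misordered refl xc<xa))) (ℤP.<-trans (pred-< (y₀ ℤ.- ℤ.1ℤ)) (pred-< y₀)))
      ...       | tri≈ _ refl _  = ⊥-elim (a≢c refl)
      ...       | tri> _ _ xa<xc = ⊥-elim (ℤP.<⇒≱ xa<xc (ℤP.≤-trans xc≤x₀ x₀≤xb))

      -- As before i+1 stands directly above i. Were i-1 in the lower row, left of i, the entry
      -- above it would lie strictly between i-1 and i+1; this is i, which is in the lower row.
      pistoled-last : Pistoled cs (xa , ya) (xb , yb) (xc , yc) → (xa , ya) ≺ (xb , yb) → (xc , yc) ≺ (xb , yb) →
        (xb , yb) ≡ below (xc , yc) × yc ≡ ya × xc ℤ.< xa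
      pistoled-last ((x₀ , y₀) , _ , a~ , b~ , c~) a≺b c≺b with c-above-b c≺b | b~ | c~
      ... | yb<yc | inj₁ (refl , _) | _ = ⊥-elim (ℤP.<⇒≱ yb<yc (pistol-row c~))
      ... | yb<yc | inj₂ (refl , _) | inj₂ (refl , _) = ⊥-elim (ℤP.<-irrefl refl yb<yc)
      ... | yb<yc | inj₂ (refl , xb≤x₀) | inj₁ (refl , x₀≤xc) with ℤP.<-cmp xb xc
      ...   | tri> _ _ xc<xb = ⊥-elim (ℤP.<⇒≱ xc<xb (ℤP.≤-trans xb≤x₀ x₀≤xc))
      ...   | tri< xb<xc _ _ with _ , lt , gt ← above-between b∈ c∈ xb<xc b<c = ⊥-elim (no-gap lt gt c≡1+b)
      ...   | tri≈ _ refl _ with a~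
      ...     | inj₁ (refl , x₀≤xa) = refl , refl , ℤP.≤∧≢⇒< (ℤP.≤-trans xb≤x₀ x₀≤xa) (λ { refl → a≢c refl })
      ...     | inj₂ (refl , xa≤x₀)
        with e∈ , lt , gt ← above-between a∈ c∈ (≺⇒col< a≺b refl) a<c =
        ⊥-elim (pred-≢ (sym (cong proj₂ (is-b e∈ lt gt))))

    -- `ρ (inv k)` is the row of k after the relabelling `g`. So `step-row` asserts that the rows
    -- move by the transposition `rowDual` even where `g` is a 3-cycle.
    record Step (m : ℕ) : Set where
      field
        {g}       : ℕ → ℕ
        g-relabel : Relabel m g
        step≡     : Dδ cs (suc m) π ≡ map g π
        step-row  : ∀ k → ρ (Relabel.inv g-relabel k) ≡ ρ (rowDual m ρ k)
        step-free : InvFree cs (val cs (map g π))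
        step-desc : descentsW cs (map g π) ≡ descentsW cs π

    module _ {m : ℕ} {xa ya xb yb xc yc : ℤ}
             (a∈ : (xa , ya) ∈ cs) (b∈ : (xb , yb) ∈ cs) (c∈ : (xc , yc) ∈ cs)
             (fa : f (xa , ya) ≡ m) (fb : f (xb , yb) ≡ suc m) (fc : f (xc , yc) ≡ suc (suc m)) where

      private
        A B C : Cell
        A = xa , ya
        B = xb , yb
        C = xc , yc

        pos-mono : ∀ {c d j k} → c ∈ cs → d ∈ cs → f c ≡ j → f d ≡ k → c ≺ d → pos j π < pos k π
        pos-mono c∈ d∈ refl refl = f-mono c∈ d∈

        cell-of : ∀ {c k} → c ∈ cs → f c ≡ k → cellAt cs (pos k π) ≡ just c
        cell-of c∈ refl = f-cellAt c∈

        row-of : ∀ {c k} → c ∈ cs → f c ≡ k → ρ k ≡ proj₂ c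
        row-of c∈ refl = ρ-f c∈

        isPistoled : Bool
        isPistoled = pistoled cs (pos m π ∷ pos (suc m) π ∷ pos (suc (suc m)) π ∷ [])

        isPistoled⇔ : T isPistoled ⇔ Pistoled cs A B C
        isPistoled⇔ = pistoled⇔ cs (cell-of a∈ fa) (cell-of b∈ fb) (cell-of c∈ fc)

        locate-near : ∀ {c} → c ∈ cs → Near m (f c) → c ≡ A ⊎ c ≡ B ⊎ c ≡ C
        locate-near d∈ (inj₁ eq)        = inj₁ (f-inj d∈ a∈ (trans eq (sym fa)))
        locate-near d∈ (inj₂ (inj₁ eq)) = inj₂ (inj₁ (f-inj d∈ b∈ (trans eq (sym fb))))
        locate-near d∈ (inj₂ (inj₂ eq)) = inj₂ (inj₂ (f-inj d∈ c∈ (trans eq (sym fc))))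

        distinct : ∀ {j k} {c d : Cell} → f c ≡ j → f d ≡ k → j < k → c ≢ d
        distinct refl refl j<k refl = ℕP.<-irrefl refl j<k

        rows-ab : A ≺ B → (ρ (suc m) ≤ℤ ρ m) ≡ true
        rows-ab a≺b rewrite row-of a∈ fa | row-of b∈ fb = ≤ℤ-true (≺⇒row≥ a≺b)

        rows-ba : B ≺ A → (ρ (suc m) ≤ℤ ρ m) ≡ false
        rows-ba b≺a rewrite row-of a∈ fa | row-of b∈ fb = ≤ℤ-false (b-above-a a∈ b∈ c∈ fa fb fc b≺a)

        rows-bc : B ≺ C → (ρ (suc (suc m)) ≤ℤ ρ (suc m)) ≡ true
        rows-bc b≺c rewrite row-of b∈ fb | row-of c∈ fc = ≤ℤ-true (≺⇒row≥ b≺c)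

        rows-cb : C ≺ B → (ρ (suc (suc m)) ≤ℤ ρ (suc m)) ≡ false
        rows-cb c≺b rewrite row-of b∈ fb | row-of c∈ fc = ≤ℤ-false (c-above-b a∈ b∈ c∈ fa fb fc c≺b)

        rows-ac : A ≺ C → (ρ (suc (suc m)) ≤ℤ ρ m) ≡ true
        rows-ac a≺c rewrite row-of a∈ fa | row-of c∈ fc = ≤ℤ-true (≺⇒row≥ a≺c)

        rows-ca : ¬ Pistoled cs A B C → C ≺ A → (ρ (suc (suc m)) ≤ℤ ρ m) ≡ false
        rows-ca ¬pist c≺a rewrite row-of a∈ fa | row-of c∈ fc =
          ≤ℤ-false (ℤP.≰⇒> (λ le → ≺-asym c≺a (order-outer a∈ b∈ c∈ fa fb fc ¬pist le)))

        D-dOp : ¬ Pistoled cs A B C → Dδ cs (suc m) π ≡ dOp (suc m) π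
        D-dOp ¬pist with isPistoled in eq
        ... | false = refl
        ... | true  = ⊥-elim (¬pist (Equivalence.to isPistoled⇔ (Equivalence.from T-≡ eq)))

        D-dtOp : Pistoled cs A B C → Dδ cs (suc m) π ≡ dtOp (suc m) π
        D-dtOp pist with isPistoled in eq
        ... | true  = refl
        ... | false = ⊥-elim (subst T eq (Equivalence.from isPistoled⇔ pist))

        before : ∀ {c d j k} → c ∈ cs → d ∈ cs → f c ≡ j → f d ≡ k → c ≺ d → (pos j π <ᵇ pos k π) ≡ true
        before c∈ d∈ p q c≺d = <⇒<ᵇ-true (pos-mono c∈ d∈ p q c≺d)

        after : ∀ {c d j k} → c ∈ cs → d ∈ cs → f c ≡ j → f d ≡ k → d ≺ c → (pos j π <ᵇ pos k π) ≡ false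
        after c∈ d∈ p q d≺c = ≮⇒<ᵇ-false (ℕP.<-asym (pos-mono d∈ c∈ q p d≺c))

        pos-distinct : ∀ {c d j k} → c ∈ cs → d ∈ cs → f c ≡ j → f d ≡ k → c ≢ d → pos j π ≢ pos k π
        pos-distinct c∈ d∈ p q c≢d eq = c≢d (just-injective
          (trans (sym (cell-of c∈ p)) (trans (cong (cellAt cs) eq) (cell-of d∈ q))))

        A≢B : A ≢ B
        A≢B = distinct fa fb (ℕP.n<1+n m)

        B≢C : B ≢ C
        B≢C = distinct fb fc (ℕP.n<1+n (suc m))

        A≢C : A ≢ C
        A≢C = distinct fa fc (ℕP.m<n⇒m<1+n (ℕP.n<1+n m))

        posA≢posB : pos m π ≢ pos (suc m) π
        posA≢posB = pos-distinct a∈ b∈ fa fb A≢B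

        posB≢posC : pos (suc m) π ≢ pos (suc (suc m)) π
        posB≢posC = pos-distinct b∈ c∈ fb fc B≢C

        -- The same three Booleans describe the triple by positions in π and by rows; d_i on π and
        -- d_i on the word with sorted rows are then the same relabelling.
        module Dual {p q s : Bool}
          (posP : (pos m π <ᵇ pos (suc m) π) ≡ p)
          (posQ : (pos (suc m) π <ᵇ pos (suc (suc m)) π) ≡ q)
          (posS : (pos m π <ᵇ pos (suc (suc m)) π) ≡ s)
          (rowP : (ρ (suc m) ≤ℤ ρ m) ≡ p)
          (rowQ : (ρ (suc (suc m)) ≤ℤ ρ (suc m)) ≡ q)
          (rowS : (ρ (suc (suc m)) ≤ℤ ρ m) ≡ s)
          where

          dOp≡ : dOp (suc m) π ≡ map (dual p q s m) π
          dOp≡ = trans (dOp-dual m π posA≢posB posB≢posC)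
            (cong (λ h → map h π) (dual-cong m posP posQ posS))

          dualStep : Dδ cs (suc m) π ≡ dOp (suc m) π →
            (∀ {c d} → c ∈ cs → d ∈ cs → Copistoled c d → Monotone (dual p q s m) c d) → Step m
          dualStep D≡ mono = record
            { g-relabel = dual-relabel p q s m
            ; step≡ = trans D≡ dOp≡
            ; step-row = λ k → cong ρ (trans (dual-inv p q s m k) (cong (λ h → h k) (sym (dual-cong m rowP rowQ rowS))))
            ; step-free = free-map
            ; step-desc = descents-map
            }
            where open CopistolTransfer free (dual p q s m) mono

        mono-upper : (Copistoled B C → ⊥) →
          ∀ {c d} → c ∈ cs → d ∈ cs → Copistoled c d → Monotone (swapV (suc m) (suc (suc m))) c d
        mono-upper ¬bc c∈' d∈' (s , s∈ , c~ , d~) =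
            mono-unless-near (λ j~ k~ lt → swapV-mono-upper j~ k~ (λ p q → contra c∈' d∈' p q (s , s∈ , c~ , d~)) lt)
          , mono-unless-near (λ j~ k~ lt → swapV-mono-upper j~ k~ (λ p q → contra d∈' c∈' p q (s , s∈ , d~ , c~)) lt)
          where
          contra : ∀ {c d} → c ∈ cs → d ∈ cs → f c ≡ suc m → f d ≡ suc (suc m) → Copistoled c d → ⊥
          contra c∈' d∈' p q co with refl ← f-inj c∈' b∈ (trans p (sym fb)) | refl ← f-inj d∈' c∈ (trans q (sym fc)) = ¬bc co
          mono-unless-near : ∀ {j k} → (Near m j → Near m k → j < k → swapV (suc m) (suc (suc m)) j < swapV (suc m) (suc (suc m)) k) →
            j < k → swapV (suc m) (suc (suc m)) j < swapV (suc m) (suc (suc m)) k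
          mono-unless-near h lt = Relabel.mono-unless-near (swapV-relabel {m} (suc m) (suc (suc m)) (inj₂ (inj₁ refl)) (inj₂ (inj₂ refl))) (λ j~ k~ → h j~ k~ lt) lt

        mono-lower : (Copistoled A B → ⊥) →
          ∀ {c d} → c ∈ cs → d ∈ cs → Copistoled c d → Monotone (swapV (suc m) m) c d
        mono-lower ¬ab c∈' d∈' (s , s∈ , c~ , d~) =
            mono-unless-near (λ j~ k~ lt → swapV-mono-lower j~ k~ (λ p q → contra c∈' d∈' p q (s , s∈ , c~ , d~)) lt)
          , mono-unless-near (λ j~ k~ lt → swapV-mono-lower j~ k~ (λ p q → contra d∈' c∈' p q (s , s∈ , d~ , c~)) lt)
          where
          contra : ∀ {c d} → c ∈ cs → d ∈ cs → f c ≡ m → f d ≡ suc m → Copistoled c d → ⊥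
          contra c∈' d∈' p q co with refl ← f-inj c∈' a∈ (trans p (sym fa)) | refl ← f-inj d∈' b∈ (trans q (sym fb)) = ¬ab co
          mono-unless-near : ∀ {j k} → (Near m j → Near m k → j < k → swapV (suc m) m j < swapV (suc m) m k) →
            j < k → swapV (suc m) m j < swapV (suc m) m k
          mono-unless-near h lt = Relabel.mono-unless-near (swapV-relabel {m} (suc m) m (inj₂ (inj₁ refl)) (inj₁ refl)) (λ j~ k~ → h j~ k~ lt) lt

        between-D : (pos m π <ᵇ pos (suc m) π) ≡ (pos (suc m) π <ᵇ pos (suc (suc m)) π) → dOp (suc m) π ≡ π →
          Dδ cs (suc m) π ≡ dOp (suc m) π
        between-D eq dOp≡π with isPistoled
        ... | true  = trans (dtOp-between m π posA≢posB posB≢posC eq) (sym dOp≡π)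
        ... | false = refl

        first-plain : ¬ Pistoled cs A B C → B ≺ A → B ≺ C → Step m
        first-plain ¬pist b≺a b≺c with ≺-total A≢C
        -- Now i+1 is the value farther from i, and i-1 stands between them; by convexity a pistol
        -- with i and i+1 would make the triple pistoled.
        ... | inj₁ a≺c = dualStep (D-dOp ¬pist) (mono-upper λ (s , s∈ , b~ , c~) →
                ¬pist (s , s∈ , pistol-convex b~ c~ b≺a a≺c , b~ , c~))
          where open Dual (after a∈ b∈ fa fb b≺a) (before b∈ c∈ fb fc b≺c) (before a∈ c∈ fa fc a≺c)
                          (rows-ba b≺a) (rows-bc b≺c) (rows-ac a≺c)
        ... | inj₂ c≺a = dualStep (D-dOp ¬pist) (mono-lower λ (s , s∈ , a~ , b~) →
                ¬pist (s , s∈ , a~ , b~ , pistol-convex b~ a~ b≺c c≺a))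
          where open Dual (after a∈ b∈ fa fb b≺a) (before b∈ c∈ fb fc b≺c) (after a∈ c∈ fa fc c≺a)
                          (rows-ba b≺a) (rows-bc b≺c) (rows-ca ¬pist c≺a)

        last-plain : ¬ Pistoled cs A B C → A ≺ B → C ≺ B → Step m
        last-plain ¬pist a≺b c≺b with ≺-total A≢C
        ... | inj₁ a≺c = dualStep (D-dOp ¬pist) (mono-lower λ (s , s∈ , a~ , b~) →
                ¬pist (s , s∈ , a~ , b~ , pistol-convex a~ b~ a≺c c≺b))
          where open Dual (before a∈ b∈ fa fb a≺b) (after b∈ c∈ fb fc c≺b) (before a∈ c∈ fa fc a≺c)
                          (rows-ab a≺b) (rows-cb c≺b) (rows-ac a≺c)
        ... | inj₂ c≺a = dualStep (D-dOp ¬pist) (mono-upper λ (s , s∈ , b~ , c~) →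
                ¬pist (s , s∈ , pistol-convex c~ b~ c≺a a≺b , b~ , c~))
          where open Dual (before a∈ b∈ fa fb a≺b) (after b∈ c∈ fb fc c≺b) (after a∈ c∈ fa fc c≺a)
                          (rows-ab a≺b) (rows-cb c≺b) (rows-ca ¬pist c≺a)

        increasing : A ≺ B → B ≺ C → Step m
        increasing a≺b b≺c = dualStep
          (between-D (trans (before a∈ b∈ fa fb a≺b) (sym (before b∈ c∈ fb fc b≺c))) (trans dOp≡ (map-id π)))
          (λ _ _ _ → (λ lt → lt) , (λ lt → lt))
          where
          a≺c : A ≺ C
          a≺c = f-reflect a∈ c∈ (ℕP.<-trans (f-mono a∈ b∈ a≺b) (f-mono b∈ c∈ b≺c))
          open Dual (before a∈ b∈ fa fb a≺b) (before b∈ c∈ fb fc b≺c) (before a∈ c∈ fa fc a≺c)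
                    (rows-ab a≺b) (rows-bc b≺c) (rows-ac a≺c)

        decreasing : B ≺ A → C ≺ B → Step m
        decreasing b≺a c≺b = dualStep
          (between-D (trans (after a∈ b∈ fa fb b≺a) (sym (after b∈ c∈ fb fc c≺b))) (trans dOp≡ (map-id π)))
          (λ _ _ _ → (λ lt → lt) , (λ lt → lt))
          where
          c≺a : C ≺ A
          c≺a = f-reflect c∈ a∈ (ℕP.<-trans (f-mono c∈ b∈ c≺b) (f-mono b∈ a∈ b≺a))
          rowS : (ρ (suc (suc m)) ≤ℤ ρ m) ≡ false
          rowS rewrite row-of a∈ fa | row-of c∈ fc =
            ≤ℤ-false (ℤP.<-trans (b-above-a a∈ b∈ c∈ fa fb fc b≺a) (c-above-b a∈ b∈ c∈ fa fb fc c≺b))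
          open Dual (after a∈ b∈ fa fb b≺a) (after b∈ c∈ fb fc c≺b) (after a∈ c∈ fa fc c≺a)
                    (rows-ba b≺a) (rows-cb c≺b) rowS

        <-off₁ : m < suc m
        <-off₁ = ℕP.n<1+n m

        <-off₂ : suc m < suc (suc m)
        <-off₂ = ℕP.n<1+n (suc m)

        m≢1 : m ≢ suc m
        m≢1 = ℕP.<⇒≢ <-off₁

        1≢2 : suc m ≢ suc (suc m)
        1≢2 = ℕP.<⇒≢ <-off₂

        m≢2 : m ≢ suc (suc m)
        m≢2 = ℕP.<⇒≢ (ℕP.<-trans <-off₁ <-off₂)

        pistoled-row : ∀ {p q s} (h : ℕ → ℕ) → (∀ {k} → ¬ Near m k → h k ≡ k) →
          (ρ (suc m) ≤ℤ ρ m) ≡ p → (ρ (suc (suc m)) ≤ℤ ρ (suc m)) ≡ q → (ρ (suc (suc m)) ≤ℤ ρ m) ≡ s →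
          (∀ {k} → Near m k → ρ (h k) ≡ ρ (dual p q s m k)) → ∀ k → ρ (h k) ≡ ρ (rowDual m ρ k)
        pistoled-row {p} {q} {s} h far refl refl refl near k with near-or-not m k
        ... | inj₁ k~ = near k~
        ... | inj₂ k≁ = cong ρ (trans (far (far-not-near k≁)) (sym (Relabel.far (dual-relabel p q s m) (far-not-near k≁))))

        first-pistoled : Pistoled cs A B C → B ≺ A → B ≺ C → Step m
        first-pistoled pist b≺a b≺c with pistoled-first a∈ b∈ c∈ fa fb fc pist b≺a
        ... | refl , refl , xb<xc = record
          { g-relabel = relabel
          ; step≡ = trans (D-dtOp pist) (dtOp-first m π (pos-mono b∈ c∈ fb fc b≺c) (pos-mono c∈ a∈ fc fa c≺a))
          ; step-row = pistoled-row (Relabel.inv relabel) (Relabel.inv-far relabel) (rows-ba b≺a) (rows-bc b≺c) rowS near-row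
          ; step-free = free-map
          ; step-desc = descents-map
          }
          where
          g : ℕ → ℕ
          g = cyc3 (suc m) (suc (suc m)) m
          relabel : Relabel m g
          relabel = cyc3-relabel _ _ _ 1≢2 (≢-sym m≢1) (≢-sym m≢2) (inj₂ (inj₁ refl)) (inj₂ (inj₂ refl)) (inj₁ refl)
          c≺a : C ≺ A
          c≺a = inj₁ (pred-< yb)
          rowS : (ρ (suc (suc m)) ≤ℤ ρ m) ≡ false
          rowS rewrite row-of a∈ fa | row-of c∈ fc = ≤ℤ-false (pred-< yb)
          -- The 3-cycle and the transposition of i-1 and i differ by the exchange of i and i+1, and
          -- these share a row.
          near-row : ∀ {k} → Near m k → ρ (cyc3 m (suc (suc m)) (suc m) k) ≡ ρ (swapV (suc m) m k)
          near-row (inj₁ refl)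
            rewrite cyc3-1 m (suc (suc m)) (suc m) | swapV-right (suc m) m | row-of b∈ fb | row-of c∈ fc = refl
          near-row (inj₂ (inj₁ refl))
            rewrite cyc3-3 m (suc (suc m)) (suc m) m≢1 (≢-sym 1≢2) | swapV-left (suc m) m = refl
          near-row (inj₂ (inj₂ refl))
            rewrite cyc3-2 m (suc (suc m)) (suc m) m≢2 | swapV-other (suc m) m {suc (suc m)} (≢-sym 1≢2) (≢-sym m≢2)
                  | row-of b∈ fb | row-of c∈ fc = refl
          g-a : g m ≡ suc m
          g-a = cyc3-3 _ _ _ (≢-sym m≢1) (≢-sym m≢2)
          g-b : g (suc m) ≡ suc (suc m)
          g-b = cyc3-1 (suc m) (suc (suc m)) m
          g-c : g (suc (suc m)) ≡ m
          g-c = cyc3-2 _ _ _ 1≢2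
          ba-mono : Monotone g B A
          ba-mono rewrite fa | fb | g-a | g-b = (λ lt → ⊥-elim (ℕP.<-asym lt <-off₁)) , λ _ → <-off₂
          corner : ¬ Inv (g (f B)) (g (f C)) (g (f A))
          corner rewrite fa | fb | fc | g-a | g-b | g-c = λ
            { (inj₁ (p , _)) → ℕP.<-asym p <-off₁
            ; (inj₂ (inj₁ (p , _))) → ℕP.<⇒≱ <-off₂ p
            ; (inj₂ (inj₂ (_ , p))) → ℕP.<⇒≱ <-off₂ p }
          near-cell : ∀ {c} → c ∈ cs → Near m (f c) → c ≡ B ⊎ c ≡ C ⊎ c ≡ A
          near-cell d∈ d~ with locate-near d∈ d~
          ... | inj₁ eq        = inj₂ (inj₂ eq)
          ... | inj₂ (inj₁ eq) = inj₁ eq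
          ... | inj₂ (inj₂ eq) = inj₂ (inj₁ eq)
          open CornerTransfer free relabel b∈ a∈ xb<xc near-cell ba-mono corner

        last-pistoled : Pistoled cs A B C → A ≺ B → C ≺ B → Step m
        last-pistoled pist a≺b c≺b with pistoled-last a∈ b∈ c∈ fa fb fc pist a≺b c≺b
        ... | refl , refl , xc<xa = record
          { g-relabel = relabel
          ; step≡ = trans (D-dtOp pist) (dtOp-last m π (pos-mono c∈ a∈ fc fa c≺a) (pos-mono a∈ b∈ fa fb a≺b))
          ; step-row = pistoled-row (Relabel.inv relabel) (Relabel.inv-far relabel) (rows-ab a≺b) (rows-cb c≺b) rowS near-row
          ; step-free = free-map
          ; step-desc = descents-map
          }
          where
          g : ℕ → ℕ
          g = cyc3 (suc (suc m)) (suc m) m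
          relabel : Relabel m g
          relabel = cyc3-relabel _ _ _ (≢-sym 1≢2) (≢-sym m≢2) (≢-sym m≢1) (inj₂ (inj₂ refl)) (inj₂ (inj₁ refl)) (inj₁ refl)
          c≺a : C ≺ A
          c≺a = inj₂ (refl , xc<xa)
          -- In π the value i+1 comes before i-1, yet both lie in one row, and the sorted row puts
          -- i-1 first. Here π and the word with sorted rows disagree, and d̃_i compensates for it.
          rowS : (ρ (suc (suc m)) ≤ℤ ρ m) ≡ true
          rowS rewrite row-of a∈ fa | row-of c∈ fc = ≤ℤ-true ℤP.≤-refl
          near-row : ∀ {k} → Near m k → ρ (cyc3 m (suc m) (suc (suc m)) k) ≡ ρ (swapV (suc m) m k)
          near-row (inj₁ refl)
            rewrite cyc3-1 m (suc m) (suc (suc m)) | swapV-right (suc m) m = refl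
          near-row (inj₂ (inj₁ refl))
            rewrite cyc3-2 m (suc m) (suc (suc m)) m≢1 | swapV-left (suc m) m | row-of a∈ fa | row-of c∈ fc = refl
          near-row (inj₂ (inj₂ refl))
            rewrite cyc3-3 m (suc m) (suc (suc m)) m≢2 1≢2 | swapV-other (suc m) m {suc (suc m)} (≢-sym 1≢2) (≢-sym m≢2)
                  | row-of a∈ fa | row-of c∈ fc = refl
          g-a : g m ≡ suc (suc m)
          g-a = cyc3-3 _ _ _ (≢-sym m≢2) (≢-sym m≢1)
          g-b : g (suc m) ≡ m
          g-b = cyc3-2 _ _ _ (≢-sym 1≢2)
          g-c : g (suc (suc m)) ≡ suc m
          g-c = cyc3-1 (suc (suc m)) (suc m) m
          cb-mono : Monotone g C B
          cb-mono rewrite fb | fc | g-b | g-c = (λ lt → ⊥-elim (ℕP.<-asym lt <-off₂)) , λ _ → <-off₁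
          corner : ¬ Inv (g (f C)) (g (f A)) (g (f B))
          corner rewrite fa | fb | fc | g-a | g-b | g-c = λ
            { (inj₁ (_ , p)) → ℕP.<-asym p <-off₂
            ; (inj₂ (inj₁ (p , _))) → ℕP.<⇒≱ <-off₁ p
            ; (inj₂ (inj₂ (p , _))) → ℕP.<-asym p <-off₂ }
          near-cell : ∀ {c} → c ∈ cs → Near m (f c) → c ≡ C ⊎ c ≡ A ⊎ c ≡ B
          near-cell d∈ d~ with locate-near d∈ d~
          ... | inj₁ eq        = inj₂ (inj₁ eq)
          ... | inj₂ (inj₁ eq) = inj₂ (inj₂ eq)
          ... | inj₂ (inj₂ eq) = inj₁ eq
          open CornerTransfer free relabel c∈ b∈ xc<xa near-cell cb-mono corner

        pistoled? : Dec (Pistoled cs A B C)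
        pistoled? with isPistoled in eq
        ... | true  = yes (Equivalence.to isPistoled⇔ (Equivalence.from T-≡ eq))
        ... | false = no λ pist → subst T eq (Equivalence.from isPistoled⇔ pist)

      step-located : Step m
      step-located with ≺-total A≢B | ≺-total B≢C
      ... | inj₁ a≺b | inj₁ b≺c = increasing a≺b b≺c
      ... | inj₂ b≺a | inj₂ c≺b = decreasing b≺a c≺b
      ... | inj₂ b≺a | inj₁ b≺c with pistoled?
      ...   | yes pist  = first-pistoled pist b≺a b≺c
      ...   | no  ¬pist = first-plain ¬pist b≺a b≺c
      step-located | inj₁ a≺b | inj₂ c≺b with pistoled?
      ...   | yes pist  = last-pistoled pist a≺b c≺b
      ...   | no  ¬pist = last-plain ¬pist a≺b c≺b

    opaque
      step : ∀ {m} → 1 ≤ m → suc (suc m) ≤ length cs → Step m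
      step {m} 1≤m m+2≤n
        with located a∈ fa ← locate 1≤m (ℕP.≤-trans (ℕP.m≤n⇒m≤1+n (ℕP.n≤1+n m)) m+2≤n)
           | located b∈ fb ← locate {suc m} (s≤s z≤n) (ℕP.≤-trans (ℕP.n≤1+n _) m+2≤n)
           | located c∈ fc ← locate {suc (suc m)} (s≤s z≤n) m+2≤n =
        step-located a∈ b∈ c∈ fa fb fc

    sig-row : ∀ {k} → 1 ≤ k → suc k ≤ length cs → sig π k ≡ (ρ (suc k) ≤ℤ ρ k)
    sig-row {k} 1≤k k+1≤n
      with located {xa} {ya} a∈ refl ← locate 1≤k (ℕP.<⇒≤ k+1≤n)
         | located {xb} {yb} b∈ fb ← locate {suc k} (s≤s z≤n) k+1≤n
      rewrite sym fb | ρ-f a∈ | ρ-f b∈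
      with yb ℤP.≤? ya
    ... | yes yb≤ya = <⇒<ᵇ-true (f-mono a∈ b∈ (proj₁ (order-consecutive a∈ b∈ refl fb) yb≤ya))
    ... | no  yb≰ya = ≮⇒<ᵇ-false (ℕP.<-asym (f-mono b∈ a∈ (inj₁ (ℤP.≰⇒> yb≰ya))))

-- Inversion-free fillings are determined by the rows of their entries

_⊏_ : Cell → Cell → Set
(x , y) ⊏ (x' , y') = y ℤ.< y' ⊎ (y ≡ y' × x ℤ.< x')

⊏-irrefl : ∀ {c} → ¬ (c ⊏ c)
⊏-irrefl (inj₁ y<y)       = ℤP.<-irrefl refl y<y
⊏-irrefl (inj₂ (_ , x<x)) = ℤP.<-irrefl refl x<x

⊏-trans : ∀ {c d e} → c ⊏ d → d ⊏ e → c ⊏ e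
⊏-trans (inj₁ p)          (inj₁ q)          = inj₁ (ℤP.<-trans p q)
⊏-trans (inj₁ p)          (inj₂ (refl , _)) = inj₁ p
⊏-trans (inj₂ (refl , _)) (inj₁ q)          = inj₁ q
⊏-trans (inj₂ (refl , p)) (inj₂ (refl , q)) = inj₂ (refl , ℤP.<-trans p q)

-- The order is not well-founded on all of ℤ × ℤ; pulled back to the indices of a list it becomes a
-- strict order on a finite set.
⊏-rec : ∀ (cs : List Cell) (P : Cell → Set) →
  (∀ {c} → c ∈ cs → (∀ {d} → d ∈ cs → d ⊏ c → P d) → P c) → ∀ {c} → c ∈ cs → P c
⊏-rec cs P h c∈ = subst P (sym (lookup-index c∈)) (go (Any.index c∈) (spo-wellFounded isSPO _))
  where
  _⊏ᶠ_ : Fin (length cs) → Fin (length cs) → Set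
  i ⊏ᶠ j = lookup cs i ⊏ lookup cs j
  isSPO : IsStrictPartialOrder _≡_ _⊏ᶠ_
  isSPO = record
    { isEquivalence = isEquivalence
    ; irrefl        = λ { refl → ⊏-irrefl }
    ; trans         = ⊏-trans
    ; <-resp-≈      = (λ { refl p → p }) , (λ { refl p → p })
    }
  go : ∀ i → Acc _⊏ᶠ_ i → P (lookup cs i)
  go i (acc rs) = h (∈-lookup i) λ d∈ d⊏ →
    subst P (sym (lookup-index d∈))
      (go (Any.index d∈) (rs (subst (_⊏ lookup cs i) (lookup-index d∈) d⊏)))

-- Two distinct candidates for the leftmost undecided cell c of a row, each
-- occurring further right in the other filling, give opposite cyclic orders
-- with the entry below c.
cyclic-order : ∀ {u v w} → u ≢ w → v ≢ w → u ≢ v → Inv u v w ⊎ Inv v u w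
cyclic-order {u} {v} {w} u≢w v≢w u≢v with ℕP.<-cmp u v | ℕP.<-cmp u w | ℕP.<-cmp v w
... | tri≈ _ eq _ | _ | _ = ⊥-elim (u≢v eq)
... | _ | tri≈ _ eq _ | _ = ⊥-elim (u≢w eq)
... | _ | _ | tri≈ _ eq _ = ⊥-elim (v≢w eq)
... | tri< u<v _ _ | tri< u<w _ _ | tri< v<w _ _ = inj₂ (inj₂ (inj₂ (u<v , ℕP.<⇒≤ v<w)))
... | tri< u<v _ _ | tri< u<w _ _ | tri> _ _ w<v = inj₁ (inj₂ (inj₁ (ℕP.<⇒≤ u<w , w<v)))
... | tri< u<v _ _ | tri> _ _ w<u | tri< v<w _ _ = ⊥-elim (ℕP.<-asym u<v (ℕP.<-trans v<w w<u))
... | tri< u<v _ _ | tri> _ _ w<u | tri> _ _ w<v = inj₂ (inj₁ (w<u , u<v))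
... | tri> _ _ v<u | tri< u<w _ _ | tri< v<w _ _ = inj₁ (inj₂ (inj₂ (v<u , ℕP.<⇒≤ u<w)))
... | tri> _ _ v<u | tri< u<w _ _ | tri> _ _ w<v = ⊥-elim (ℕP.<-asym v<u (ℕP.<-trans u<w w<v))
... | tri> _ _ v<u | tri> _ _ w<u | tri< v<w _ _ = inj₂ (inj₂ (inj₁ (ℕP.<⇒≤ v<w , w<u)))
... | tri> _ _ v<u | tri> _ _ w<u | tri> _ _ w<v = inj₁ (inj₁ (w<v , v<u))

module Uniqueness (cs : List Cell) (cs↗ : AllPairs _≺_ cs) {π π' : Word}
  (π-perm : IsPerm (length cs) π) (π'-perm : IsPerm (length cs) π')
  (rows≡ : ∀ k → rowOfValue cs π k ≡ rowOfValue cs π' k) where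

  module F  = Filling cs cs↗ π π-perm
  module F' = Filling cs cs↗ π' π'-perm

  module _ (free : InvFree cs F.f) (free' : InvFree cs F'.f) where

    agree : ∀ {c} → c ∈ cs → F.f c ≡ F'.f c
    agree = ⊏-rec cs (λ c → F.f c ≡ F'.f c) step
      where
      step : ∀ {c} → c ∈ cs → (∀ {d} → d ∈ cs → d ⊏ c → F.f d ≡ F'.f d) → F.f c ≡ F'.f c
      step {x , y} c∈ ih with F.f (x , y) ℕP.≟ F'.f (x , y)
      ... | yes eq = eq
      ... | no  u≢v
        with 1≤u , u≤n ← F.f-range c∈ | 1≤v , v≤n ← F'.f-range c∈
        with F'.located {x₁} {y₁} d∈ fd ← F'.locate 1≤u u≤n
           | F.located {x₂} {y₂} d'∈ fd' ← F.locate 1≤v v≤n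
        -- Equal row functions put the entry of c from either filling into the row of c in the other
        -- one.
        with refl ← trans (sym (F'.ρ-f d∈)) (trans (cong (rowOfValue cs π') fd) (trans (sym (rows≡ _)) (F.ρ-f c∈)))
           | refl ← trans (sym (F.ρ-f d'∈)) (trans (cong (rowOfValue cs π) fd') (trans (rows≡ _) (F'.ρ-f c∈)))
        with ℤP.<-cmp x x₁ | ℤP.<-cmp x x₂
      ... | tri≈ _ refl _ | _ = sym fd
      ... | _ | tri≈ _ refl _ = fd'
      -- To the left of c the fillings agree by induction, so the value would occur twice in one of
      -- them.
      ... | tri> _ _ x₁<x | _ = ⊥-elim (ℤP.<-irrefl (cong proj₁ (F.f-inj d∈ c∈ (trans (ih d∈ (inj₂ (refl , x₁<x))) fd))) x₁<x)
      ... | tri< _ _ _ | tri> _ _ x₂<x = ⊥-elim (ℤP.<-irrefl (cong proj₁ (F'.f-inj d'∈ c∈ (trans (sym (ih d'∈ (inj₂ (refl , x₂<x)))) fd'))) x₂<x)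
      ... | tri< x<x₁ _ _ | tri< x<x₂ _ _ with below (x , y) ∈? cs
      ...   | no e∉ with ℕP.<-cmp (F.f (x , y)) (F'.f (x , y))
      ...     | tri≈ _ eq _  = eq
      ...     | tri< u<v _ _ = ⊥-elim (InvFree.row free' c∈ d∈ x<x₁ e∉ (subst (_< F'.f (x , y)) (sym fd) u<v))
      ...     | tri> _ _ v<u = ⊥-elim (InvFree.row free c∈ d'∈ x<x₂ e∉ (subst (_< F.f (x , y)) (sym fd') v<u))
      step {x , y} c∈ ih | no u≢v | tri< x<x₁ _ _ | tri< x<x₂ _ _ | yes e∈
        with e≡ ← ih e∈ (inj₁ (pred-< y))
        with cyclic-order
          (λ eq → pred-≢ (sym (cong proj₂ (F.f-inj c∈ e∈ eq))))
          (λ eq → pred-≢ (sym (cong proj₂ (F'.f-inj c∈ e∈ (trans eq e≡))))) u≢v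
      ... | inj₁ i rewrite sym fd' = ⊥-elim (InvFree.triple free c∈ d'∈ x<x₂ e∈ i)
      ... | inj₂ i rewrite e≡ | sym fd = ⊥-elim (InvFree.triple free' c∈ d∈ x<x₁ e∈ i)

    unique : π ≡ π'
    unique = At-ext cs (proj₁ π-perm) (proj₁ π'-perm)
      (λ c∈ → F.f _ , F.f-At c∈ , subst (λ v → At _ v cs π') (sym (agree c∈)) (F'.f-At c∈)) cs↗

-- Components of graphs over S₆

InRange : ℕ → Set
InRange i = 2 ≤ i × i ≤ 5

inRange⇒∈ : ∀ {i} → InRange i → i ∈ colours
inRange⇒∈ {2} _ = here refl
inRange⇒∈ {3} _ = there (here refl)
inRange⇒∈ {4} _ = there (there (here refl))
inRange⇒∈ {5} _ = there (there (there (here refl)))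
inRange⇒∈ {suc (suc (suc (suc (suc (suc i)))))} (_ , s≤s (s≤s (s≤s (s≤s (s≤s ())))))
inRange⇒∈ {0} (() , _)
inRange⇒∈ {1} (s≤s () , _)

signed⇒∈ : ∀ {i} → 1 ≤ i → i ≤ 5 → i ∈ 1 ∷ colours
signed⇒∈ {1} _ _ = here refl
signed⇒∈ {suc (suc i)} _ i≤5 = there (inRange⇒∈ (s≤s (s≤s z≤n) , i≤5))

table-partitions : All (λ t → IsPartition (proj₁ t) × sum (proj₁ t) ≡ 6) table
table-partitions = from-yes (all? (λ (μ , _) →
  (linked? (λ a b → b ℕ.≤? a) μ ×-dec all? (0 ℕ.<?_) μ) ×-dec (sum μ ℕP.≟ 6)) table)

IsPerm6 : Word → Set
IsPerm6 w = T (isPerm 6 w)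

module Facts (w : Word) (p : IsPerm6 w) where

  facts : RSKFacts w
  facts = All.lookup rskFacts (∈-perms 6 w (isPerm⇒IsPerm 6 w p))

  insertion-perm : IsPerm6 (insertionWord w)
  insertion-perm = proj₁ facts

  insertion-tableau : T (isSYTword 6 (shape w) (insertionWord w))
  insertion-tableau = proj₁ (proj₂ facts)

  shape∈table : ∃ λ t → t ∈ table × shape w ≡ proj₁ t
  shape∈table = find (proj₁ (proj₂ (proj₂ facts)))

  insertion-sig : ∀ {i} → 1 ≤ i → i ≤ 5 → sig (insertionWord w) i ≡ sig w i
  insertion-sig 1≤i i≤5 = All.lookup (proj₁ (proj₂ (proj₂ (proj₂ facts)))) (signed⇒∈ 1≤i i≤5)

  path-range : All InRange (path (insertionWord w))
  path-range = proj₁ (proj₂ (proj₂ (proj₂ (proj₂ facts))))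

  equivariant : ∀ {i} → InRange i → Equivariant w i
  equivariant i∈ = All.lookup (proj₁ (proj₂ (proj₂ (proj₂ (proj₂ (proj₂ facts)))))) (inRange⇒∈ i∈)

  canonical : ∀ {t} → t ∈ table → Canonical w t
  canonical = All.lookup (proj₂ (proj₂ (proj₂ (proj₂ (proj₂ (proj₂ facts))))))

dOp-perm : ∀ {i} → InRange i → ∀ w → IsPerm6 w → IsPerm6 (dOp i w)
dOp-perm i∈ w w! = proj₁ (proj₂ (proj₂ (Facts.equivariant w w! i∈)))

dOp-involutive : ∀ {i} → InRange i → ∀ w → IsPerm6 w → dOp i (dOp i w) ≡ w
dOp-involutive i∈ w w! = proj₁ (proj₂ (proj₂ (proj₂ (Facts.equivariant w w! i∈))))

insertion-dOp : ∀ {i} → InRange i → ∀ w → IsPerm6 w → insertionWord (dOp i w) ≡ dOp i (insertionWord w)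
insertion-dOp i∈ w w! = proj₁ (Facts.equivariant w w! i∈)

shape-dOp : ∀ {i} → InRange i → ∀ w → IsPerm6 w → shape (dOp i w) ≡ shape w
shape-dOp i∈ w w! = proj₁ (proj₂ (Facts.equivariant w w! i∈))

path-dOp : ∀ {i} → InRange i → ∀ w → IsPerm6 w →
  run (path (insertionWord (dOp i w))) (dOp i w) ≡ run (path (insertionWord w)) w
path-dOp i∈ w w! = proj₂ (proj₂ (proj₂ (proj₂ (Facts.equivariant w w! i∈))))

run-++ : ∀ p q w → run (p ++ q) w ≡ run q (run p w)
run-++ []      q w = refl
run-++ (i ∷ p) q w = run-++ p q (dOp i w)

run-reverse : ∀ {p} → All InRange p → ∀ w → IsPerm6 w → run (reverse p) (run p w) ≡ w
run-reverse             []        w w! = refl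
run-reverse {p = i ∷ p} (i∈ ∷ p∈) w w! = begin
  run (reverse (i ∷ p)) (run p (dOp i w))      ≡⟨ cong (λ q → run q (run p (dOp i w))) (unfold-reverse i p) ⟩
  run (reverse p ++ [ i ]) (run p (dOp i w))   ≡⟨ run-++ (reverse p) [ i ] (run p (dOp i w)) ⟩
  dOp i (run (reverse p) (run p (dOp i w)))    ≡⟨ cong (dOp i) (run-reverse p∈ (dOp i w) (dOp-perm i∈ w w!)) ⟩
  dOp i (dOp i w)                              ≡⟨ dOp-involutive i∈ w w! ⟩
  w                                            ∎
  where open ≡-Reasoning

insertion-run : ∀ {p} → All InRange p → ∀ w → IsPerm6 w → insertionWord (run p w) ≡ run p (insertionWord w)
insertion-run             []        w w! = refl
insertion-run {p = i ∷ p} (i∈ ∷ p∈) w w! =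
  trans (insertion-run p∈ (dOp i w) (dOp-perm i∈ w w!)) (cong (run p) (insertion-dOp i∈ w w!))

-- word covers the graph of S₆; every component lies in one ≈-class, on which
-- word is injective.
record LocalModel (G : SCG 6) : Set₁ where
  field
    act           : ℕ → V G → V G
    word          : V G → Word
    word-perm     : ∀ v → IsPerm6 (word v)
    act-word      : ∀ {i} → InRange i → ∀ v → word (act i v) ≡ dOp i (word v)
    act-involutive : ∀ {i} → InRange i → ∀ v → act i (act i v) ≡ v
    _≈_           : V G → V G → Set
    ≈-equiv       : IsEquivalence _≈_
    act-≈         : ∀ {i} → InRange i → ∀ v → act i v ≈ v
    word-injective : ∀ {v w} → v ≈ w → word v ≡ word w → v ≡ w
    edge          : ∀ {i} → InRange i → ∀ v w → E G i v w ⇔ (v ≢ w × (w ≡ act i v ⊎ v ≡ act i w))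
    sign          : ∀ {i} → 1 ≤ i → i ≤ 5 → ∀ v → σ G v i ≡ sig (word v) i

module Components {G : SCG 6} (M : LocalModel G) where
  open LocalModel M
  module ≈ = IsEquivalence ≈-equiv

  acts : Word → V G → V G
  acts []      v = v
  acts (i ∷ p) v = acts p (act i v)

  acts-word : ∀ {p} → All InRange p → ∀ v → word (acts p v) ≡ run p (word v)
  acts-word             []        v = refl
  acts-word {p = i ∷ p} (i∈ ∷ p∈) v = trans (acts-word p∈ (act i v)) (cong (run p) (act-word i∈ v))

  acts-≈ : ∀ {p} → All InRange p → ∀ v → acts p v ≈ v
  acts-≈             []        v = ≈.refl
  acts-≈ {p = i ∷ p} (i∈ ∷ p∈) v = ≈.trans (acts-≈ p∈ (act i v)) (act-≈ i∈ v)

  acts-++ : ∀ p q v → acts (p ++ q) v ≡ acts q (acts p v)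
  acts-++ []      q v = refl
  acts-++ (i ∷ p) q v = acts-++ p q (act i v)

  acts-reverse : ∀ {p} → All InRange p → ∀ v → acts (reverse p) (acts p v) ≡ v
  acts-reverse             []        v = refl
  acts-reverse {p = i ∷ p} (i∈ ∷ p∈) v = begin
    acts (reverse (i ∷ p)) (acts p (act i v))     ≡⟨ cong (λ q → acts q (acts p (act i v))) (unfold-reverse i p) ⟩
    acts (reverse p ++ [ i ]) (acts p (act i v))  ≡⟨ acts-++ (reverse p) [ i ] _ ⟩
    act i (acts (reverse p) (acts p (act i v)))   ≡⟨ cong (act i) (acts-reverse p∈ (act i v)) ⟩
    act i (act i v)                               ≡⟨ act-involutive i∈ v ⟩
    v                                             ∎
    where open ≡-Reasoning

  -- A move may fix the word; then it fixes the vertex, since both lie in one ≈-class, and the walk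
  -- is empty.
  reach-act : ∀ {i} → InRange i → ∀ v → Reach G v (act i v)
  reach-act {i} i∈ v with word v ≟ʷ word (act i v)
  ... | yes eq = subst (Reach G v) (word-injective (≈.sym (act-≈ i∈ v)) eq) ε
  ... | no ≢ = (i , proj₁ i∈ , proj₂ i∈ , inj₁ (Equivalence.from (edge i∈ v (act i v)) ((λ eq → ≢ (cong word eq)) , inj₁ refl))) ◅ ε

  reach-acts : ∀ {p} → All InRange p → ∀ v → Reach G v (acts p v)
  reach-acts             []        v = ε
  reach-acts {p = i ∷ p} (i∈ ∷ p∈) v = reach-act i∈ v ◅◅ reach-acts p∈ (act i v)

  adj⇒act : ∀ {v w} → Adj G v w → ∃ λ i → InRange i × w ≡ act i v
  adj⇒act {v} {w} (i , 2≤i , i≤5 , inj₁ e) with Equivalence.to (edge (2≤i , i≤5) v w) e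
  ... | _ , inj₁ eq = i , (2≤i , i≤5) , eq
  ... | _ , inj₂ eq = i , (2≤i , i≤5) , trans (sym (act-involutive (2≤i , i≤5) w)) (cong (act i) (sym eq))
  adj⇒act {v} {w} (i , 2≤i , i≤5 , inj₂ e) with Equivalence.to (edge (2≤i , i≤5) w v) e
  ... | _ , inj₂ eq = i , (2≤i , i≤5) , eq
  ... | _ , inj₁ eq = i , (2≤i , i≤5) , trans (sym (act-involutive (2≤i , i≤5) w)) (cong (act i) (sym eq))

  tableau : V G → Word
  tableau v = insertionWord (word v)

  path∈ : ∀ v → All InRange (path (tableau v))
  path∈ v = Facts.path-range (word v) (word-perm v)

  -- The base point of the component: by `path-dOp` neighbours have roots with equal words, and
  -- these roots are equal because they lie in one ≈-class.
  root : V G → V G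
  root v = acts (path (tableau v)) v

  root-act : ∀ {i} → InRange i → ∀ v → root (act i v) ≡ root v
  root-act {i} i∈ v = word-injective
    (≈.trans (acts-≈ (path∈ (act i v)) (act i v)) (≈.trans (act-≈ i∈ v) (≈.sym (acts-≈ (path∈ v) v))))
    (begin
      word (root (act i v))                                                ≡⟨ acts-word (path∈ (act i v)) (act i v) ⟩
      run (path (insertionWord (word (act i v)))) (word (act i v))         ≡⟨ cong (λ w → run (path (insertionWord w)) w) (act-word i∈ v) ⟩
      run (path (insertionWord (dOp i (word v)))) (dOp i (word v))         ≡⟨ path-dOp i∈ (word v) (word-perm v) ⟩
      run (path (insertionWord (word v))) (word v)                         ≡⟨ acts-word (path∈ v) v ⟨
      word (root v)                                                        ∎)
    where open ≡-Reasoning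

  shape-act : ∀ {i} → InRange i → ∀ v → shape (word (act i v)) ≡ shape (word v)
  shape-act i∈ v = trans (cong shape (act-word i∈ v)) (shape-dOp i∈ (word v) (word-perm v))

  reach-root : ∀ {v w} → Reach G v w → root w ≡ root v
  reach-root ε = refl
  reach-root (a ◅ as) with i , i∈ , refl ← adj⇒act a = trans (reach-root as) (root-act i∈ _)

  reach-shape : ∀ {v w} → Reach G v w → shape (word w) ≡ shape (word v)
  reach-shape ε = refl
  reach-shape (a ◅ as) with i , i∈ , refl ← adj⇒act a = trans (reach-shape as) (shape-act i∈ _)

  module AtVertex (v : V G) (μ : List ℕ) (c : Word) (t∈ : (μ , c) ∈ table) (shape≡ : shape (word v) ≡ μ) where

    Tableau : Word → Set
    Tableau h = IsPerm6 h × T (isSYTword 6 μ h)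

    tableau-path : ∀ {h} → Tableau h → insertionWord h ≡ h × All InRange (path h) × run (path h) h ≡ c
    tableau-path {h} (h! , h-syt) with Facts.canonical h h! t∈ h-syt
    ... | P≡ , _ , run≡ = P≡ , subst (λ w → All InRange (path w)) P≡ (Facts.path-range h h!) , run≡

    reach-tableau : ∀ {w} → Reach G v w → Tableau (tableau w)
    reach-tableau {w} r = Facts.insertion-perm (word w) (word-perm w) ,
      subst (λ ν → T (isSYTword 6 ν (tableau w))) (trans (reach-shape r) shape≡)
        (Facts.insertion-tableau (word w) (word-perm w))

    -- Inverse to `tableau` on the component of `v`. The root has tableau `c`, the end of the path
    -- of every tableau of this shape, so walking that path backwards from the root yields the
    -- vertex with tableau `h`.
    place : Word → V G
    place h = acts (reverse (path h)) (root v)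

    reverse-range : ∀ {p} → All InRange p → All InRange (reverse p)
    reverse-range p∈ = All.tabulate (λ i∈ → All.lookup p∈ (AnyP.reverse⁻ i∈))

    reach-place : ∀ {h} → Tableau h → Reach G v (place h)
    reach-place h-tab with _ , p∈ , _ ← tableau-path h-tab =
      reach-acts (path∈ v) v ◅◅ reach-acts (reverse-range p∈) (root v)

    tableau-root : tableau (root v) ≡ c
    tableau-root = begin
      insertionWord (word (root v))                 ≡⟨ cong insertionWord (acts-word (path∈ v) v) ⟩
      insertionWord (run (path (tableau v)) (word v)) ≡⟨ insertion-run (path∈ v) (word v) (word-perm v) ⟩
      run (path (tableau v)) (tableau v)            ≡⟨ proj₂ (proj₂ (tableau-path (reach-tableau ε))) ⟩
      c                                             ∎
      where open ≡-Reasoning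

    tableau-place : ∀ {h} → Tableau h → tableau (place h) ≡ h
    tableau-place {h} h-tab@(h! , _) with _ , p∈ , run≡ ← tableau-path h-tab = begin
      insertionWord (word (place h))                        ≡⟨ cong insertionWord (acts-word (reverse-range p∈) (root v)) ⟩
      insertionWord (run (reverse (path h)) (word (root v))) ≡⟨ insertion-run (reverse-range p∈) (word (root v)) (word-perm (root v)) ⟩
      run (reverse (path h)) (tableau (root v))             ≡⟨ cong (run (reverse (path h))) (trans tableau-root (sym run≡)) ⟩
      run (reverse (path h)) (run (path h) h)               ≡⟨ run-reverse p∈ h h! ⟩
      h                                                     ∎
      where open ≡-Reasoning

    place-tableau : ∀ {w} → Reach G v w → place (tableau w) ≡ w
    place-tableau {w} r = trans (cong (acts (reverse (path (tableau w)))) (sym (reach-root r))) (acts-reverse (path∈ w) w)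

    tableau-act : ∀ {i} → InRange i → ∀ {h} → Tableau h → tableau (act i (place h)) ≡ dOp i h
    tableau-act {i} i∈ {h} h-tab = begin
      insertionWord (word (act i (place h)))  ≡⟨ cong insertionWord (act-word i∈ (place h)) ⟩
      insertionWord (dOp i (word (place h)))  ≡⟨ insertion-dOp i∈ (word (place h)) (word-perm (place h)) ⟩
      dOp i (tableau (place h))               ≡⟨ cong (dOp i) (tableau-place h-tab) ⟩
      dOp i h                                 ∎
      where open ≡-Reasoning

    -- Equivariance of the inverse comes from that of `tableau`, since the moved vertex is still in
    -- the component, where `place` undoes `tableau`.
    place-dOp : ∀ {i} → InRange i → ∀ {h} → Tableau h → place (dOp i h) ≡ act i (place h)
    place-dOp i∈ {h} h-tab = trans (cong place (sym (tableau-act i∈ h-tab)))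
      (place-tableau (reach-place h-tab ◅◅ reach-act i∈ (place h)))

    dOp-place : ∀ {i} → InRange i → ∀ {h h'} → Tableau h → Tableau h' → place h' ≡ act i (place h) → h' ≡ dOp i h
    dOp-place i∈ h-tab h'-tab eq = trans (sym (tableau-place h'-tab)) (trans (cong tableau eq) (tableau-act i∈ h-tab))

    vertex : V (Gλ 6 μ) → Word
    vertex h = proj₁ (proj₁ h)

    vertex-tableau : ∀ h → Tableau (vertex h)
    vertex-tableau ((h , h!) , h-syt) = h! , h-syt

    vertex-injective : ∀ h h' → vertex h ≡ vertex h' → h ≡ h'
    vertex-injective ((h , p) , q) ((.h , p') , q') refl with refl ← T-irrelevant p p' with refl ← T-irrelevant q q' = refl

    place-injective : ∀ h h' → place (vertex h) ≡ place (vertex h') → vertex h ≡ vertex h'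
    place-injective h h' eq = trans (sym (tableau-place (vertex-tableau h)))
      (trans (cong tableau eq) (tableau-place (vertex-tableau h')))

    place-edge : ∀ {i} → InRange i → ∀ h h' →
      E G i (place (vertex h)) (place (vertex h')) ⇔ E (Gλ 6 μ) i h h'
    place-edge {i} i∈ h h' = mk⇔ to from
      where
      to : E G i (place (vertex h)) (place (vertex h')) → E (Gλ 6 μ) i h h'
      to e with ≢ , eq ← Equivalence.to (edge i∈ _ _) e =
        (λ h≡h' → ≢ (cong place h≡h')) ,
        Sum.map (dOp-place i∈ (vertex-tableau h) (vertex-tableau h'))
                (dOp-place i∈ (vertex-tableau h') (vertex-tableau h)) eq
      from : E (Gλ 6 μ) i h h' → E G i (place (vertex h)) (place (vertex h'))
      from (≢ , eq) = Equivalence.from (edge i∈ _ _)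
        ( (λ p≡p' → ≢ (place-injective h h' p≡p'))
        , Sum.map (λ e → trans (cong place e) (place-dOp i∈ (vertex-tableau h)))
                  (λ e → trans (cong place e) (place-dOp i∈ (vertex-tableau h'))) eq)

    place-sign : ∀ h i → 1 ≤ i → i ≤ 5 → σ G (place (vertex h)) i ≡ sig (vertex h) i
    place-sign h i 1≤i i≤5 = begin
      σ G (place (vertex h)) i           ≡⟨ sign 1≤i i≤5 (place (vertex h)) ⟩
      sig (word (place (vertex h))) i    ≡⟨ Facts.insertion-sig (word (place (vertex h))) (word-perm _) 1≤i i≤5 ⟨
      sig (tableau (place (vertex h))) i ≡⟨ cong (λ w → sig w i) (tableau-place (vertex-tableau h)) ⟩
      sig (vertex h) i                   ∎
      where open ≡-Reasoning

    componentIso : ComponentIso G v (Gλ 6 μ)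
    componentIso =
        (λ h → place (vertex h))
      , (λ h h' eq → vertex-injective h h' (place-injective h h' eq))
      , (λ w r → let (h! , h-syt) = reach-tableau r in ((tableau w , h!) , h-syt) , place-tableau r)
      , (λ h → reach-place (vertex-tableau h))
      , place-sign
      , (λ h h' i 2≤i i≤5 → place-edge (2≤i , i≤5) h h')

  standard : ∀ v → ∃ λ μ → IsPartition μ × sum μ ≡ 6 × ComponentIso G v (Gλ 6 μ)
  standard v with (μ , c) , t∈ , shape≡ ← Facts.shape∈table (word v) (word-perm v)
    with partition , sum≡6 ← All.lookup table-partitions t∈ =
    μ , partition , sum≡6 , AtVertex.componentIso v μ c t∈ shape≡

-- Words of rows

≤ℤ-true⁻ : ∀ {x y} → (x ≤ℤ y) ≡ true → x ℤ.≤ y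
≤ℤ-true⁻ {x} {y} eq = toWitness {a? = x ℤP.≤? y} (Equivalence.from T-≡ eq)

≤ℤ-false⁻ : ∀ {x y} → (x ≤ℤ y) ≡ false → y ℤ.< x
≤ℤ-false⁻ {x} {y} eq = ℤP.≰⇒> (λ x≤y → case≢ (trans (sym eq) (≤ℤ-true x≤y)))
  where
  case≢ : false ≡ true → ⊥
  case≢ ()

rowDual-relabel : ∀ m r → Relabel m (rowDual m r)
rowDual-relabel m r =
  dual-relabel (r (suc m) ≤ℤ r m) (r (suc (suc m)) ≤ℤ r (suc m)) (r (suc (suc m)) ≤ℤ r m) m

rowDual-involutive : ∀ m r k → rowDual m r (rowDual m r k) ≡ k
rowDual-involutive m r =
  dual-involutive (r (suc m) ≤ℤ r m) (r (suc (suc m)) ≤ℤ r (suc m)) (r (suc (suc m)) ≤ℤ r m) m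

rowDual-cong : ∀ m {r r'} → (∀ {k} → Near m k → r k ≡ r' k) → ∀ k → rowDual m r k ≡ rowDual m r' k
rowDual-cong m h k
  rewrite h (inj₁ refl) | h (inj₂ (inj₁ refl)) | h (inj₂ (inj₂ refl)) = refl

module SwapValues (m : ℕ) where
  m≢1 : m ≢ suc m
  m≢1 = ℕP.<⇒≢ (ℕP.n<1+n m)
  1≢2 : suc m ≢ suc (suc m)
  1≢2 = ℕP.<⇒≢ (ℕP.n<1+n (suc m))
  m≢2 : m ≢ suc (suc m)
  m≢2 = ℕP.<⇒≢ (ℕP.m<n⇒m<1+n (ℕP.n<1+n m))
  upper-a : swapV (suc m) (suc (suc m)) m ≡ m
  upper-a = swapV-other (suc m) (suc (suc m)) m≢1 m≢2
  upper-b : swapV (suc m) (suc (suc m)) (suc m) ≡ suc (suc m)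
  upper-b = swapV-left (suc m) (suc (suc m))
  upper-c : swapV (suc m) (suc (suc m)) (suc (suc m)) ≡ suc m
  upper-c = swapV-right (suc m) (suc (suc m))
  lower-a : swapV (suc m) m m ≡ suc m
  lower-a = swapV-right (suc m) m
  lower-b : swapV (suc m) m (suc m) ≡ m
  lower-b = swapV-left (suc m) m
  lower-c : swapV (suc m) m (suc (suc m)) ≡ suc (suc m)
  lower-c = swapV-other (suc m) m (≢-sym 1≢2) (≢-sym m≢2)

-- Applying the prescribed transposition reverses the case but prescribes the
-- same transposition again.
rowDual-stable : ∀ m r k → rowDual m (λ j → r (rowDual m r j)) k ≡ rowDual m r k
rowDual-stable m r k
  with r (suc m) ≤ℤ r m in P | r (suc (suc m)) ≤ℤ r (suc m) in Q | r (suc (suc m)) ≤ℤ r m in S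
... | false | true | true
  rewrite SwapValues.upper-a m | SwapValues.upper-b m | SwapValues.upper-c m | S
        | ≤ℤ-false (ℤP.≤-<-trans (≤ℤ-true⁻ S) (≤ℤ-false⁻ P)) | P = refl
... | false | true | false
  rewrite SwapValues.lower-a m | SwapValues.lower-b m | SwapValues.lower-c m | S | Q
        | ≤ℤ-true (ℤP.<⇒≤ (≤ℤ-false⁻ P)) = refl
... | true | false | true
  rewrite SwapValues.lower-a m | SwapValues.lower-b m | SwapValues.lower-c m | S | Q
        | ≤ℤ-false (ℤP.<-≤-trans (≤ℤ-false⁻ Q) (≤ℤ-true⁻ S)) = refl
... | true | false | false
  rewrite SwapValues.upper-a m | SwapValues.upper-b m | SwapValues.upper-c m | S
        | ≤ℤ-true (ℤP.<⇒≤ (≤ℤ-false⁻ Q)) | P = refl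
... | true | true | s rewrite P | Q = refl
... | false | false | s rewrite P | Q = refl

-- The two values exchanged are consecutive integers in different rows: in each case the row
-- comparisons that prescribe the exchange contain a strict one separating them.
rowDual-mono : ∀ m r {j k} → r j ≡ r k → j < k → rowDual m r j < rowDual m r k
rowDual-mono m r {j} {k} eq j<k = Relabel.mono-unless-near (rowDual-relabel m r) near j<k
  where
  near : Near m j → Near m k → rowDual m r j < rowDual m r k
  near j~ k~ with r (suc m) ≤ℤ r m in P | r (suc (suc m)) ≤ℤ r (suc m) in Q | r (suc (suc m)) ≤ℤ r m in S
  ... | false | true | true = swapV-mono-upper j~ k~
    (λ { refl refl → ℤP.<-irrefl (sym eq) (ℤP.≤-<-trans (≤ℤ-true⁻ S) (≤ℤ-false⁻ P)) }) j<k
  ... | false | true | false = swapV-mono-lower j~ k~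
    (λ { refl refl → ℤP.<-irrefl eq (≤ℤ-false⁻ P) }) j<k
  ... | true | false | true = swapV-mono-lower j~ k~
    (λ { refl refl → ℤP.<-irrefl (sym eq) (ℤP.<-≤-trans (≤ℤ-false⁻ Q) (≤ℤ-true⁻ S)) }) j<k
  ... | true | false | false = swapV-mono-upper j~ k~
    (λ { refl refl → ℤP.<-irrefl eq (≤ℤ-false⁻ Q) }) j<k
  ... | true | true | s = j<k
  ... | false | false | s = j<k

dual-suc : ∀ p q s m k → dual p q s (suc m) (suc k) ≡ suc (dual p q s m k)
dual-suc p q s m k = go p q s
  where
  swapV-suc : ∀ a b → swapV (suc a) (suc b) (suc k) ≡ suc (swapV a b k)
  swapV-suc a b with k ℕ.≡ᵇ a | k ℕ.≡ᵇ b
  ... | true  | _     = refl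
  ... | false | true  = refl
  ... | false | false = refl
  go : ∀ p q s → dual p q s (suc m) (suc k) ≡ suc (dual p q s m k)
  go false true  true  = swapV-suc (suc m) (suc (suc m))
  go false true  false = swapV-suc (suc m) m
  go true  false true  = swapV-suc (suc m) m
  go true  false false = swapV-suc (suc m) (suc (suc m))
  go true  true  s     = refl
  go false false s     = refl

-- Translation invariance, which allows the window b+1, ..., b+6 to be renumbered as 1, ..., 6.
rowDual-shift : ∀ b m r k → rowDual (b + m) r (b + k) ≡ b + rowDual m (λ j → r (b + j)) k
rowDual-shift zero    m r k = refl
rowDual-shift (suc b) m r k = trans
  (dual-suc (r (suc (suc (b + m))) ≤ℤ r (suc (b + m))) (r (suc (suc (suc (b + m)))) ≤ℤ r (suc (suc (b + m))))
            (r (suc (suc (suc (b + m)))) ≤ℤ r (suc (b + m))) (b + m) (b + k))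
  (cong suc (rowDual-shift b m (λ j → r (suc j)) k))

-- The word of six values with every row sorted

Before : (ℕ → ℤ) → ℕ → ℕ → Set
Before r j k = r k ℤ.< r j ⊎ (r j ≡ r k × j < k)

Before-asym : ∀ r {j k} → Before r j k → ¬ Before r k j
Before-asym r (inj₁ p)        (inj₁ q)        = ℤP.<-asym p q
Before-asym r (inj₁ p)        (inj₂ (eq , _)) = ℤP.<-irrefl eq p
Before-asym r (inj₂ (eq , _)) (inj₁ q)        = ℤP.<-irrefl eq q
Before-asym r (inj₂ (_ , p))  (inj₂ (_ , q))  = ℕP.<-asym p q

Before-trans : ∀ (r : ℕ → ℤ) {j k l} → Before r j k → Before r k l → Before r j l
Before-trans r (inj₁ p)        (inj₁ q)         = inj₁ (ℤP.<-trans q p)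
Before-trans r (inj₁ p)        (inj₂ (eq , _))  = inj₁ (subst (ℤ._< r _) eq p)
Before-trans r (inj₂ (eq , _)) (inj₁ q)         = inj₁ (subst (r _ ℤ.<_) (sym eq) q)
Before-trans r (inj₂ (eq , p)) (inj₂ (eq' , q)) = inj₂ (trans eq eq' , ℕP.<-trans p q)

Before-total : ∀ r {j k} → j ≢ k → Before r j k ⊎ Before r k j
Before-total r {j} {k} j≢k with ℤP.<-cmp (r j) (r k)
... | tri< lt _ _ = inj₂ (inj₁ lt)
... | tri> _ _ gt = inj₁ (inj₁ gt)
... | tri≈ _ eq _ with ℕP.<-cmp j k
...   | tri< j<k _ _ = inj₁ (inj₂ (eq , j<k))
...   | tri≈ _ j≡k _ = ⊥-elim (j≢k j≡k)
...   | tri> _ _ k<j = inj₂ (inj₂ (sym eq , k<j))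

Sorting : (ℕ → ℤ) → Word → Set
Sorting r w = IsPerm 6 w × AllPairs (Before r) w

insertSorted : ∀ r x w → All (x ≢_) w → AllPairs (Before r) w →
  ∃ λ w' → x ∷ w ↭ w' × AllPairs (Before r) w'
insertSorted r x []      _            _            = x ∷ [] , ↭-refl , [] ∷ []
insertSorted r x (y ∷ w) (x≢y ∷ x≢w) (y<w ∷ w↗) with Before-total r x≢y
... | inj₁ x<y = x ∷ y ∷ w , ↭-refl , (x<y ∷ All.map (Before-trans r x<y) y<w) ∷ y<w ∷ w↗
... | inj₂ y<x with w' , p , w'↗ ← insertSorted r x w x≢w w↗ =
  y ∷ w' , ↭-trans (swap x y ↭-refl) (prep y p) , All-resp-↭ p (y<x ∷ y<w) ∷ w'↗

sortWord : ∀ r w → Unique w → ∃ λ w' → w ↭ w' × AllPairs (Before r) w'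
sortWord r []      _          = [] , ↭-refl , []
sortWord r (x ∷ w) (x≢ ∷ w!) with w₁ , p , w₁↗ ← sortWord r w w!
  with w₂ , q , w₂↗ ← insertSorted r x w₁ (All-resp-↭ p x≢) w₁↗ =
  w₂ , ↭-trans (prep x p) q , w₂↗

identity6 : Word
identity6 = 1 ∷ 2 ∷ 3 ∷ 4 ∷ 5 ∷ 6 ∷ []

opaque
  sorting : ∀ r → ∃ (Sorting r)
  sorting r with id6 ← isPerm⇒IsPerm 6 identity6 _
    with w , p , w↗ ← sortWord r identity6 (perm-unique id6) =
    w , (trans (sym (↭-length p)) (proj₁ id6) , λ 1≤k k≤6 → ∈-resp-↭ p (proj₂ id6 1≤k k≤6)) , w↗

sorted-unique : ∀ {R : ℕ → ℕ → Set} → (∀ {j k} → R j k → ¬ R k j) → ∀ {u v} →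
  AllPairs R u → AllPairs R v → (∀ {k} → k ∈ u → k ∈ v) → (∀ {k} → k ∈ v → k ∈ u) → u ≡ v
sorted-unique asym {[]}    {[]}    _ _ _ _ = refl
sorted-unique asym {[]}    {y ∷ v} _ _ _ g with () ← g (here refl)
sorted-unique asym {x ∷ u} {[]}    _ _ f _ with () ← f (here refl)
sorted-unique {R} asym {x ∷ u} {y ∷ v} (x< ∷ u↗) (y< ∷ v↗) f g with heads (f (here refl)) (g (here refl))
  where
  heads : x ∈ y ∷ v → y ∈ x ∷ u → x ≡ y
  heads (here eq)  _          = eq
  heads (there _)  (here eq)  = sym eq
  heads (there x∈) (there y∈) = ⊥-elim (asym (All.lookup x< y∈) (All.lookup y< x∈))
... | refl = cong (x ∷_) (sorted-unique asym u↗ v↗ (λ k∈ → tail x< k∈ (f (there k∈))) (λ k∈ → tail y< k∈ (g (there k∈))))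
  where
  tail : ∀ {k u v} → All (R x) u → k ∈ u → k ∈ x ∷ v → k ∈ v
  tail x<u k∈u (here refl) = let xx = All.lookup x<u k∈u in ⊥-elim (asym xx xx)
  tail _   _   (there k∈)  = k∈

Sorting-unique : ∀ r {u v} → Sorting r u → Sorting r v → u ≡ v
Sorting-unique r (u! , u↗) (v! , v↗) = sorted-unique (Before-asym r) u↗ v↗
  (λ k∈ → let (1≤k , k≤6) = perm-range u! k∈ in proj₂ v! 1≤k k≤6)
  (λ k∈ → let (1≤k , k≤6) = perm-range v! k∈ in proj₂ u! 1≤k k≤6)

sorted-pos : ∀ r {w j k} → AllPairs (Before r) w → j ∈ w → k ∈ w → Before r j k → pos j w < pos k w
sorted-pos r _ (here refl) (here refl) jj = ⊥-elim (Before-asym r jj jj)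
sorted-pos r {k = k} (j< ∷ _) (here {x = j} refl) (there k∈) jk
  rewrite ≡ᵇ-refl j | ≢⇒≡ᵇ-false {k} {j} (λ { refl → Before-asym r jk jk }) = s≤s z≤n
sorted-pos r (k< ∷ _) (there j∈) (here refl) jk = ⊥-elim (Before-asym r jk (All.lookup k< j∈))
sorted-pos r {x ∷ w} {j} {k} (x< ∷ w↗) (there j∈) (there k∈) jk
  rewrite ≢⇒≡ᵇ-false {j} {x} (λ { refl → let jj = All.lookup x< j∈ in Before-asym r jj jj })
        | ≢⇒≡ᵇ-false {k} {x} (λ { refl → let kk = All.lookup x< k∈ in Before-asym r kk kk }) =
  s≤s (sorted-pos r w↗ j∈ k∈ jk)

module Sorted (r : ℕ → ℤ) {w : Word} (w-sorting : Sorting r w) where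

  private
    ∈w : ∀ {k} → 1 ≤ k → k ≤ 6 → k ∈ w
    ∈w = proj₂ (proj₁ w-sorting)

  order : ∀ {j k} → 1 ≤ j → j < k → k ≤ 6 → (pos j w <ᵇ pos k w) ≡ (r k ≤ℤ r j)
  order {j} {k} 1≤j j<k k≤6
    with j∈ ← ∈w 1≤j (ℕP.<⇒≤ (ℕP.<-≤-trans j<k k≤6)) | k∈ ← ∈w (ℕP.≤-trans 1≤j (ℕP.<⇒≤ j<k)) k≤6
    with ℤP.<-cmp (r j) (r k)
  ... | tri< lt _ _ = trans (≮⇒<ᵇ-false (ℕP.<-asym (sorted-pos r (proj₂ w-sorting) k∈ j∈ (inj₁ lt)))) (sym (≤ℤ-false lt))
  ... | tri≈ _ eq _ = trans (<⇒<ᵇ-true (sorted-pos r (proj₂ w-sorting) j∈ k∈ (inj₂ (eq , j<k)))) (sym (≤ℤ-true (ℤP.≤-reflexive (sym eq))))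
  ... | tri> _ _ gt = trans (<⇒<ᵇ-true (sorted-pos r (proj₂ w-sorting) j∈ k∈ (inj₁ gt))) (sym (≤ℤ-true (ℤP.<⇒≤ gt)))

  distinct : ∀ {j k} → 1 ≤ j → j < k → k ≤ 6 → pos j w ≢ pos k w
  distinct {j} {k} 1≤j j<k k≤6 eq
    with j∈ ← ∈w 1≤j (ℕP.<⇒≤ (ℕP.<-≤-trans j<k k≤6)) | k∈ ← ∈w (ℕP.≤-trans 1≤j (ℕP.<⇒≤ j<k)) k≤6
    with Before-total r (ℕP.<⇒≢ j<k)
  ... | inj₁ jk = ℕP.<-irrefl eq (sorted-pos r (proj₂ w-sorting) j∈ k∈ jk)
  ... | inj₂ kj = ℕP.<-irrefl (sym eq) (sorted-pos r (proj₂ w-sorting) k∈ j∈ kj)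

  dOp-rowDual : ∀ {m} → 1 ≤ m → suc (suc m) ≤ 6 → dOp (suc m) w ≡ map (rowDual m r) w
  dOp-rowDual {m} 1≤m m+2≤6 = trans
    (dOp-dual m w (distinct 1≤m m<1 (ℕP.<⇒≤ m+2≤6)) (distinct (s≤s z≤n) 1<2 m+2≤6))
    (cong (λ h → map h w) (dual-cong m (order 1≤m m<1 (ℕP.<⇒≤ m+2≤6))
      (order (s≤s z≤n) 1<2 m+2≤6) (order 1≤m (ℕP.<-trans m<1 1<2) m+2≤6)))
    where
    m<1 : m < suc m
    m<1 = ℕP.n<1+n m
    1<2 : suc m < suc (suc m)
    1<2 = ℕP.n<1+n (suc m)

  -- The relabelling carries each value's old row to the new value at the same place, so rows still
  -- descend along the word; ties stay increasing by `rowDual-mono`. Hence sorting commutes with the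
  -- move.
  rowDual-sorting : ∀ {m r'} → 1 ≤ m → suc (suc m) ≤ 6 → (∀ k → r' k ≡ r (rowDual m r k)) →
    Sorting r' (map (rowDual m r) w)
  rowDual-sorting {m} {r'} 1≤m m+2≤6 r'≡ =
    Relabel.relabel-perm (rowDual-relabel m r) 1≤m m+2≤6 (proj₁ w-sorting) ,
    AllPairsP.map⁺ (AllPairs.map relabel (proj₂ w-sorting))
    where
    r'-dual : ∀ k → r' (rowDual m r k) ≡ r k
    r'-dual k = trans (r'≡ (rowDual m r k)) (cong r (rowDual-involutive m r k))
    relabel : ∀ {j k} → Before r j k → Before r' (rowDual m r j) (rowDual m r k)
    relabel {j} {k} (inj₁ lt) rewrite r'-dual j | r'-dual k = inj₁ lt
    relabel {j} {k} (inj₂ (eq , j<k)) = inj₂ (trans (r'-dual j) (trans eq (sym (r'-dual k))) , rowDual-mono m r eq j<k)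

-- Dual equivalence for graphs whose vertices are determined by row functions moved by `rowDual`

record RowModel {n : ℕ} (G : SCG n) : Set where
  field
    rows      : V G → ℕ → ℤ
    rows-injective : ∀ {v w} → (∀ k → rows v k ≡ rows w k) → v ≡ w
    step      : ℕ → V G → V G
    step-rows : ∀ {m} → 1 ≤ m → suc (suc m) ≤ n → ∀ v k → rows (step m v) k ≡ rows v (rowDual m (rows v) k)
    edge      : ∀ {m} → 1 ≤ m → suc (suc m) ≤ n → ∀ v w →
                E G (suc m) v w ⇔ (v ≢ w × (w ≡ step m v ⊎ v ≡ step m w))
    sign      : ∀ {k} → 1 ≤ k → suc k ≤ n → ∀ v → σ G v k ≡ (rows v (suc k) ≤ℤ rows v k)

module DualEquivalence {n : ℕ} {G : SCG n} (M : RowModel G) where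
  open RowModel M

  module _ {m : ℕ} (1≤m : 1 ≤ m) (m+2≤n : suc (suc m) ≤ n) where

    -- After one step the rows prescribe the same transposition again, so the second step undoes the
    -- first, with no case distinction on pistols.
    step-involutive : ∀ v → step m (step m v) ≡ v
    step-involutive v = rows-injective λ k → begin
      rows (step m (step m v)) k                            ≡⟨ step-rows 1≤m m+2≤n (step m v) k ⟩
      rows (step m v) (rowDual m (rows (step m v)) k)       ≡⟨ cong (rows (step m v)) (rowDual-cong m (λ {j} _ → step-rows 1≤m m+2≤n v j) k) ⟩
      rows (step m v) (rowDual m (λ j → rows v (rowDual m (rows v) j)) k) ≡⟨ cong (rows (step m v)) (rowDual-stable m (rows v) k) ⟩
      rows (step m v) (rowDual m (rows v) k)                ≡⟨ step-rows 1≤m m+2≤n v _ ⟩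
      rows v (rowDual m (rows v) (rowDual m (rows v) k))    ≡⟨ cong (rows v) (rowDual-involutive m (rows v) k) ⟩
      rows v k                                              ∎
      where open ≡-Reasoning

    edge⇒step : ∀ {v w} → E G (suc m) v w → v ≢ w × w ≡ step m v
    edge⇒step {v} {w} e with Equivalence.to (edge 1≤m m+2≤n v w) e
    ... | v≢w , inj₁ eq = v≢w , eq
    ... | v≢w , inj₂ eq = v≢w , trans (sym (step-involutive w)) (cong (step m) (sym eq))

    step⇒edge : ∀ {v w} → v ≢ w → w ≡ step m v → E G (suc m) v w
    step⇒edge {v} {w} v≢w eq = Equivalence.from (edge 1≤m m+2≤n v w) (v≢w , inj₁ eq)

  relabel-commute : ∀ {l m g h} → Relabel l g → Relabel m h → (∀ {k} → Near l k → ¬ Near m k) →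
    ∀ k → g (h k) ≡ h (g k)
  relabel-commute {l} {m} {g} {h} G' H disjoint k with near-or-not l k | near-or-not m k
  ... | inj₁ k~l | _ = trans (cong g (Relabel.far H (disjoint k~l))) (sym (Relabel.far H (disjoint (Relabel.near G' k~l))))
  ... | inj₂ k≁l | inj₁ k~m = trans (Relabel.far G' (λ p → disjoint p (Relabel.near H k~m))) (cong h (sym (Relabel.far G' (far-not-near k≁l))))
  ... | inj₂ k≁l | inj₂ k≁m = trans (cong g (Relabel.far H (far-not-near k≁m)))
    (trans (Relabel.far G' (far-not-near k≁l)) (sym (trans (cong h (Relabel.far G' (far-not-near k≁l))) (Relabel.far H (far-not-near k≁m)))))

  module _ {l m : ℕ} (1≤l : 1 ≤ l) (l+2≤n : suc (suc l) ≤ n) (1≤m : 1 ≤ m) (m+2≤n : suc (suc m) ≤ n)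
           (disjoint : ∀ {k} → Near l k → ¬ Near m k) where

    -- The first step leaves the rows of the second triple alone, so both transpositions can be read
    -- off from the original vertex.
    step-step : ∀ v k → rows (step m (step l v)) k ≡ rows v (rowDual l (rows v) (rowDual m (rows v) k))
    step-step v k = begin
      rows (step m (step l v)) k                       ≡⟨ step-rows 1≤m m+2≤n (step l v) k ⟩
      rows (step l v) (rowDual m (rows (step l v)) k)  ≡⟨ cong (rows (step l v)) (rowDual-cong m unchanged k) ⟩
      rows (step l v) (rowDual m (rows v) k)           ≡⟨ step-rows 1≤l l+2≤n v _ ⟩
      rows v (rowDual l (rows v) (rowDual m (rows v) k)) ∎
      where
      open ≡-Reasoning
      unchanged : ∀ {j} → Near m j → rows (step l v) j ≡ rows v j
      unchanged {j} j~m = trans (step-rows 1≤l l+2≤n v j)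
        (cong (rows v) (Relabel.far (rowDual-relabel l (rows v)) (λ j~l → disjoint j~l j~m)))

  step-commute : ∀ {l m} → 1 ≤ l → suc (suc l) ≤ n → 1 ≤ m → suc (suc m) ≤ n →
    (∀ {k} → Near l k → ¬ Near m k) → ∀ v → step m (step l v) ≡ step l (step m v)
  step-commute {l} {m} 1≤l l+2≤n 1≤m m+2≤n disjoint v = rows-injective λ k →
    trans (step-step 1≤l l+2≤n 1≤m m+2≤n disjoint v k)
      (trans (cong (rows v) (relabel-commute (rowDual-relabel l (rows v)) (rowDual-relabel m (rows v)) disjoint k))
        (sym (step-step 1≤m m+2≤n 1≤l l+2≤n (λ p q → disjoint q p) v k)))

  distant⇒disjoint : ∀ {l m} → 2 < ∣ l - m ∣ → ∀ {k} → Near l k → ¬ Near m k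
  distant⇒disjoint {l} {m} lt {k} k~l k~m with ℕP.≤-total l m
  ... | inj₁ l≤m = ℕP.<⇒≱ lt (subst (_≤ 2) (sym (ℕP.m≤n⇒∣m-n∣≡n∸m l≤m))
    (ℕP.m≤n+o⇒m∸n≤o m l (ℕP.≤-trans (near-lower k~m) (subst (k ≤_) (ℕP.+-comm 2 l) (near-upper k~l)))))
  ... | inj₂ m≤l = ℕP.<⇒≱ lt (subst (_≤ 2) (sym (ℕP.m≤n⇒∣n-m∣≡n∸m m≤l))
    (ℕP.m≤n+o⇒m∸n≤o l m (ℕP.≤-trans (near-lower k~l) (subst (k ≤_) (ℕP.+-comm 2 m) (near-upper k~m)))))

  ≤∸1⇒< : ∀ {i n} → 1 ≤ i → i ≤ n ∸ 1 → suc i ≤ n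
  ≤∸1⇒< {n = zero}  1≤i i≤0 = ⊥-elim (ℕP.<⇒≱ 1≤i i≤0)
  ≤∸1⇒< {n = suc n} _   i≤n = s≤s i≤n

  commuting : Commuting G
  commuting (suc l) (suc m) (s≤s 1≤l) l≤ (s≤s 1≤m) m≤ far v w x e e'
    with l+2≤n ← ≤∸1⇒< (s≤s z≤n) l≤ | m+2≤n ← ≤∸1⇒< (s≤s z≤n) m≤
    with v≢w , refl ← edge⇒step 1≤l l+2≤n e
    with w≢x , refl ← edge⇒step 1≤m m+2≤n e' =
    -- The fourth corner of the square. If `step m` fixed v, commutation would make it fix w,
    -- contrary to w ≢ x; likewise x = y would give w = v.
    step m v ,
    step⇒edge 1≤m m+2≤n (λ eq → w≢x (trans (cong (step l) eq) (sym commute))) refl ,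
    step⇒edge 1≤l l+2≤n
      (λ eq → v≢w (trans (sym (step-involutive 1≤m m+2≤n v))
        (trans (cong (step m) (sym eq)) (step-involutive 1≤m m+2≤n (step l v)))))
      (trans (sym (step-involutive 1≤l l+2≤n (step m v))) (cong (step l) (sym commute)))
    where
    commute : step m (step l v) ≡ step l (step m v)
    commute = step-commute 1≤l (≤∸1⇒< (s≤s z≤n) l≤) 1≤m (≤∸1⇒< (s≤s z≤n) m≤) (distant⇒disjoint far) v

  module Local (b : ℕ) (b+6≤n : b + 6 ≤ n) where

    local : V G → ℕ → ℤ
    local v k = rows v (b + k)

    word : V G → Word
    word v = proj₁ (sorting (local v))

    word-sorting : ∀ v → Sorting (local v) (word v)
    word-sorting v = proj₂ (sorting (local v))

    -- The local colour m+1 is the colour b+m+1 of `G`, whose smallest moved value is b+m.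
    act : ℕ → V G → V G
    act zero    v = v
    act (suc m) v = step (b + m) v

    module _ {m : ℕ} (1≤m : 1 ≤ m) (m+2≤6 : suc (suc m) ≤ 6) where

      1≤b+m : 1 ≤ b + m
      1≤b+m = ℕP.≤-trans 1≤m (ℕP.m≤n+m m b)

      b+m+2≤n : suc (suc (b + m)) ≤ n
      b+m+2≤n = ℕP.≤-trans (ℕP.≤-reflexive (sym (trans (ℕP.+-suc b (suc m)) (cong suc (ℕP.+-suc b m)))))
        (ℕP.≤-trans (ℕP.+-monoʳ-≤ b m+2≤6) b+6≤n)

      act-local : ∀ v k → local (act (suc m) v) k ≡ local v (rowDual m (local v) k)
      act-local v k = trans (step-rows 1≤b+m b+m+2≤n v (b + k)) (cong (rows v) (rowDual-shift b m (rows v) k))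

      act-map : ∀ v → word (act (suc m) v) ≡ map (rowDual m (local v)) (word v)
      act-map v = Sorting-unique (local (act (suc m) v)) (word-sorting (act (suc m) v))
        (Sorted.rowDual-sorting (local v) (word-sorting v) 1≤m m+2≤6 (act-local v))

      act-dOp : ∀ v → word (act (suc m) v) ≡ dOp (suc m) (word v)
      act-dOp v = trans (act-map v) (sym (Sorted.dOp-rowDual (local v) (word-sorting v) 1≤m m+2≤6))

    InWindow : ℕ → Set
    InWindow k = ∃ λ j → 1 ≤ j × j ≤ 6 × k ≡ b + j

    inWindow? : ∀ k → Dec (InWindow k)
    inWindow? k with suc b ℕ.≤? k | k ℕ.≤? b + 6
    ... | no b≮k | _ = no λ (j , 1≤j , _ , eq) →
      b≮k (subst (suc b ≤_) (sym eq) (subst (_≤ b + j) (ℕP.+-comm b 1) (ℕP.+-monoʳ-≤ b 1≤j)))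
    ... | _ | no k≰b+6 = no λ (j , _ , j≤6 , eq) → k≰b+6 (subst (_≤ b + 6) (sym eq) (ℕP.+-monoʳ-≤ b j≤6))
    ... | yes b<k | yes k≤b+6 = yes
      ( k ∸ b , ℕP.m<n⇒0<n∸m b<k , ℕP.m≤n+o⇒m∸n≤o k b k≤b+6
      , sym (ℕP.m+[n∸m]≡n (ℕP.<⇒≤ b<k)))

    rowWord : V G → List ℤ
    rowWord v = map (local v) (word v)

    -- `rowWord` lists the rows of the window from the top with multiplicity. A move redistributes
    -- the six values over these rows without changing the list, and `word` tells which value has
    -- which entry of the list. So within a class the word recovers all rows.
    record _≈_ (v w : V G) : Set where
      constructor same
      field
        inside  : rowWord v ≡ rowWord w
        outside : ∀ {k} → ¬ InWindow k → rows v k ≡ rows w k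

    ≈-equiv : IsEquivalence _≈_
    ≈-equiv = record
      { refl  = same refl (λ _ → refl)
      ; sym   = λ (same p q) → same (sym p) (λ k∉ → sym (q k∉))
      ; trans = λ (same p q) (same p' q') → same (trans p p') (λ k∉ → trans (q k∉) (q' k∉))
      }

    near-window : ∀ {m} → 1 ≤ m → suc (suc m) ≤ 6 → ∀ {k} → Near (b + m) k → InWindow k
    near-window {m} 1≤m m+2≤6 (inj₁ eq) = m , 1≤m , ℕP.≤-trans (ℕP.≤-trans (ℕP.n≤1+n m) (ℕP.n≤1+n (suc m))) m+2≤6 , eq
    near-window {m} 1≤m m+2≤6 (inj₂ (inj₁ eq)) = suc m , s≤s z≤n , ℕP.≤-trans (ℕP.n≤1+n (suc m)) m+2≤6 , trans eq (sym (ℕP.+-suc b m))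
    near-window {m} 1≤m m+2≤6 (inj₂ (inj₂ eq)) = suc (suc m) , s≤s z≤n , m+2≤6 ,
      trans eq (sym (trans (ℕP.+-suc b (suc m)) (cong suc (ℕP.+-suc b m))))

    act-≈ : ∀ {m} → 1 ≤ m → suc (suc m) ≤ 6 → ∀ v → act (suc m) v ≈ v
    act-≈ {m} 1≤m m+2≤6 v = same inside outside
      where
      open ≡-Reasoning
      inside : rowWord (act (suc m) v) ≡ rowWord v
      inside = begin
        map (local (act (suc m) v)) (word (act (suc m) v))                 ≡⟨ cong (map (local (act (suc m) v))) (act-map 1≤m m+2≤6 v) ⟩
        map (local (act (suc m) v)) (map (rowDual m (local v)) (word v))   ≡⟨ map-∘ (word v) ⟨
        map (λ k → local (act (suc m) v) (rowDual m (local v) k)) (word v)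
          ≡⟨ map-cong (λ k → trans (act-local 1≤m m+2≤6 v (rowDual m (local v) k)) (cong (local v) (rowDual-involutive m (local v) k))) (word v) ⟩
        map (local v) (word v)                                             ∎
      outside : ∀ {k} → ¬ InWindow k → rows (act (suc m) v) k ≡ rows v k
      outside {k} k∉ = trans (step-rows (1≤b+m 1≤m m+2≤6) (b+m+2≤n 1≤m m+2≤6) v k)
        (cong (rows v) (Relabel.far (rowDual-relabel (b + m) (rows v)) (λ k~ → k∉ (near-window 1≤m m+2≤6 k~))))

    map-equal : ∀ {f g : ℕ → ℤ} w → map f w ≡ map g w → ∀ {k} → k ∈ w → f k ≡ g k
    map-equal (x ∷ w) eq (here refl) = proj₁ (∷-injective eq)
    map-equal (x ∷ w) eq (there k∈)  = map-equal w (proj₂ (∷-injective eq)) k∈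

    word-injective : ∀ {v w} → v ≈ w → word v ≡ word w → v ≡ w
    word-injective {v} {w} (same inside outside) eq = rows-injective pointwise
      where
      pointwise : ∀ k → rows v k ≡ rows w k
      pointwise k with inWindow? k
      ... | no k∉ = outside k∉
      ... | yes (j , 1≤j , j≤6 , refl) =
        map-equal (word v) (trans inside (cong (map (local w)) (sym eq))) (proj₂ (proj₁ (word-sorting v)) 1≤j j≤6)

    act-involutive : ∀ {m} → 1 ≤ m → suc (suc m) ≤ 6 → ∀ v → act (suc m) (act (suc m) v) ≡ v
    act-involutive 1≤m m+2≤6 = step-involutive (1≤b+m 1≤m m+2≤6) (b+m+2≤n 1≤m m+2≤6)

    act-edge : ∀ {m} → 1 ≤ m → suc (suc m) ≤ 6 → ∀ v w →
      E G (b + suc m) v w ⇔ (v ≢ w × (w ≡ act (suc m) v ⊎ v ≡ act (suc m) w))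
    act-edge {m} 1≤m m+2≤6 v w rewrite ℕP.+-suc b m = edge (1≤b+m 1≤m m+2≤6) (b+m+2≤n 1≤m m+2≤6) v w

    word-sign : ∀ {i} → 1 ≤ i → i ≤ 5 → ∀ v → σ G v (b + i) ≡ sig (word v) i
    word-sign {i} 1≤i i≤5 v = begin
      σ G v (b + i)                              ≡⟨ sign (ℕP.≤-trans 1≤i (ℕP.m≤n+m i b)) (ℕP.≤-trans (ℕP.≤-reflexive (sym (ℕP.+-suc b i))) (ℕP.≤-trans (ℕP.+-monoʳ-≤ b (s≤s i≤5)) b+6≤n)) v ⟩
      (rows v (suc (b + i)) ≤ℤ rows v (b + i))   ≡⟨ cong (λ k → rows v k ≤ℤ rows v (b + i)) (ℕP.+-suc b i) ⟨
      (local v (suc i) ≤ℤ local v i)             ≡⟨ Sorted.order (local v) (word-sorting v) 1≤i (ℕP.n<1+n i) (s≤s i≤5) ⟨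
      sig (word v) i                             ∎
      where open ≡-Reasoning

    localModel : LocalModel (restrict G (suc b) 6)
    localModel = record
      { act            = act
      ; word           = word
      ; word-perm      = λ v → IsPerm⇒isPerm 6 (word v) (proj₁ (word-sorting v))
      ; act-word       = λ { {suc m} (s≤s 1≤m , m<5) → act-dOp 1≤m (s≤s m<5) }
      ; act-involutive = λ { {suc m} (s≤s 1≤m , m<5) → act-involutive 1≤m (s≤s m<5) }
      ; _≈_            = _≈_
      ; ≈-equiv        = ≈-equiv
      ; act-≈          = λ { {suc m} (s≤s 1≤m , m<5) → act-≈ 1≤m (s≤s m<5) }
      ; word-injective = word-injective
      ; edge           = λ { {suc m} (s≤s 1≤m , m<5) → act-edge 1≤m (s≤s m<5) }
      ; sign           = word-sign
      }

  locallyStandard : LocallyStandard G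
  locallyStandard (suc b) _ a+5≤n =
    Components.standard (Local.localModel b (ℕP.≤-trans (ℕP.≤-reflexive (ℕP.+-suc b 5)) a+5≤n))

  isDEG : IsDEG G
  isDEG = locallyStandard , commuting

-- The graphs of a diagram

-- Covers both vertex sets at once: a step preserves inversion-freeness and the descent set, and a
-- condition that survives under these two is all that an induced subgraph closed under the steps
-- requires.
module Induced (δ : Diagram) (Good : V (Hδ δ) → Set)
  (good-irrelevant : ∀ {v} (p q : Good v) → p ≡ q)
  (good⇒inv≡0 : ∀ {v} → Good v → invδ δ (proj₁ v) ≡ 0)
  (good-transfer : ∀ {v w} → Good v → invδ δ (proj₁ w) ≡ 0 →
     Descentδ δ (proj₁ w) ≡ Descentδ δ (proj₁ v) → Good w) where

  private
    cs = cells δ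
    n = length cs
    G = induced (Hδ δ) Good

  reading : V G → Word
  reading v = proj₁ (proj₁ v)

  -- Edges compare words, the row model compares vertices; irrelevance of the attached proofs
  -- identifies the two.
  reading-injective : ∀ {v w} → reading v ≡ reading w → v ≡ w
  reading-injective {(π , p) , g} {(.π , p') , g'} refl
    with refl ← T-irrelevant p p' with refl ← good-irrelevant g g' = refl

  reading-perm : ∀ v → IsPerm n (reading v)
  reading-perm v = isPerm⇒IsPerm n (reading v) (proj₂ (proj₁ v))

  reading-free : ∀ v → InvFree cs (val cs (reading v))
  reading-free v = invW≡0⇒InvFree cs (reading v) (good⇒inv≡0 (proj₂ v))

  stepOf : ∀ v {m} → 1 ≤ m → suc (suc m) ≤ n → Filling.Step cs (sorted δ) (reading v) (reading-perm v) (reading-free v) m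
  stepOf v = Filling.step cs (sorted δ) (reading v) (reading-perm v) (reading-free v)

  inBounds? : ∀ m → Dec (1 ≤ m × suc (suc m) ≤ n)
  inBounds? m = (1 ≤? m) ×-dec (suc (suc m) ≤? n)

  move : ∀ v {m} → 1 ≤ m → suc (suc m) ≤ n → V G
  move v 1≤m m+2≤n =
    (map g (reading v) , IsPerm⇒isPerm n _ (Relabel.relabel-perm g-relabel 1≤m m+2≤n (reading-perm v))) ,
    good-transfer (proj₂ v) (InvFree⇒invW≡0 cs _ step-free) step-desc
    where open Filling.Step (stepOf v 1≤m m+2≤n)

  step : ℕ → V G → V G
  step m v with inBounds? m
  ... | yes (1≤m , m+2≤n) = move v 1≤m m+2≤n
  -- Steps are total in m, with the identity as default where i-1, i, i+1 are not all values of the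
  -- filling.
  ... | no _ = v

  step-move : ∀ {m} (1≤m : 1 ≤ m) (m+2≤n : suc (suc m) ≤ n) v → step m v ≡ move v 1≤m m+2≤n
  step-move {m} 1≤m m+2≤n v with inBounds? m
  ... | yes (p , q) = cong₂ (λ a b → move v a b) (ℕP.≤-irrelevant p 1≤m) (ℕP.≤-irrelevant q m+2≤n)
  ... | no out = ⊥-elim (out (1≤m , m+2≤n))

  rows : V G → ℕ → ℤ
  rows v = rowOfValue cs (reading v)

  reading-step : ∀ {m} → 1 ≤ m → suc (suc m) ≤ n → ∀ v → reading (step m v) ≡ Dδ cs (suc m) (reading v)
  reading-step 1≤m m+2≤n v = trans (cong reading (step-move 1≤m m+2≤n v)) (sym step≡)
    where open Filling.Step (stepOf v 1≤m m+2≤n)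

  step-rows : ∀ {m} → 1 ≤ m → suc (suc m) ≤ n → ∀ v k → rows (step m v) k ≡ rows v (rowDual m (rows v) k)
  step-rows 1≤m m+2≤n v k = trans (cong (λ u → rows u k) (step-move 1≤m m+2≤n v))
    (trans (cong (λ p → rowOf (cellAt cs p)) (Relabel.pos-relabel g-relabel k (reading v))) (step-row k))
    where open Filling.Step (stepOf v 1≤m m+2≤n)

  step-edge : ∀ {m} → 1 ≤ m → suc (suc m) ≤ n → ∀ v w → E G (suc m) v w ⇔ (v ≢ w × (w ≡ step m v ⊎ v ≡ step m w))
  step-edge 1≤m m+2≤n v w = mk⇔
    (λ (≢ , eq) → (λ v≡w → ≢ (cong reading v≡w)) , Sum.map (to v w) (to w v) eq)
    (λ (≢ , eq) → (λ r≡ → ≢ (reading-injective r≡)) , Sum.map (from v) (from w) eq)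
    where
    to : ∀ v w → reading w ≡ Dδ cs _ (reading v) → w ≡ step _ v
    to v w eq = reading-injective (trans eq (sym (reading-step 1≤m m+2≤n v)))
    from : ∀ v {w} → w ≡ step _ v → reading w ≡ Dδ cs _ (reading v)
    from v refl = reading-step 1≤m m+2≤n v

  rowModel : RowModel G
  rowModel = record
    { rows           = rows
    ; rows-injective = λ {v} {w} rows≡ → reading-injective
        (Uniqueness.unique cs (sorted δ) (reading-perm v) (reading-perm w) rows≡ (reading-free v) (reading-free w))
    ; step           = step
    ; step-rows      = step-rows
    ; edge           = step-edge
    ; sign           = λ 1≤k k<n v →
        Filling.sig-row cs (sorted δ) (reading v) (reading-perm v) (reading-free v) 1≤k k<n
    }

theorem3p2 : (γ δ : Diagram) → γ ⊆ᴰ δ → IsDEG (Pδ δ) × IsDEG (Rγδ γ δ)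
theorem3p2 γ δ _ =
    DualEquivalence.isDEG (Induced.rowModel δ (λ v → invδ δ (proj₁ v) ≡ 0)
      ℕP.≡-irrelevant (λ p → p) (λ _ q _ → q))
  , DualEquivalence.isDEG (Induced.rowModel δ (λ v → (invδ δ (proj₁ v) ≡ 0) × (Descentδ δ (proj₁ v) ≡ cells γ))
      (λ (p , q) (p' , q') → cong₂ _,_ (ℕP.≡-irrelevant p p') (cells-irrelevant q q'))
      proj₁ (λ (_ , d) q d' → q , trans d' d))
  where
  cells-irrelevant : ∀ {xs ys : List Cell} (p q : xs ≡ ys) → p ≡ q
  cells-irrelevant = Decidable⇒UIP.≡-irrelevant (ListP.≡-dec (×P.≡-dec ℤP._≟_ ℤP._≟_))
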